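{- Let $\gamma\ge 2$ be an integer. There is an algorithm that, given an instance, queries a set $\mathrm{ALG}$ of edges and transforms the instance into a prediction mandatory free instance, such that $$|\mathrm{ALG}|\le\min\left\{\left(1+\tfrac{1}{\gamma}\right)\cdot\Big(|(\mathrm{ALG}\cup D)\cap\mathrm{OPT}|+k^+(\mathrm{ALG})+k^-(\mathrm{ALG})\Big),\ \gamma\cdot|(\mathrm{ALG}\cup D)\cap\mathrm{OPT}|+\gamma-2\right\}$$ for some set $D\subseteq E\setminus\mathrm{ALG}$ of unqueried edges that do not occur in the remaining instance after executing the algorithm.
   Context: MST problem under explorable uncertainty with predictions: a connected (multi)graph $G=(V,E)$; each edge $e$ has unknown true weight $w_e\in\mathbb{R}_+$ and known uncertainty interval $I_e$, either open $(L_e,U_e)\ni w_e$ or trivial $\{w_e\}$ (then $L_e=U_e=w_e$). Querying $e$ reveals $w_e$. $Q\subseteq E$ is a feasible query set if some spanning tree is a minimum spanning tree for every weight assignment equal to $w_e$ on $Q$ and arbitrary in $I_e$ outside $Q$; $\mathrm{OPT}$ is a minimum-cardinality feasible query set. Predictions $\hat w_e\in I_e$ are given. For distinct edges $e,e'$, $k_{e'}(e)=0$ if $w_e$ and $\hat w_e$ lie in the same one of the regions $(-\infty,L_{e'}]$, $(L_{e'},U_{e'})$, $[U_{e'},\infty)$, else $k_{e'}(e)=1$; $k^+(e)=\sum_{e'\ne e}k_{e'}(e)$, $k^-(e)=\sum_{e'\ne e}k_e(e')$, and $k^{\pm}(E')=\sum_{e\in E'}k^{\pm}(e)$ for $E'\subseteq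 E$. An edge is prediction mandatory if it belongs to every feasible query set under the hypothesis that all true values equal the predictions; an instance is prediction mandatory free if it has none. During the algorithm, edges whose weights are known to be maximal on a cycle may be deleted and edges known to be minimal in a cut may be contracted without loss of generality; the "remaining instance" is the graph after such deletions/contractions, and the edges of $D$ are removed in this way without being queried.
   Formalization: The edge weights, the endpoints of the uncertainty intervals and the predicted weights are rational numbers instead of real numbers (with lower limits assumed nonnegative, which the proof does not use). -}

module Defs where

open import Data.Bool using (Bool; true; false; if_then_else_; _∧_; _∨_; not)
open import Data.Nat as ℕ using (ℕ; zero; suc)
open import Data.Fin using (Fin; zero; suc)
open import Data.Fin.Properties using () renaming (_≟_ to _≟ᶠ_)
open import Data.Rational using (ℚ; 0ℚ; _+_; _≤_; _<_)
open import Data.Rational.Properties using (_≤?_; _<?_)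
open import Data.Maybe using (Maybe; just; nothing; is-just)
open import Data.Product using (Σ; ∃; _×_; _,_; proj₁; proj₂; map)
open import Data.Sum using (_⊎_)
open import Data.List using (List; []; _∷_)
open import Data.List.Membership.Propositional using (_∈_)
open import Data.List.Relation.Unary.Unique.Propositional using (Unique)
open import Relation.Binary.PropositionalEquality using (_≡_; _≢_)
open import Relation.Nullary using (¬_)
open import Relation.Nullary.Decidable using (⌊_⌋)

Σℕ : ∀ {m} → (Fin m → ℕ) → ℕ
Σℕ {zero}  f = 0
Σℕ {suc m} f = f zero ℕ.+ Σℕ (λ i → f (suc i))

Σℚ : ∀ {m} → (Fin m → ℚ) → ℚ
Σℚ {zero}  f = 0ℚ
Σℚ {suc m} f = f zero + Σℚ (λ i → f (suc i))

EdgeSet : ℕ → Set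
EdgeSet m = Fin m → Bool

∣_∣ : ∀ {m} → EdgeSet m → ℕ
∣ S ∣ = Σℕ (λ e → if S e then 1 else 0)

_∪_ : ∀ {m} → EdgeSet m → EdgeSet m → EdgeSet m
(S ∪ T) e = S e ∨ T e

_∩_ : ∀ {m} → EdgeSet m → EdgeSet m → EdgeSet m
(S ∩ T) e = S e ∧ T e

_⊆_ : ∀ {m} → EdgeSet m → EdgeSet m → Set
S ⊆ T = ∀ e → S e ≡ true → T e ≡ true

data Interval : Set where
  pt : ℚ → Interval
  op : ℚ → ℚ → Interval

lo : Interval → ℚ
lo (pt a)   = a
lo (op l u) = l

hi : Interval → ℚ
hi (pt a)   = a
hi (op l u) = u

_∈I_ : ℚ → Interval → Set
x ∈I pt a   = x ≡ a
x ∈I op l u = (l < x) × (x < u)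

-- (Multi)graphs on vertex set {v ∈ Fin n | active v}, edges {e ∈ Fin m | present e}

record Graph (n m : ℕ) : Set where
  field
    ends    : Fin m → Fin n × Fin n
    active  : Fin n → Bool
    present : EdgeSet m
open Graph public

Joins : ∀ {n m} → Graph n m → Fin m → Fin n → Fin n → Set
Joins g e u v = (ends g e ≡ (u , v)) ⊎ (ends g e ≡ (v , u))

data Walk {n m} (g : Graph n m) (S : EdgeSet m) : Fin n → Fin n → List (Fin m) → Set where
  []  : ∀ {v} → Walk g S v v []
  _∷_ : ∀ {u v w es} e → (S e ≡ true) × (present g e ≡ true) × Joins g e u v
        → Walk g S v w es → Walk g S u w (e ∷ es)

Cycle : ∀ {n m} → Graph n m → EdgeSet m → List (Fin m) → Set
Cycle g S es = (es ≢ []) × Unique es × ∃ λ v → Walk g S v v es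

SpanningTree : ∀ {n m} → Graph n m → EdgeSet m → Set
SpanningTree g T =
  (T ⊆ present g) ×
  (∀ es → ¬ Cycle g T es) ×
  (∀ u v → active g u ≡ true → active g v ≡ true → ∃ λ es → Walk g T u v es)

Connected : ∀ {n m} → Graph n m → Set
Connected g = ∀ u v → active g u ≡ true → active g v ≡ true →
              ∃ λ es → Walk g (present g) u v es

weightOf : ∀ {m} → EdgeSet m → (Fin m → ℚ) → ℚ
weightOf T x = Σℚ (λ e → if T e then x e else 0ℚ)

MST : ∀ {n m} → Graph n m → (Fin m → ℚ) → EdgeSet m → Set
MST g x T = SpanningTree g T ×
            (∀ T′ → SpanningTree g T′ → weightOf T x ≤ weightOf T′ x)

Feasible : ∀ {n m} → Graph n m → (Fin m → Interval) → (Fin m → ℚ) → EdgeSet m → Set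
Feasible {m = m} g I v Q =
  (Q ⊆ present g) ×
  ∃ λ T → ∀ (x : Fin m → ℚ) →
    (∀ e → present g e ≡ true →
       (Q e ≡ true → x e ≡ v e) × (Q e ≡ false → x e ∈I I e)) →
    MST g x T

fullGraph : ∀ {n m} → (Fin m → Fin n × Fin n) → Graph n m
fullGraph ends = record { ends = ends ; active = λ _ → true ; present = λ _ → true }

IsOPT : ∀ {n m} → (Fin m → Fin n × Fin n) → (Fin m → Interval) → (Fin m → ℚ) → EdgeSet m → Set
IsOPT ends I w OPT = Feasible (fullGraph ends) I w OPT ×
                     (∀ Q → Feasible (fullGraph ends) I w Q → ∣ OPT ∣ ℕ.≤ ∣ Q ∣)

_≤ᵇ_ _<ᵇ_ : ℚ → ℚ → Bool
p ≤ᵇ q = ⌊ p ≤? q ⌋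
p <ᵇ q = ⌊ p <? q ⌋

sameRegion : ℚ → ℚ → ℚ → ℚ → Bool
sameRegion a b L U =
  (a ≤ᵇ L ∧ b ≤ᵇ L) ∨ ((L <ᵇ a ∧ a <ᵇ U) ∧ (L <ᵇ b ∧ b <ᵇ U)) ∨ (U ≤ᵇ a ∧ U ≤ᵇ b)

kOf : ∀ {m} → (Fin m → Interval) → (Fin m → ℚ) → (Fin m → ℚ) → Fin m → Fin m → ℕ
kOf I w ŵ e′ e = if sameRegion (w e) (ŵ e) (lo (I e′)) (hi (I e′)) then 0 else 1

k⁺ : ∀ {m} → (Fin m → Interval) → (Fin m → ℚ) → (Fin m → ℚ) → Fin m → ℕ
k⁺ I w ŵ e = Σℕ (λ e′ → if ⌊ e′ ≟ᶠ e ⌋ then 0 else kOf I w ŵ e′ e)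

k⁻ : ∀ {m} → (Fin m → Interval) → (Fin m → ℚ) → (Fin m → ℚ) → Fin m → ℕ
k⁻ I w ŵ e = Σℕ (λ e′ → if ⌊ e′ ≟ᶠ e ⌋ then 0 else kOf I w ŵ e e′)

k⁺Set k⁻Set : ∀ {m} → (Fin m → Interval) → (Fin m → ℚ) → (Fin m → ℚ) → EdgeSet m → ℕ
k⁺Set I w ŵ S = Σℕ (λ e → if S e then k⁺ I w ŵ e else 0)
k⁻Set I w ŵ S = Σℕ (λ e → if S e then k⁻ I w ŵ e else 0)

-- Adaptive query algorithms.
-- An algorithm sees the public data (graph, intervals, predictions) and the
-- values revealed so far, and either queries an edge (just e) or stops.

Algorithm : Set
Algorithm = ∀ {n m} → (Fin m → Fin n × Fin n) → (Fin m → Interval) → (Fin m → ℚ)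
            → (Fin m → Maybe ℚ) → Maybe (Fin m)

reveal : ∀ {m} → (Fin m → ℚ) → (Fin m → Maybe ℚ) → Fin m → Fin m → Maybe ℚ
reveal w r e f = if ⌊ f ≟ᶠ e ⌋ then just (w f) else r f

run : ∀ {n m} → Algorithm → (Fin m → Fin n × Fin n) → (Fin m → Interval) → (Fin m → ℚ)
      → (w : Fin m → ℚ) → ℕ → (Fin m → Maybe ℚ) → (Fin m → Maybe ℚ)
run A ends I ŵ w zero    r = r
run A ends I ŵ w (suc k) r with A ends I ŵ r
... | nothing = r
... | just e  = run A ends I ŵ w k (reveal w r e)

finalState : ∀ {n m} → Algorithm → (Fin m → Fin n × Fin n) → (Fin m → Interval) → (Fin m → ℚ)
             → (Fin m → ℚ) → (Fin m → Maybe ℚ)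
finalState {m = m} A ends I ŵ w = run A ends I ŵ w m (λ _ → nothing)

Halts : ∀ {n m} → Algorithm → (Fin m → Fin n × Fin n) → (Fin m → Interval) → (Fin m → ℚ)
        → (Fin m → ℚ) → Set
Halts A ends I ŵ w = A ends I ŵ (finalState A ends I ŵ w) ≡ nothing

Queried : ∀ {n m} → Algorithm → (Fin m → Fin n × Fin n) → (Fin m → Interval) → (Fin m → ℚ)
          → (Fin m → ℚ) → EdgeSet m
Queried A ends I ŵ w e = is-just (finalState A ends I ŵ w e)

Consistent : ∀ {m} → (Fin m → Interval) → (Fin m → ℚ) → EdgeSet m → (Fin m → ℚ) → Set
Consistent I w ALG x = ∀ e → (ALG e ≡ true → x e ≡ w e) × (x e ∈I I e)

-- state of the reduction: remaining edges and, for each vertex,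
-- the vertex it has been contracted into (cls v ≡ v for remaining vertices)
record RState (n m : ℕ) : Set where
  field
    alive : EdgeSet m
    cls   : Fin n → Fin n
open RState public

initState : ∀ {n m} → RState n m
initState = record { alive = λ _ → true ; cls = λ v → v }

current : ∀ {n m} → (Fin m → Fin n × Fin n) → RState n m → Graph n m
current ends s = record
  { ends    = λ e → map (cls s) (cls s) (ends e)
  ; active  = λ v → ⌊ cls s v ≟ᶠ v ⌋
  ; present = alive s }

deleteEdge : ∀ {n m} → RState n m → Fin m → RState n m
deleteEdge s e = record { alive = λ f → if ⌊ f ≟ᶠ e ⌋ then false else alive s f ; cls = cls s }

contractEdge : ∀ {n m} → (Fin m → Fin n × Fin n) → RState n m → Fin m → RState n m
contractEdge ends s e = record
  { alive = λ f → if ⌊ f ≟ᶠ e ⌋ then false else alive s f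
  ; cls   = λ x → if ⌊ cls s x ≟ᶠ v′ ⌋ then u′ else cls s x }
  where
  u′ = cls s (proj₁ (ends e))
  v′ = cls s (proj₂ (ends e))

KnownMaxOnCycle : ∀ {n m} → (Fin m → Fin n × Fin n) → (Fin m → Interval) → (Fin m → ℚ)
                  → EdgeSet m → RState n m → Fin m → Set
KnownMaxOnCycle ends I w ALG s e =
  alive s e ≡ true ×
  ∃ λ C → Cycle (current ends s) (alive s) C × e ∈ C ×
    (∀ x → Consistent I w ALG x → ∀ f → f ∈ C → x f ≤ x e)

Crosses : ∀ {n m} → (Fin m → Fin n × Fin n) → RState n m → (Fin n → Bool) → Fin m → Set
Crosses ends s S f = alive s f ≡ true ×
  S (cls s (proj₁ (ends f))) ≢ S (cls s (proj₂ (ends f)))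

KnownMinInCut : ∀ {n m} → (Fin m → Fin n × Fin n) → (Fin m → Interval) → (Fin m → ℚ)
                → EdgeSet m → RState n m → Fin m → Set
KnownMinInCut ends I w ALG s e =
  ∃ λ (S : Fin _ → Bool) → Crosses ends s S e ×
    (∀ x → Consistent I w ALG x → ∀ f → Crosses ends s S f → x e ≤ x f)

data Reduces {n m} (ends : Fin m → Fin n × Fin n) (I : Fin m → Interval) (w : Fin m → ℚ)
             (ALG : EdgeSet m) : RState n m → RState n m → Set where
  done : ∀ {s} → Reduces ends I w ALG s s
  del  : ∀ {s s′} e → KnownMaxOnCycle ends I w ALG s e
         → Reduces ends I w ALG (deleteEdge s e) s′ → Reduces ends I w ALG s s′
  con  : ∀ {s s′} e → KnownMinInCut ends I w ALG s e
         → Reduces ends I w ALG (contractEdge ends s e) s′ → Reduces ends I w ALG s s′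

remI : ∀ {m} → (Fin m → Interval) → (Fin m → ℚ) → EdgeSet m → Fin m → Interval
remI I w ALG e = if ALG e then pt (w e) else I e

remŵ : ∀ {m} → (Fin m → ℚ) → (Fin m → ℚ) → EdgeSet m → Fin m → ℚ
remŵ ŵ w ALG e = if ALG e then w e else ŵ e

PredictionMandatory : ∀ {n m} → Graph n m → (Fin m → Interval) → (Fin m → ℚ) → Fin m → Set
PredictionMandatory g I ŵ e =
  present g e ≡ true × (∀ Q → Feasible g I ŵ Q → Q e ≡ true)

PredictionMandatoryFree : ∀ {n m} → Graph n m → (Fin m → Interval) → (Fin m → ℚ) → Set
PredictionMandatoryFree g I ŵ = ∀ e → ¬ PredictionMandatory g I ŵ e

{-# OPTIONS --safe #-}

-- An edge with open interval (L , U) is mandatory, given the values of all other edges, iff it lies on a cycle whose other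
-- edges have values below U and on a cut whose other edges have values above L. This criterion is self-dual, so everything
-- except the exchange arguments for trees takes place in a system of circuits and cocircuits.
--
-- If no edge is known to be mandatory, the lower limit tree and the upper limit tree coincide. A prediction mandatory edge
-- then yields a prediction mandatory edge e and a companion f such that, whatever the other values are, e is mandatory
-- once the value of f is on the side of a limit of e where it is predicted to be. The strategy queries known mandatory
-- edges at once, then γ - 2 prediction mandatory edges, then e, and finishes the batch in one of four ways:
--   * some edge has become known to be mandatory: query it;
--   * f is now determined: it is put into D;
--   * query f and find it mispredicted relative to e;
--   * query f as well as an edge g such that every feasible query set meets {f , g}; here e is mandatory.
-- A prediction mandatory edge that is not mandatory has an error k⁻, so the first three endings pay for each of their
-- queries, and the last one pays for all but one of its γ + 1 queries while using two edges of OPT.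
module Submission where

open import Defs
open import Data.Bool using (Bool; _xor_; _∧_; _∨_; false; if_then_else_; not; true)
import Data.Bool.Properties as Boolₚ
open import Data.Empty using (⊥; ⊥-elim)
open import Data.Fin using (Fin; suc; toℕ; zero)
open import Data.Fin.Properties using (_≟_; all?; any?; toℕ-injective; toℕ<n)
open import Data.List using (List; []; _++_; _∷_; allFin; filter; map)
import Data.List.Membership.DecPropositional as DecMembership
open import Data.List.Membership.Propositional using (_∈_; _∉_)
open import Data.List.Membership.Propositional.Properties using (∈-++⁺ʳ; ∈-++⁺ˡ; ∈-allFin; ∈-filter⁺; ∈-filter⁻; ∈-map⁺)
import Data.List.Relation.Unary.All as All
open import Data.List.Relation.Unary.All using (All; []; _∷_)
open import Data.List.Relation.Unary.AllPairs using ([]; _∷_)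
open import Data.List.Relation.Unary.Any using (here; there)
open import Data.List.Relation.Unary.Unique.Propositional using (Unique)
open import Data.Maybe using (Maybe; fromMaybe; is-just; just; maybe; nothing)
import Data.Nat as ℕ
open import Data.Nat using (suc; zero; ℕ)
import Data.Nat.Properties as ℕₚ
open import Data.Nat.Tactic.RingSolver using (solve-∀)
open import Data.Product using (_,_; _×_; proj₁; proj₂; Σ; ∃; ∃₂)
import Data.Rational as ℚ
import Data.Rational.Properties as ℚₚ
open import Data.Sum using (_⊎_; inj₁; inj₂; swap)
open import Data.Unit using (tt; ⊤)
open import Function using (_∘_; case_of_; flip)
open import Relation.Binary.Definitions using (Transitive; Trichotomous; tri<; tri>; tri≈)
open import Relation.Binary.PropositionalEquality hiding (J)
open import Relation.Nullary using (Dec; no; yes; ¬_)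
open import Relation.Nullary.Decidable using (_×-dec_; _⊎-dec_; decidable-stable; ¬?; ⌊_⌋)

-- The constant `γ - 2` comes from the fourth ending. In the first bound its last three queries cost
-- `3γ` and bring in only `2(γ + 1)`; the gap is exactly `γ - 2`, and each prediction mandatory edge
-- queried beforehand saves one unit, since it costs `γ` and brings in `γ + 1`. In the second bound
-- the same edges are debts: an edge of OPT repays `γ` queries, and the debts of an unfinished batch
-- form the additive term.
--
-- `D` exists because of the second ending: querying `f` as well could leave a single unit of charge
-- for two queries, one too few, while the edge of OPT that repays the debts may be `f` itself.
--
-- A common limit tree is what makes companions available: fundamental circuits and cocircuits are
-- then bounded at both limits at once, so an edge chosen extreme for one limit keeps its
-- certificate for the other.
--
-- Open limits may coincide. They are replaced by perturbed keys, which makes the trees unique while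
-- comparisons of keys still give the strict inequalities of the criterion.

-- Booleans, decisions and pointwise updates

module Preliminaries where

  true≢false : ∀ {b} → b ≡ true → b ≡ false → ⊥
  true≢false refl ()

  bool-dec : ∀ b → (b ≡ true) ⊎ (b ≡ false)
  bool-dec true = inj₁ refl
  bool-dec false = inj₂ refl

  ⌊⌋-true : ∀ {A : Set} (d : Dec A) → A → ⌊ d ⌋ ≡ true
  ⌊⌋-true (yes _) _ = refl
  ⌊⌋-true (no n) a = ⊥-elim (n a)

  ⌊⌋-sound : ∀ {A : Set} (d : Dec A) → ⌊ d ⌋ ≡ true → A
  ⌊⌋-sound (yes a) _ = a

  module _ {A : Set} {m : ℕ} (x : Fin m → A) (e : Fin m) (a : A) where

    _[_≔_] : Fin m → A
    _[_≔_] f = if ⌊ f ≟ e ⌋ then a else x f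

    update-at : _[_≔_] e ≡ a
    update-at with e ≟ e
    ... | yes _ = refl
    ... | no p = ⊥-elim (p refl)

    update-off : ∀ {f} → f ≢ e → _[_≔_] f ≡ x f
    update-off {f} f≢e with f ≟ e
    ... | yes p = ⊥-elim (f≢e p)
    ... | no _ = refl

    update-elim : (P : Fin m → A → Set) → P e a → (∀ f → f ≢ e → P f (x f)) → ∀ f → P f (_[_≔_] f)
    update-elim P at off f with f ≟ e
    ... | yes refl = at
    ... | no f≢e = off f f≢e

-- Matroids given by circuits and cocircuits, with greedy bases for both limits

module MintySystems where

  open Preliminaries

  -- Minty's painting axioms for a matroid, without minimality of circuits and cocircuits, so that
  -- closed trails and edge cuts qualify directly. The axioms are symmetric under exchanging the two
  -- families and the two colours.
  record Minty (m : ℕ) : Set₁ where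
    field
      Circuit Cocircuit : Set
      onCircuit   : Circuit → Fin m → Bool
      onCocircuit : Cocircuit → Fin m → Bool
      orthogonal : ∀ C X e → onCircuit C e ≡ true → onCocircuit X e ≡ true →
        ∃ λ h → (h ≢ e) × (onCircuit C h ≡ true) × (onCocircuit X h ≡ true)
      paint : (A : Fin m → Bool) (e : Fin m) →
        (∃ λ C → (onCircuit C e ≡ true) × (∀ h → onCircuit C h ≡ true → h ≢ e → A h ≡ true))
        ⊎ (∃ λ X → (onCocircuit X e ≡ true) × (∀ h → onCocircuit X h ≡ true → h ≢ e → A h ≡ false))

  not-true : ∀ {b} → not b ≡ true → b ≡ false
  not-true {false} _ = refl

  not-false : ∀ {b} → not b ≡ false → b ≡ true
  not-false {true} _ = refl

  dual : ∀ {m} → Minty m → Minty m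
  dual M = record
    { Circuit = Cocircuit ; Cocircuit = Circuit
    ; onCircuit = onCocircuit ; onCocircuit = onCircuit
    ; orthogonal = λ X C e p q → let (h , h≢e , a , b) = orthogonal C X e q p in h , h≢e , b , a
    ; paint = paint* }
    where
    open Minty M
    paint* : ∀ A e → _
    paint* A e with paint (not ∘ A) e
    ... | inj₁ (C , e∈C , f) = inj₂ (C , e∈C , λ h a b → not-true (f h a b))
    ... | inj₂ (X , e∈X , f) = inj₁ (X , e∈X , λ h a b → not-false (f h a b))

  module _ {m} (M : Minty m) where
    open Minty M

    HasCircuit HasCocircuit : (Fin m → Set) → Fin m → Set
    HasCircuit P e =
      ∃ λ C → (onCircuit C e ≡ true) × (∀ h → onCircuit C h ≡ true → h ≢ e → P h)
    HasCocircuit P e =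
      ∃ λ X → (onCocircuit X e ≡ true) × (∀ h → onCocircuit X h ≡ true → h ≢ e → P h)

    mapCircuit : ∀ {P Q : Fin m → Set} {e} → (∀ h → h ≢ e → P h → Q h) → HasCircuit P e → HasCircuit Q e
    mapCircuit i (C , e∈C , p) = C , e∈C , λ h a b → i h b (p h a b)

    mapCocircuit : ∀ {P Q : Fin m → Set} {e} → (∀ h → h ≢ e → P h → Q h) → HasCocircuit P e → HasCocircuit Q e
    mapCocircuit i (X , e∈X , p) = X , e∈X , λ h a b → i h b (p h a b)

    -- The source of most contradictions below: when no edge satisfies both `P` and `Q`, a circuit
    -- and a cocircuit of these kinds through the same `e` cannot coexist.
    meet : ∀ {P Q : Fin m → Set} {e} → HasCircuit P e → HasCocircuit Q e → ∃ λ h → h ≢ e × P h × Q h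
    meet {e = e} (C , e∈C , p) (X , e∈X , q) with orthogonal C X e e∈C e∈X
    ... | h , h≢e , a , b = h , h≢e , p h a h≢e , q h b h≢e

    -- Together with `meet` this decides whether a suitable circuit exists, and failure comes with a
    -- cocircuit as its certificate.
    paintDec : {P : Fin m → Set} → (∀ h → Dec (P h)) → ∀ e → HasCircuit P e ⊎ HasCocircuit (¬_ ∘ P) e
    paintDec {P} P? e with paint (λ h → ⌊ P? h ⌋) e
    ... | inj₁ (C , e∈C , f) = inj₁ (C , e∈C , λ h a b → ⌊⌋-sound (P? h) (f h a b))
    ... | inj₂ (X , e∈X , f) = inj₂ (X , e∈X , λ h a b p → true≢false (⌊⌋-true (P? h) p) (f h a b))

  -- Injectivity at each limit makes the minimum weight basis for that limit unique, so that
  -- membership has a local certificate.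
  record Keys (m : ℕ) : Set₁ where
    field
      K : Set
      _<_ : K → K → Set
      <-trans : Transitive _<_
      <-cmp : Trichotomous _≡_ _<_
      lower upper value : Fin m → K
      open? : Fin m → Bool
      lower-injective : ∀ {e h} → lower e ≡ lower h → e ≡ h
      upper-injective : ∀ {e h} → upper e ≡ upper h → e ≡ h
      lower≤value : ∀ e → ¬ value e < lower e
      value≤upper : ∀ e → ¬ upper e < value e
      closed : ∀ e → open? e ≡ false → lower e ≡ upper e

  dualKeys : ∀ {m} → Keys m → Keys m
  dualKeys k = record
    { K = K ; _<_ = flip _<_ ; <-trans = λ a b → <-trans b a ; <-cmp = cmp
    ; lower = upper ; upper = lower ; value = value ; open? = open?
    ; lower-injective = upper-injective ; upper-injective = lower-injective
    ; lower≤value = value≤upper ; value≤upper = lower≤value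
    ; closed = λ e p → sym (closed e p) }
    where
    open Keys k
    cmp : Trichotomous _≡_ (flip _<_)
    cmp x y with <-cmp x y
    ... | tri< a b c = tri> c b a
    ... | tri≈ a b c = tri≈ c b a
    ... | tri> a b c = tri< c b a

  module KeyFacts {m} (k : Keys m) where
    open Keys k public

    <-irrefl : ∀ {x} → ¬ x < x
    <-irrefl {x} p with <-cmp x x
    ... | tri< _ b _ = b refl
    ... | tri≈ a _ _ = a p
    ... | tri> _ b _ = b refl

    <-asym : ∀ {x y} → x < y → ¬ y < x
    <-asym p q = <-irrefl (<-trans p q)

    _<?_ : ∀ x y → Dec (x < y)
    x <? y with <-cmp x y
    ... | tri< a _ _ = yes a
    ... | tri≈ a _ _ = no a
    ... | tri> a _ _ = no a

    <-≮ : ∀ {x y z} → x < y → ¬ z < y → x < z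
    <-≮ {x} {y} {z} p q with <-cmp y z
    ... | tri< a _ _ = <-trans p a
    ... | tri≈ _ refl _ = p
    ... | tri> _ _ a = ⊥-elim (q a)

    ≮-< : ∀ {x y z} → ¬ y < x → y < z → x < z
    ≮-< {x} {y} {z} p q with <-cmp x y
    ... | tri< a _ _ = <-trans a q
    ... | tri≈ _ refl _ = q
    ... | tri> _ _ a = ⊥-elim (p a)

    upper≮lower : ∀ e → ¬ upper e < lower e
    upper≮lower e p = value≤upper e (<-≮ p (lower≤value e))

    argmin : ∀ {n} (P : Fin n → Bool) (key : Fin n → K) e → P e ≡ true →
      ∃ λ k → (P k ≡ true) × (∀ h → P h ≡ true → ¬ key h < key k)
    argmin {suc n} P key e e∈P with any? (λ h → P (suc h) Boolₚ.≟ true)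
    argmin {suc n} P key zero e∈P | no none = zero , e∈P ,
      λ { zero _ → <-irrefl ; (suc h) q → ⊥-elim (none (h , q)) }
    argmin {suc n} P key (suc e) e∈P | no none = ⊥-elim (none (e , e∈P))
    ... | yes (h , h∈P) with argmin (P ∘ suc) (key ∘ suc) h h∈P | P zero in eq
    ... | k , k∈P , min | false = suc k , k∈P ,
      λ { zero q → ⊥-elim (true≢false q eq) ; (suc j) q → min j q }
    ... | k , k∈P , min | true with key zero <? key (suc k)
    ... | yes 0<k = zero , eq , λ { zero _ → <-irrefl ; (suc j) q r → min j q (<-trans r 0<k) }
    ... | no 0≮k = suc k , k∈P , λ { zero _ → 0≮k ; (suc j) q → min j q }

  -- The minimum weight basis for the lower limits; for the upper limits it is the complement of the one obtained by duality.
  module LowerBasis {m} (M : Minty m) (k : Keys m) where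
    open Minty M
    open KeyFacts k

    -- The greedy rules of matroids: an edge belongs to the basis iff it is the lightest of some
    -- cocircuit, and is left out iff it is the heaviest of some circuit. With these certificates
    -- the basis itself never has to be constructed.
    In Out : Fin m → Set
    In  e = HasCocircuit M (λ h → lower e < lower h) e
    Out e = HasCircuit M (λ h → lower h < lower e) e

    lower≢ : ∀ {e h} → h ≢ e → ¬ lower h < lower e → lower e < lower h
    lower≢ {e} {h} h≢e p with <-cmp (lower e) (lower h)
    ... | tri< a _ _ = a
    ... | tri≈ _ a _ = ⊥-elim (h≢e (sym (lower-injective a)))
    ... | tri> _ _ a = ⊥-elim (p a)

    out-or-in : ∀ e → Out e ⊎ In e
    out-or-in e with paintDec M (λ h → lower h <? lower e) e
    ... | inj₁ c = inj₁ c
    ... | inj₂ x = inj₂ (mapCocircuit M (λ h → lower≢) x)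

    in-out : ∀ {e} → In e → Out e → ⊥
    in-out i o with meet M o i
    ... | h , _ , a , b = <-asym a b

    in? : ∀ e → Dec (In e)
    in? e with out-or-in e
    ... | inj₁ o = no λ i → in-out i o
    ... | inj₂ i = yes i

    -- If the painting gave a cocircuit, its lightest edge `k` would lie in the basis. Either `k` is
    -- `e`, against `in-out`, or `k` lies below `e` and is one of the edges that this cocircuit has
    -- to avoid.
    out-fundamental : ∀ {e} → Out e → HasCircuit M (λ h → In h × lower h < lower e) e
    out-fundamental {e} o with paintDec M (λ h → in? h ×-dec (lower h <? lower e)) e
    ... | inj₁ c = c
    ... | inj₂ (X , e∈X , f) with argmin (onCocircuit X) lower e e∈X
    ... | k , k∈X , min = ⊥-elim (case-k (k ≟ e))
      where
      kIn : In k
      kIn = X , k∈X , λ h h∈X h≢k → lower≢ h≢k (min h h∈X)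
      case-k : Dec (k ≡ e) → ⊥
      case-k (yes refl) = in-out kIn o
      case-k (no k≢e) = f k k∈X k≢e (kIn , lower≢ (k≢e ∘ sym) (min e e∈X))

  module Bases {m} (M : Minty m) (k : Keys m) where
    open Minty M
    open KeyFacts k
    open LowerBasis M k public
    -- Bases of the dual are complements of bases, hence the crossed names: inside the dual basis
    -- means outside the upper one.
    open LowerBasis (dual M) (dualKeys k) public using () renaming
      ( In to OutU ; Out to InU ; out-or-in to inU-or-outU
      ; out-fundamental to inU-fundamental)

    -- Not the dual of out-fundamental, since duality also exchanges lower and upper limits.
    in-fundamental : ∀ {e} → In e → HasCocircuit M (λ h → Out h × lower e < lower h) e
    in-fundamental {e} i with paintDec (dual M) out? e
      where
      out? : ∀ h → Dec (Out h × lower e < lower h)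
      out? h with out-or-in h
      ... | inj₁ o = yes o ×-dec (lower e <? lower h)
      ... | inj₂ i′ = no λ p → in-out i′ (proj₁ p)
    ... | inj₁ x = x
    ... | inj₂ (C , e∈C , f) with Maxi.argmin (onCircuit C) lower e e∈C
      where module Maxi = KeyFacts (dualKeys k)
    ... | k′ , k∈C , max = ⊥-elim (case-k (k′ ≟ e))
      where
      kOut : Out k′
      kOut = C , k∈C , λ h h∈C h≢k → lower≢ (h≢k ∘ sym) (max h h∈C)
      case-k : Dec (k′ ≡ e) → ⊥
      case-k (yes refl) = in-out i kOut
      case-k (no k≢e) = f k′ k∈C k≢e (kOut , lower≢ k≢e (max e e∈C))

-- The common basis when nothing is known to be mandatory, and pairs of edges that force each other

module CriticalPairs where

  open MintySystems

  module Resolved {m} (M : Minty m) (k : Keys m) where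
    open Minty M
    open Bases M k
    open Bases (dual M) (dualKeys k) using () renaming (in-fundamental to outU-fundamental)
    open KeyFacts k

    -- The two certificates are `OutU e` and `In e`: an open edge of the lower basis that the upper
    -- basis lacks.
    KnownMandatory : Fin m → Set
    KnownMandatory e = (open? e ≡ true) × HasCircuit M (λ h → upper h < upper e) e × HasCocircuit M (λ h → lower e < lower h) e

    Undetermined : Fin m → Set
    Undetermined e = HasCircuit M (λ h → lower h < upper e) e × HasCocircuit M (λ h → lower e < upper h) e

    PredictedMandatory : Fin m → Set
    PredictedMandatory e = (open? e ≡ true) × HasCircuit M (λ h → value h < upper e) e × HasCocircuit M (λ h → lower e < value h) e

    -- Once the value of q falls below upper e (resp. above lower f), e (resp. f) is mandatory.
    PairIn PairOut : Fin m → Fin m → Set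
    PairIn e q = (open? e ≡ true) × HasCircuit M (λ h → h ≢ q → upper h < upper e) e × HasCocircuit M (λ h → lower e < lower h) e
    PairOut f q = (open? f ≡ true) × HasCircuit M (λ h → upper h < upper f) f × HasCocircuit M (λ h → h ≢ q → lower f < lower h) f

    module _ (resolved : ∀ e → ¬ KnownMandatory e) where

      -- An open edge of this kind would be known to be mandatory. For a trivial edge, orthogonality
      -- yields an `h` whose upper limit lies below its lower limit.
      resolved′ : ∀ {e} → In e → OutU e → ⊥
      resolved′ {e} i o with open? e in eq
      ... | true = resolved e (eq , o , i)
      ... | false with meet M o i
      ... | h , _ , a , b = upper≮lower h (<-trans (subst (upper h <_) (sym (closed e eq)) a) b)

      -- Otherwise the fundamental circuit of `e` at the lower limits consists of edges `In`, its
      -- fundamental cocircuit at the upper limits of edges `OutU`, and the second edge they share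
      -- contradicts `resolved′`.
      inU⇒in : ∀ {e} → InU e → In e
      inU⇒in {e} u with out-or-in e
      ... | inj₂ i = i
      ... | inj₁ o with meet M (out-fundamental o) (inU-fundamental u)
      ... | h , _ , (a , _) , (b , _) = ⊥-elim (resolved′ a b)

      out⇒outU : ∀ {e} → Out e → OutU e
      out⇒outU {e} o with inU-or-outU e
      ... | inj₂ p = p
      ... | inj₁ u = ⊥-elim (in-out (inU⇒in u) o)

      -- The circuit is the one of the upper basis. For the lower limits, the fundamental cocircuit
      -- of `h` must meet it a second time; an edge other than `f` would be both in and out of the
      -- common basis, so the cocircuit contains `f`, which bounds `lower h`.
      fundamentalCircuit : ∀ {f} → Out f → HasCircuit M (λ h → In h × (upper h < upper f) × (lower h < lower f)) f
      fundamentalCircuit {f} o with outU-fundamental (out⇒outU o)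
      ... | C , f∈C , p = C , f∈C , λ h h∈C h≢f → inU⇒in (proj₁ (p h h∈C h≢f)) , proj₂ (p h h∈C h≢f) , below h h∈C h≢f
        where
        below : ∀ h → onCircuit C h ≡ true → h ≢ f → lower h < lower f
        below h h∈C h≢f with in-fundamental (inU⇒in (proj₁ (p h h∈C h≢f)))
        ... | X , h∈X , q with orthogonal C X h h∈C h∈X
        ... | j , j≢h , j∈C , j∈X with j ≟ f
        ... | yes refl = proj₂ (q f j∈X j≢h)
        ... | no j≢f = ⊥-elim (in-out (inU⇒in (proj₁ (p j j∈C j≢f))) (proj₁ (q j j∈X j≢h)))

      fundamentalCocircuit : ∀ {e} → In e → HasCocircuit M (λ h → Out h × (lower e < lower h) × (upper e < upper h)) e
      fundamentalCocircuit {e} i with in-fundamental i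
      ... | X , e∈X , p = X , e∈X , λ h h∈X h≢e → proj₁ (p h h∈X h≢e) , proj₂ (p h h∈X h≢e) , above h h∈X h≢e
        where
        above : ∀ h → onCocircuit X h ≡ true → h ≢ e → upper e < upper h
        above h h∈X h≢e with outU-fundamental (out⇒outU (proj₁ (p h h∈X h≢e)))
        ... | C , h∈C , q with orthogonal C X h h∈C h∈X
        ... | j , j≢h , j∈C , j∈X with j ≟ e
        ... | yes refl = proj₂ (q e j∈C j≢h)
        ... | no j≢e = ⊥-elim (in-out (inU⇒in (proj₁ (q j j∈C j≢h))) (proj₁ (p j j∈X j≢e)))

      -- A fundamental circuit and a fundamental cocircuit of the same basis share at most `e` and
      -- `f`, and orthogonality forbids sharing only one of them.
      exchange : ∀ {e f} C X → onCircuit C f ≡ true → onCocircuit X e ≡ true →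
        (∀ h → onCircuit C h ≡ true → h ≢ f → In h) → (∀ h → onCocircuit X h ≡ true → h ≢ e → Out h) →
        onCocircuit X f ≡ true → onCircuit C e ≡ true
      exchange {e} {f} C X f∈C e∈X p q f∈X with orthogonal C X f f∈C f∈X
      ... | h , h≢f , h∈C , h∈X with h ≟ e
      ... | yes refl = h∈C
      ... | no h≢e = ⊥-elim (in-out (p h h∈C h≢f) (q h h∈X h≢e))

      exchange′ : ∀ {e f} C X → onCircuit C f ≡ true → onCocircuit X e ≡ true →
        (∀ h → onCircuit C h ≡ true → h ≢ f → In h) → (∀ h → onCocircuit X h ≡ true → h ≢ e → Out h) →
        onCircuit C e ≡ true → onCocircuit X f ≡ true
      exchange′ {e} {f} C X f∈C e∈X p q e∈C with orthogonal C X e e∈C e∈X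
      ... | h , h≢e , h∈C , h∈X with h ≟ f
      ... | yes refl = h∈X
      ... | no h≢f = ⊥-elim (in-out (p h h∈C h≢f) (q h h∈X h≢e))

      -- The circuit that predicts `g` and the fundamental cocircuit of `g` share a second edge `f`,
      -- which is outside the basis; by exchange `g` lies on the fundamental circuit of `f`. The
      -- companion is this `f`, but the main edge is sought anew on that circuit, because its other
      -- edges may have upper limits above that of `g`.
      predicted-in : ∀ {g} → PredictedMandatory g → In g →
        ∃₂ λ e f → (open? f ≡ true) × (f ≢ e) × PairIn e f × (value f < upper e) × Undetermined f
      predicted-in {g} (_ , (Cg , g∈Cg , νC) , _) i with in-fundamental i
      ... | Xg , g∈Xg , xg with orthogonal Cg Xg g g∈Cg g∈Xg
      ... | f , f≢g , f∈Cg , f∈Xg with xg f f∈Xg f≢g | νC f f∈Cg f≢g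
      ... | fOut , _ | νf<μg with fundamentalCircuit fOut
      ... | C , f∈C , c = conclude
        where
        inC : ∀ h → onCircuit C h ≡ true → h ≢ f → In h
        inC h a b = proj₁ (c h a b)
        g∈C : onCircuit C g ≡ true
        g∈C = exchange C Xg f∈C g∈Xg inC (λ h a b → proj₁ (xg h a b)) f∈Xg
        C∖f : Fin m → Bool
        C∖f h with h ≟ f
        ... | yes _ = false
        ... | no _ = onCircuit C h
        C∖f-intro : ∀ h → onCircuit C h ≡ true → h ≢ f → C∖f h ≡ true
        C∖f-intro h a b with h ≟ f
        ... | yes p = ⊥-elim (b p)
        ... | no _ = a
        C∖f-elim : ∀ h → C∖f h ≡ true → (onCircuit C h ≡ true) × (h ≢ f)
        C∖f-elim h a with h ≟ f
        ... | no p = a , p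
        module Max = KeyFacts (dualKeys k)
        -- The largest upper limit on the circuit apart from `f` leaves `f` as the only edge that
        -- may rise above `e`. As it is at least the upper limit of `g`, the prediction
        -- `value f < upper g` carries over to `e`.
        best : ∃ λ e → (C∖f e ≡ true) × (∀ h → C∖f h ≡ true → ¬ upper e < upper h)
        best = Max.argmin C∖f upper g (C∖f-intro g g∈C (f≢g ∘ sym))
        conclude : ∃₂ λ e f → (open? f ≡ true) × (f ≢ e) × PairIn e f × (value f < upper e) × Undetermined f
        conclude with best
        ... | e , e∈C∖f , max with C∖f-elim e e∈C∖f
        ... | e∈C , e≢f with c e e∈C e≢f
        ... | eIn , μe<μf , λe<λf with fundamentalCocircuit eIn
        ... | X , e∈X , x = e , f , f-open , (e≢f ∘ sym) , (e-open , circuit , cocircuit) , νf<μe , und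
          where
          νf<μe : value f < upper e
          νf<μe = <-≮ νf<μg (max g (C∖f-intro g g∈C (f≢g ∘ sym)))
          circuit : HasCircuit M (λ h → h ≢ f → upper h < upper e) e
          circuit = C , e∈C , λ h h∈C h≢e h≢f → below h (max h (C∖f-intro h h∈C h≢f)) h≢e
            where
            below : ∀ h → ¬ upper e < upper h → h ≢ e → upper h < upper e
            below h p h≢e with <-cmp (upper h) (upper e)
            ... | tri< a _ _ = a
            ... | tri≈ _ a _ = ⊥-elim (h≢e (upper-injective a))
            ... | tri> _ _ a = ⊥-elim (p a)
          cocircuit : HasCocircuit M (λ h → lower e < lower h) e
          cocircuit = mapCocircuit M (λ _ _ p → proj₁ (proj₂ p)) (X , e∈X , x)
          e-open : open? e ≡ true
          e-open with open? e in eq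
          ... | true = refl
          ... | false = ⊥-elim (<-irrefl (<-trans (≮-< (lower≤value f) νf<μe) (subst (_< lower f) (closed e eq) λe<λf)))
          f-open : open? f ≡ true
          f-open with open? f in eq
          ... | true = refl
          -- With a trivial `f` the same circuit would already make `e` known to be mandatory.
          ... | false = ⊥-elim (resolved e (e-open , (C , e∈C , λ h h∈C h≢e → μ h h∈C h≢e (h ≟ f)) , cocircuit))
            where
            μ : ∀ h → onCircuit C h ≡ true → h ≢ e → Dec (h ≡ f) → upper h < upper e
            μ h h∈C h≢e (no h≢f) = proj₂ (proj₂ circuit) h h∈C h≢e h≢f
            μ h h∈C h≢e (yes refl) = ≮-< (subst (λ z → ¬ value f < z) (closed f eq) (lower≤value f)) νf<μe
          und : Undetermined f
          und = (C , f∈C , λ h a b → ≮-< (upper≮lower h) (proj₁ (proj₂ (c h a b))))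
              , (X , exchange′ C X f∈C e∈X inC (λ h a b → proj₁ (x h a b)) e∈C , λ h h∈X h≢f → up h h∈X h≢f (h ≟ e))
            where
            up : ∀ h → onCocircuit X h ≡ true → h ≢ f → Dec (h ≡ e) → lower f < upper h
            up h _ _ (yes refl) = ≮-< (lower≤value f) νf<μe
            up h h∈X h≢f (no h≢e) = <-trans (≮-< (lower≤value f) νf<μe) (proj₂ (proj₂ (x h h∈X h≢e)))

      -- On the fundamental cocircuit of `e`, `f` has the smallest lower limit apart from `e`, so
      -- only `e` can keep `f` from being known to be mandatory. That `e` is undetermined gives
      -- `lower f < upper e`, so `e` still has room for a value above `lower f`.
      partner-in : ∀ {e} → In e → Undetermined e →
        ∃ λ f → (f ≢ e) × PairOut f e × (lower f < upper e) × Undetermined f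
      partner-in {e} i ((C₀ , e∈C₀ , c₀) , _) with fundamentalCocircuit i
      ... | X , e∈X , x = conclude (argmin X∖e lower j (X∖e-intro j j∈X j≢e))
        where
        met = orthogonal C₀ X e e∈C₀ e∈X
        j = proj₁ met
        j≢e : j ≢ e
        j≢e = proj₁ (proj₂ met)
        j∈C₀ : onCircuit C₀ j ≡ true
        j∈C₀ = proj₁ (proj₂ (proj₂ met))
        j∈X : onCocircuit X j ≡ true
        j∈X = proj₂ (proj₂ (proj₂ met))
        X∖e : Fin m → Bool
        X∖e h with h ≟ e
        ... | yes _ = false
        ... | no _ = onCocircuit X h
        X∖e-intro : ∀ h → onCocircuit X h ≡ true → h ≢ e → X∖e h ≡ true
        X∖e-intro h a b with h ≟ e
        ... | yes p = ⊥-elim (b p)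
        ... | no _ = a
        X∖e-elim : ∀ h → X∖e h ≡ true → (onCocircuit X h ≡ true) × (h ≢ e)
        X∖e-elim h a with h ≟ e
        ... | no p = a , p
        conclude : (∃ λ f → (X∖e f ≡ true) × (∀ h → X∖e h ≡ true → ¬ lower h < lower f)) →
          ∃ λ f → (f ≢ e) × PairOut f e × (lower f < upper e) × Undetermined f
        conclude (f , f∈X∖e , min) with X∖e-elim f f∈X∖e
        ... | f∈X , f≢e with x f f∈X f≢e
        ... | fOut , _ , μe<μf with fundamentalCircuit fOut
        ... | C , f∈C , c = f , f≢e , (f-open , circuit , cocircuit) , λf<μe , und
          where
          λf<μe : lower f < upper e
          λf<μe = ≮-< (min j (X∖e-intro j j∈X j≢e)) (c₀ j j∈C₀ j≢e)
          f-open : open? f ≡ true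
          f-open with open? f in eq
          ... | true = refl
          ... | false = ⊥-elim (<-asym λf<μe (subst (upper e <_) (sym (closed f eq)) μe<μf))
          circuit : HasCircuit M (λ h → upper h < upper f) f
          circuit = C , f∈C , λ h a b → proj₁ (proj₂ (c h a b))
          cocircuit : HasCocircuit M (λ h → h ≢ e → lower f < lower h) f
          cocircuit = X , f∈X , λ h h∈X h≢f h≢e → lower≢ h≢f (min h (X∖e-intro h h∈X h≢e))
          und : Undetermined f
          und = mapCircuit M (λ h _ p → ≮-< (upper≮lower h) p) circuit
              , (X , f∈X , λ h h∈X h≢f → up h h∈X h≢f (h ≟ e))
            where
            up : ∀ h → onCocircuit X h ≡ true → h ≢ f → Dec (h ≡ e) → lower f < upper h
            up h _ _ (yes refl) = λf<μe
            up h h∈X h≢f (no h≢e) = <-≮ (proj₂ (proj₂ cocircuit) h h∈X h≢f h≢e) (upper≮lower h)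

  module Symmetric {m} (M : Minty m) (k : Keys m) where
    open KeyFacts k
    open Resolved M k public
    private module R* = Resolved (dual M) (dualKeys k)

    module _ (resolved : ∀ e → ¬ KnownMandatory e) where
      private
        resolved* : ∀ e → ¬ R*.KnownMandatory e
        resolved* e (o , x , c) = resolved e (o , c , x)

      PredictedPair : Set
      PredictedPair =
        ∃₂ λ e f → (open? f ≡ true) × (f ≢ e) × Undetermined f ×
          ((PairIn e f × value f < upper e) ⊎ (PairOut e f × lower e < value f))

      predicted-pair : ∀ {g} → PredictedMandatory g → PredictedPair
      predicted-pair {g} pm@(o , c , x) = side (Bases.out-or-in M k g)
        where
        dual-side : (∃₂ λ e f → (open? f ≡ true) × (f ≢ e) × R*.PairIn e f × (lower e < value f) × R*.Undetermined f) → PredictedPair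
        dual-side (e , f , fo , f≢e , (eo , x′ , c′) , ν , (xf , cf)) = e , f , fo , f≢e , (cf , xf) , inj₂ ((eo , c′ , x′) , ν)
        direct-side : (∃₂ λ e f → (open? f ≡ true) × (f ≢ e) × PairIn e f × (value f < upper e) × Undetermined f) → PredictedPair
        direct-side (e , f , fo , f≢e , pair , ν , und) = e , f , fo , f≢e , und , inj₁ (pair , ν)
        side : _ → PredictedPair
        side (inj₂ i) = direct-side (predicted-in resolved pm i)
        -- An edge outside the common basis is inside the basis of the dual, where the two limits
        -- have exchanged roles.
        side (inj₁ out) = dual-side (R*.predicted-in resolved* (o , x , c) (out⇒outU resolved out))

      Partner : Fin m → Set
      Partner e = ∃ λ f → (f ≢ e) × Undetermined f ×
        ((PairOut f e × lower f < upper e) ⊎ (PairIn f e × lower e < upper f))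

      partner : ∀ {e} → Undetermined e → Partner e
      partner {e} und@(c , x) = side (Bases.out-or-in M k e)
        where
        dual-side : (∃ λ f → (f ≢ e) × R*.PairOut f e × (lower e < upper f) × R*.Undetermined f) → Partner e
        dual-side (f , f≢e , (fo , x′ , c′) , λμ , (xf , cf)) = f , f≢e , (cf , xf) , inj₂ ((fo , c′ , x′) , λμ)
        direct-side : (∃ λ f → (f ≢ e) × PairOut f e × (lower f < upper e) × Undetermined f) → Partner e
        direct-side (f , f≢e , pair , λμ , und-f) = f , f≢e , und-f , inj₁ (pair , λμ)
        side : _ → Partner e
        side (inj₂ i) = direct-side (partner-in resolved i und)
        side (inj₁ out) = dual-side (R*.partner-in resolved* (out⇒outU resolved out) (x , c))

-- Limits of intervals as perturbed rationals

module LimitKeys where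

  open MintySystems
  open CriticalPairs
  open import Data.Rational using (ℚ; _<_; _≤_)
  open import Data.Rational.Properties using (<⇒≤; ≤-refl; <-trans; <-≤-trans)

  Key : Set
  Key = ℚ × ℕ

  data _≺_ : Key → Key → Set where
    first  : ∀ {a b i j} → a < b → (a , i) ≺ (b , j)
    second : ∀ {a i j} → i ℕ.< j → (a , i) ≺ (a , j)

  ≺-trans : Transitive _≺_
  ≺-trans (first p)  (first q)  = first (<-trans p q)
  ≺-trans (first p)  (second q) = first p
  ≺-trans (second p) (first q)  = first q
  ≺-trans (second p) (second q) = second (ℕₚ.<-trans p q)

  ≺-irrefl : ∀ {a i} → ¬ (a , i) ≺ (a , i)
  ≺-irrefl (first p)  = ℚₚ.<-irrefl refl p
  ≺-irrefl (second p) = ℕₚ.<-irrefl refl p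

  ≺-asym : ∀ {x y} → x ≺ y → ¬ y ≺ x
  ≺-asym p q = ≺-irrefl (≺-trans p q)

  ≺-cmp : Trichotomous _≡_ _≺_
  ≺-cmp (a , i) (b , j) with ℚₚ.<-cmp a b
  ... | tri< p _ _ = tri< (first p) (λ { refl → ℚₚ.<-irrefl refl p }) (≺-asym (first p))
  ... | tri> _ _ p = tri> (≺-asym (first p)) (λ { refl → ℚₚ.<-irrefl refl p }) (first p)
  ... | tri≈ _ refl _ with ℕₚ.<-cmp i j
  ... | tri< p _ _ = tri< (second p) (λ { refl → ℕₚ.<-irrefl refl p }) (≺-asym (second p))
  ... | tri> _ _ p = tri> (≺-asym (second p)) (λ { refl → ℕₚ.<-irrefl refl p }) (second p)
  ... | tri≈ _ refl _ = tri≈ ≺-irrefl refl ≺-irrefl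

  -- An open lower limit l acts as l + ε and an open upper limit u as u − ε; the second component
  -- encodes this infinitesimal and breaks ties by the edge index.
  module Embedding {m : ℕ} where
    valueKey : Fin m → ℚ → Key
    valueKey h q = q , m ℕ.+ toℕ h

    -- The second components fill three disjoint blocks of length `m`: at the same rational, open
    -- upper limits come first, then values and trivial limits, then open lower limits.
    lowerKey upperKey : Fin m → Interval → Key
    lowerKey h (pt a)   = valueKey h a
    lowerKey h (op l u) = l , m ℕ.+ (m ℕ.+ toℕ h)
    upperKey h (pt a)   = valueKey h a
    upperKey h (op l u) = u , toℕ h

    lo≤ : ∀ {x} J → x ∈I J → lo J ≤ x
    lo≤ (pt a) refl = ≤-refl
    lo≤ (op l u) (p , _) = <⇒≤ p

    ≤hi : ∀ {x} J → x ∈I J → x ≤ hi J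
    ≤hi (pt a) refl = ≤-refl
    ≤hi (op l u) (_ , p) = <⇒≤ p

    lowerKey-injective : ∀ e h I J → lowerKey e I ≡ lowerKey h J → e ≡ h
    lowerKey-injective e h (pt a) (pt b) p = toℕ-injective (ℕₚ.+-cancelˡ-≡ m _ _ (cong proj₂ p))
    lowerKey-injective e h (pt a) (op l u) p =
      ⊥-elim (ℕₚ.<⇒≢ (ℕₚ.+-monoʳ-< m (ℕₚ.<-≤-trans (toℕ<n e) (ℕₚ.m≤m+n m (toℕ h)))) (cong proj₂ p))
    lowerKey-injective e h (op l u) (pt a) p =
      ⊥-elim (ℕₚ.<⇒≢ (ℕₚ.+-monoʳ-< m (ℕₚ.<-≤-trans (toℕ<n h) (ℕₚ.m≤m+n m (toℕ e)))) (sym (cong proj₂ p)))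
    lowerKey-injective e h (op l u) (op l′ u′) p =
      toℕ-injective (ℕₚ.+-cancelˡ-≡ m _ _ (ℕₚ.+-cancelˡ-≡ m _ _ (cong proj₂ p)))

    upperKey-injective : ∀ e h I J → upperKey e I ≡ upperKey h J → e ≡ h
    upperKey-injective e h (pt a) (pt b) p = toℕ-injective (ℕₚ.+-cancelˡ-≡ m _ _ (cong proj₂ p))
    upperKey-injective e h (pt a) (op l u) p =
      ⊥-elim (ℕₚ.<⇒≢ (ℕₚ.<-≤-trans (toℕ<n h) (ℕₚ.m≤m+n m (toℕ e))) (sym (cong proj₂ p)))
    upperKey-injective e h (op l u) (pt a) p =
      ⊥-elim (ℕₚ.<⇒≢ (ℕₚ.<-≤-trans (toℕ<n e) (ℕₚ.m≤m+n m (toℕ h))) (cong proj₂ p))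
    upperKey-injective e h (op l u) (op l′ u′) p = toℕ-injective (cong proj₂ p)

    value≮lower : ∀ h J {x} → x ∈I J → ¬ valueKey h x ≺ lowerKey h J
    value≮lower h (pt a) refl p = ≺-irrefl p
    value≮lower h (op l u) (l<x , _) p = ≺-asym p (first l<x)

    upper≮value : ∀ h J {x} → x ∈I J → ¬ upperKey h J ≺ valueKey h x
    upper≮value h (pt a) refl p = ≺-irrefl p
    upper≮value h (op l u) (_ , x<u) p = ≺-asym p (first x<u)

    module _ (e h : Fin m) {l u : ℚ} where
      private
        idx< : ∀ n → toℕ e ℕ.< m ℕ.+ n
        idx< n = ℕₚ.<-≤-trans (toℕ<n e) (ℕₚ.m≤m+n m n)

      value<upper : ∀ {x} → valueKey h x ≺ upperKey e (op l u) → x < u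
      value<upper (first p) = p
      value<upper (second p) = ⊥-elim (ℕₚ.<-asym p (idx< _))

      lower<value : ∀ {x} → lowerKey e (op l u) ≺ valueKey h x → l < x
      lower<value (first p) = p
      lower<value (second p) = ⊥-elim (ℕₚ.<-asym p (ℕₚ.+-monoʳ-< m (ℕₚ.<-≤-trans (toℕ<n h) (ℕₚ.m≤m+n m _))))

      -- When two open limits are equal the index has decided, and strictness comes from `x` lying
      -- strictly inside its own interval. This is why comparing keys suffices for the strict
      -- criterion.
      upper<upper : ∀ J {x} → x ∈I J → upperKey h J ≺ upperKey e (op l u) → x < u
      upper<upper (pt a) refl p = value<upper p
      upper<upper (op l′ u′) (_ , q) (first p) = <-trans q p
      upper<upper (op l′ u′) (_ , q) (second p) = q

      lower<lower : ∀ J {x} → x ∈I J → lowerKey e (op l u) ≺ lowerKey h J → l < x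
      lower<lower (pt a) refl p = lower<value p
      lower<lower (op l′ u′) (q , _) (first p) = <-trans p q
      lower<lower (op l′ u′) (q , _) (second p) = q

      lower<upper : ∀ J → lowerKey h J ≺ upperKey e (op l u) → lo J < u
      lower<upper (pt a) p = value<upper p
      lower<upper (op l′ u′) (first p) = p
      lower<upper (op l′ u′) (second p) = ⊥-elim (ℕₚ.<-asym p (idx< _))

      lower<upper′ : ∀ J → lowerKey e (op l u) ≺ upperKey h J → l < hi J
      lower<upper′ (pt a) p = lower<value p
      lower<upper′ (op l′ u′) (first p) = p
      lower<upper′ (op l′ u′) (second p) = ⊥-elim (ℕₚ.<-asym p (ℕₚ.<-≤-trans (toℕ<n h) (ℕₚ.m≤m+n m _)))

    <⇒lower<upper : ∀ e h I J → lo I < hi J → lowerKey e I ≺ upperKey h J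
    <⇒lower<upper e h (pt _) (pt _) p = first p
    <⇒lower<upper e h (pt _) (op _ _) p = first p
    <⇒lower<upper e h (op _ _) (pt _) p = first p
    <⇒lower<upper e h (op _ _) (op _ _) p = first p

-- Mandatory, undetermined and determined edges in a given state of knowledge

module QueryStates where

  open MintySystems
  open CriticalPairs
  open LimitKeys
  open import Data.Rational using (ℚ; _<_; _≤_; _⊔_; _⊓_)
  open import Data.Rational.Properties using (_<?_; _≤?_; <-trans; ≤-<-trans; <-≤-trans; ≮⇒≥; ≰⇒>; <-dense)

  <⇒≱ : ∀ {p q} → p < q → ¬ q ≤ p
  <⇒≱ p<q q≤p = ℚₚ.<-irrefl refl (<-≤-trans p<q q≤p)

  isOpen : Interval → Bool
  isOpen (pt _) = false
  isOpen (op _ _) = true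

  sameRegion-above : ∀ {a b l u} → l < u → u ≤ a → b < u → sameRegion a b l u ≡ false
  sameRegion-above {a} {b} {l} {u} l<u u≤a b<u
    with a ≤? l | l <? a | a <? u | u ≤? a | u ≤? b
  ... | yes a≤l | _ | _ | _ | _ = ⊥-elim (<⇒≱ (<-≤-trans l<u u≤a) a≤l)
  ... | no _ | _ | yes a<u | _ | _ = ⊥-elim (<⇒≱ a<u u≤a)
  ... | no _ | _ | no _ | _ | yes u≤b = ⊥-elim (<⇒≱ b<u u≤b)
  ... | no _ | yes _ | no _ | yes _ | no _ = refl
  ... | no _ | yes _ | no _ | no _ | no _ = refl
  ... | no _ | no _ | no _ | yes _ | no _ = refl
  ... | no _ | no _ | no _ | no _ | no _ = refl

  sameRegion-below : ∀ {a b l u} → l < u → a ≤ l → l < b → sameRegion a b l u ≡ false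
  sameRegion-below {a} {b} {l} {u} l<u a≤l l<b
    with a ≤? l | b ≤? l | l <? a | u ≤? a
  ... | _ | yes b≤l | _ | _ = ⊥-elim (<⇒≱ l<b b≤l)
  ... | _ | no _ | yes l<a | _ = ⊥-elim (<⇒≱ l<a a≤l)
  ... | _ | no _ | _ | yes u≤a = ⊥-elim (<⇒≱ (≤-<-trans a≤l l<u) u≤a)
  ... | yes _ | no _ | no _ | no _ = refl
  ... | no _ | no _ | no _ | no _ = refl

  lo<hi : ∀ {x l u} → x ∈I op l u → l < u
  lo<hi (p , q) = <-trans p q

  <-⊔ : ∀ {a b c} → a < c → b < c → a ⊔ b < c
  <-⊔ {a} {b} p q with ℚₚ.⊔-sel a b
  ... | inj₁ eq = subst (_< _) (sym eq) p
  ... | inj₂ eq = subst (_< _) (sym eq) q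

  <-⊓ : ∀ {a b c} → c < a → c < b → c < a ⊓ b
  <-⊓ {a} {b} p q with ℚₚ.⊓-sel a b
  ... | inj₁ eq = subst (_ <_) (sym eq) p
  ... | inj₂ eq = subst (_ <_) (sym eq) q

  op-nonempty : ∀ {J l u x} → J ≡ op l u → x ∈I J → l < u
  op-nonempty refl = lo<hi

  module Analysis {m} (M : Minty m) where
    open Minty M
    open Embedding {m}

    Intervals Values : Set
    Intervals = Fin m → Interval
    Values = Fin m → ℚ

    _∈J_ : Values → Intervals → Set
    x ∈J J = ∀ h → x h ∈I J h

    Mandatory : Intervals → Values → Fin m → Set
    Mandatory J x e = ∃₂ λ l u → (J e ≡ op l u) × HasCircuit M (λ h → x h < u) e × HasCocircuit M (λ h → l < x h) e

    -- `Det` is what permits deleting or contracting `e` without a query; its weak inequalities make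
    -- it the exact opposite of `Undet` on open edges.
    Undet Det : Intervals → Fin m → Set
    Undet J e = ∃₂ λ l u → (J e ≡ op l u) × HasCircuit M (λ h → lo (J h) < u) e × HasCocircuit M (λ h → l < hi (J h)) e
    Det J e = HasCircuit M (λ h → hi (J h) ≤ lo (J e)) e ⊎ HasCocircuit M (λ h → hi (J e) ≤ lo (J h)) e

    mandatory⇒undet : ∀ {J x e} → x ∈J J → Mandatory J x e → Undet J e
    mandatory⇒undet {J} x∈J (l , u , eq , c , k) = l , u , eq ,
      mapCircuit M (λ h _ p → ≤-<-trans (lo≤ (J h) (x∈J h)) p) c ,
      mapCocircuit M (λ h _ p → <-≤-trans p (≤hi (J h) (x∈J h))) k

    det⇒¬undet : ∀ {J e} → Det J e → ¬ Undet J e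
    det⇒¬undet {J} {e} (inj₁ c) (l , u , eq , _ , x) with meet M c x
    ... | h , _ , p , q = <⇒≱ q (subst (λ i → hi (J h) ≤ lo i) eq p)
    det⇒¬undet {J} {e} (inj₂ x) (l , u , eq , c , _) with meet M c x
    ... | h , _ , p , q = <⇒≱ p (subst (λ i → hi i ≤ lo (J h)) eq q)

    det-or-undet : ∀ {J e l u} → J e ≡ op l u → Det J e ⊎ Undet J e
    det-or-undet {J} {e} {l} {u} eq with paintDec M (λ h → lo (J h) <? u) e
    ... | inj₂ x = inj₁ (inj₂ (mapCocircuit M (λ h _ p → subst (λ i → hi i ≤ lo (J h)) (sym eq) (≮⇒≥ p)) x))
    ... | inj₁ c with paintDec M (λ h → hi (J h) ≤? l) e
    ... | inj₁ c′ = inj₁ (inj₁ (mapCircuit M (λ h _ p → subst (λ i → hi (J h) ≤ lo i) (sym eq) p) c′))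
    ... | inj₂ x = inj₂ (l , u , eq , c , mapCocircuit M (λ h _ → ≰⇒>) x)

    -- One painting for each half of the criterion. The result is positive, a circuit or a
    -- cocircuit, and in this form it is carried through deletions and contractions.
    ¬mandatory⇒blocked : ∀ {J v e l u} → J e ≡ op l u → ¬ Mandatory J v e →
      HasCircuit M (λ h → v h ≤ l) e ⊎ HasCocircuit M (λ h → u ≤ v h) e
    ¬mandatory⇒blocked {J} {v} {e} {l} {u} eq ¬m with paintDec M (λ h → v h <? u) e
    ... | inj₂ x = inj₂ (mapCocircuit M (λ h _ → ≮⇒≥) x)
    ... | inj₁ c with paintDec M (λ h → v h ≤? l) e
    ... | inj₁ c′ = inj₁ c′
    ... | inj₂ x = ⊥-elim (¬m (l , u , eq , c , mapCocircuit M (λ h _ → ≰⇒>) x))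

    module _ (J : Intervals) (v : Values) (v∈J : v ∈J J) where

      keys : Keys m
      keys = record
        { K = Key ; _<_ = _≺_ ; <-trans = ≺-trans ; <-cmp = ≺-cmp
        ; lower = λ h → lowerKey h (J h) ; upper = λ h → upperKey h (J h) ; value = λ h → valueKey h (v h)
        ; open? = λ h → isOpen (J h)
        ; lower-injective = λ {e} {h} → lowerKey-injective e h (J e) (J h)
        ; upper-injective = λ {e} {h} → upperKey-injective e h (J e) (J h)
        ; lower≤value = λ h → value≮lower h (J h) (v∈J h)
        ; value≤upper = λ h → upper≮value h (J h) (v∈J h)
        ; closed = λ h → closed (J h) }
        where
        closed : ∀ {h} I → isOpen I ≡ false → lowerKey h I ≡ upperKey h I
        closed (pt a) _ = refl

      open Symmetric M keys
      open KeyFacts keys using (lower; upper; value) renaming (_<?_ to _≺?_)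

      KM : Fin m → Set
      KM = KnownMandatory

      opens : ∀ e → isOpen (J e) ≡ true → ∃₂ λ l u → J e ≡ op l u
      opens e p with J e
      ... | op l u = l , u , refl

      isOpen-op : ∀ {e l u} → J e ≡ op l u → isOpen (J e) ≡ true
      isOpen-op eq rewrite eq = refl

      Undetermined⇒Undet : ∀ {e} → isOpen (J e) ≡ true → Undetermined e → Undet J e
      Undetermined⇒Undet {e} o (c , x) with opens e o
      ... | l , u , eq = l , u , eq ,
        mapCircuit M (λ h _ p → lower<upper e h {l} (J h) (subst (λ i → lower h ≺ upperKey e i) eq p)) c ,
        mapCocircuit M (λ h _ p → lower<upper′ e h {l} {u} (J h) (subst (λ i → lowerKey e i ≺ upper h) eq p)) x

      Undet⇒Undetermined : ∀ {e} → Undet J e → Undetermined e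
      Undet⇒Undetermined {e} (l , u , eq , c , x) =
        mapCircuit M (λ h _ p → <⇒lower<upper h e (J h) (J e) (subst (λ i → lo (J h) < hi i) (sym eq) p)) c ,
        mapCocircuit M (λ h _ p → <⇒lower<upper e h (J e) (J h) (subst (λ i → lo i < hi (J h)) (sym eq) p)) x

      pairIn⇒mandatory : ∀ {e f x} → x ∈J J → PairIn e f → x f < hi (J e) → Mandatory J x e
      pairIn⇒mandatory {e} {f} {x} x∈J (o , c , k) xf<u with opens e o
      ... | l , u , eq = l , u , eq , mapCircuit M (λ h _ p → below h p (h ≟ f)) c ,
        mapCocircuit M (λ h _ p → lower<lower e h {l} {u} (J h) (x∈J h) (subst (λ i → lowerKey e i ≺ lower h) eq p)) k
        where
        below : ∀ h → (h ≢ f → upper h ≺ upper e) → Dec (h ≡ f) → x h < u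
        below h p (yes refl) = subst (λ i → x h < hi i) eq xf<u
        below h p (no h≢f) = upper<upper e h {l} (J h) (x∈J h) (subst (λ i → upper h ≺ upperKey e i) eq (p h≢f))

      pairOut⇒mandatory : ∀ {e f x} → x ∈J J → PairOut e f → lo (J e) < x f → Mandatory J x e
      pairOut⇒mandatory {e} {f} {x} x∈J (o , c , k) l<xf with opens e o
      ... | l , u , eq = l , u , eq , mapCircuit M (λ h _ p → upper<upper e h {l} (J h) (x∈J h) (subst (λ i → upper h ≺ upperKey e i) eq p)) c ,
        mapCocircuit M (λ h _ p → above h p (h ≟ f)) k
        where
        above : ∀ h → (h ≢ f → lower e ≺ lower h) → Dec (h ≡ f) → l < x h
        above h p (yes refl) = subst (λ i → lo i < x h) eq l<xf
        above h p (no h≢f) = lower<lower e h {l} {u} (J h) (x∈J h) (subst (λ i → lowerKey e i ≺ lower h) eq (p h≢f))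

      km⇒mandatory : ∀ {e x} → x ∈J J → KM e → Mandatory J x e
      km⇒mandatory {e} {x} x∈J (o , c , k) with opens e o
      ... | l , u , eq = l , u , eq ,
        mapCircuit M (λ h _ p → upper<upper e h {l} (J h) (x∈J h) (subst (λ i → upper h ≺ upperKey e i) eq p)) c ,
        mapCocircuit M (λ h _ p → lower<lower e h {l} {u} (J h) (x∈J h) (subst (λ i → lowerKey e i ≺ lower h) eq p)) k

      mandatory⇒predicted : ∀ {e} → Mandatory J v e → PredictedMandatory e
      mandatory⇒predicted {e} (l , u , eq , c , k) = isOpen-op eq ,
        mapCircuit M (λ h _ p → subst (λ i → value h ≺ upperKey e i) (sym eq) (first p)) c ,
        mapCocircuit M (λ h _ p → subst (λ i → lowerKey e i ≺ value h) (sym eq) (first p)) k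

      km? : ∀ e → Dec (KM e)
      km? e with isOpen (J e)
      ... | false = no λ { (() , _) }
      ... | true with paintDec M (λ h → upper h ≺? upper e) e | paintDec M (λ h → ¬? (lower e ≺? lower h)) e
      ... | inj₂ x | _ = no λ { (_ , c , _) → let (_ , _ , p , q) = meet M c x in q p }
      ... | inj₁ c | inj₁ c′ = no λ { (_ , _ , x) → let (_ , _ , p , q) = meet M c′ x in p q }
      ... | inj₁ c | inj₂ x = yes (refl , c , mapCocircuit M (λ h _ p → decidable-stable (lower e ≺? lower h) p) x)

      mandatory? : ∀ e → Dec (Mandatory J v e)
      mandatory? e with J e in eq
      ... | pt _ = no λ { (_ , _ , () , _) }
      ... | op l u with paintDec M (λ h → v h <? u) e | paintDec M (λ h → v h ≤? l) e
      ... | inj₂ x | _ = no λ { (_ , _ , refl , c , _) → let (_ , _ , p , q) = meet M c x in q p }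
      ... | inj₁ c | inj₁ c′ = no λ { (_ , _ , refl , _ , x) → let (_ , _ , p , q) = meet M c′ x in <⇒≱ q p }
      ... | inj₁ c | inj₂ x = yes (l , u , refl , c , mapCocircuit M (λ h _ → ≰⇒>) x)

      -- If the value of companion is good, then main is mandatory; if not, the prediction of companion is wrong relative to main.
      record Config : Set₁ where
        field
          {main companion} : Fin m
          Good : ℚ → Set
          good? : ∀ t → Dec (Good t)
          distinct : companion ≢ main
          undet-companion : Undet J companion
          forces : ∀ x → x ∈J J → Good (x companion) → Mandatory J x main
          good-predicted : Good (v companion)
          wrong : ∀ t → ¬ Good t → sameRegion t (v companion) (lo (J main)) (hi (J main)) ≡ false

      J-nonempty : ∀ {e} → isOpen (J e) ≡ true → lo (J e) < hi (J e)
      J-nonempty {e} o with J e | v∈J e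
      ... | op l u | p = lo<hi p

      config : (∀ e → ¬ KM e) → ∀ g → Mandatory J v g → Config
      config none g pm with predicted-pair none (mandatory⇒predicted pm)
      ... | e , f , fo , f≢e , und , inj₁ (pair , ν) = record
        { main = e ; companion = f ; Good = λ t → t < hi (J e) ; good? = λ t → t <? hi (J e)
        ; distinct = f≢e ; undet-companion = Undetermined⇒Undet fo und
        ; forces = λ x x∈J → pairIn⇒mandatory x∈J pair
        ; good-predicted = good
        ; wrong = λ t bad → sameRegion-above (J-nonempty (proj₁ pair)) (≮⇒≥ bad) good }
        where
        good : v f < hi (J e)
        good with opens e (proj₁ pair)
        ... | l , u , eq = subst (λ i → v f < hi i) (sym eq) (value<upper e f {l} (subst (λ i → value f ≺ upperKey e i) eq ν))
      ... | e , f , fo , f≢e , und , inj₂ (pair , ν) = record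
        { main = e ; companion = f ; Good = λ t → lo (J e) < t ; good? = λ t → lo (J e) <? t
        ; distinct = f≢e ; undet-companion = Undetermined⇒Undet fo und
        ; forces = λ x x∈J → pairOut⇒mandatory x∈J pair
        ; good-predicted = good
        ; wrong = λ t bad → sameRegion-below (J-nonempty (proj₁ pair)) (≮⇒≥ bad) good }
        where
        good : lo (J e) < v f
        good with opens e (proj₁ pair)
        ... | l , u , eq = subst (λ i → lo i < v f) (sym eq) (lower<value e f {l} {u} (subst (λ i → lowerKey e i ≺ value f) eq ν))

      -- If a query set omits `q`, then `q` may take the value `t`, which forces `f` into the set;
      -- hence every feasible query set meets the pair.
      WitnessPartner : Fin m → Fin m → Set
      WitnessPartner q f = (f ≢ q) × Undet J f × ∃ λ t → (t ∈I J q) × (∀ x → x ∈J J → x q ≡ t → Mandatory J x f)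

      inside : ∀ {q l u t} → J q ≡ op l u → l < t → t < u → t ∈I J q
      inside eq a b rewrite eq = a , b

      witness-partner : (∀ e → ¬ KM e) → ∀ q → Undet J q → ∃ λ f → WitnessPartner q f
      witness-partner none q und@(l , u , eq , c , x) with partner none (Undet⇒Undetermined und)
      ... | f , f≢q , und-f , inj₁ (pair , p) = f , f≢q , Undetermined⇒Undet (proj₁ pair) und-f , found
        where
        lf<u : lo (J f) < u
        lf<u = lower<upper q f {l} (J f) (subst (λ i → lower f ≺ upperKey q i) eq p)
        l<u : l < u
        l<u = subst (λ i → lo i < hi i) eq (J-nonempty (isOpen-op eq))
        found : ∃ λ t → (t ∈I J q) × (∀ x → x ∈J J → x q ≡ t → Mandatory J x f)
        -- Above `lo (J f)` to force `f`, and strictly between `l` and `u` to be admissible for `q`.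
        found with <-dense (<-⊔ lf<u l<u)
        ... | t , a , b = t , inside eq (≤-<-trans (ℚₚ.p≤q⊔p (lo (J f)) l) a) b ,
          λ x x∈J xq → pairOut⇒mandatory x∈J pair (subst (lo (J f) <_) (sym xq) (≤-<-trans (ℚₚ.p≤p⊔q (lo (J f)) l) a))
      ... | f , f≢q , und-f , inj₂ (pair , p) = f , f≢q , Undetermined⇒Undet (proj₁ pair) und-f , found
        where
        l<uf : l < hi (J f)
        l<uf = lower<upper′ q f {l} {u} (J f) (subst (λ i → lowerKey q i ≺ upper f) eq p)
        l<u : l < u
        l<u = subst (λ i → lo i < hi i) eq (J-nonempty (isOpen-op eq))
        found : ∃ λ t → (t ∈I J q) × (∀ x → x ∈J J → x q ≡ t → Mandatory J x f)
        found with <-dense (<-⊓ l<uf l<u)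
        ... | t , a , b = t , inside eq a (<-≤-trans b (ℚₚ.p⊓q≤q (hi (J f)) u)) ,
          λ x x∈J xq → pairIn⇒mandatory x∈J pair (subst (_< hi (J f)) (sym xq) (<-≤-trans b (ℚₚ.p⊓q≤p (hi (J f)) u)))

      data Verdict : Set where
        known : ∀ e → KM e → Verdict
        predicted : (∀ e → ¬ KM e) → ∀ g → Mandatory J v g → Verdict
        free : (∀ g → ¬ Mandatory J v g) → Verdict

      verdict : Verdict
      verdict with any? km?
      ... | yes (e , km) = known e km
      ... | no none with any? mandatory?
      ... | yes (g , pm) = predicted (λ e p → none (e , p)) g pm
      ... | no none′ = free (λ g p → none′ (g , p))

-- Walks, trails and separating colourings

module GraphWalks where

  open Preliminaries

  _∈?_ : ∀ {m} (e : Fin m) es → Dec (e ∈ es)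
  _∈?_ = DecMembership._∈?_ _≟_

  _∖_ _⊕_ : ∀ {m} → EdgeSet m → Fin m → EdgeSet m
  (S ∖ e) f = if ⌊ f ≟ e ⌋ then false else S f
  (S ⊕ e) f = if ⌊ f ≟ e ⌋ then true else S f

  module _ {m} {S : EdgeSet m} {e : Fin m} where
    ∖-intro : ∀ {f} → f ≢ e → S f ≡ true → (S ∖ e) f ≡ true
    ∖-intro {f} f≢e p with f ≟ e
    ... | yes q = ⊥-elim (f≢e q)
    ... | no _ = p

    ∖-elim : ∀ {f} → (S ∖ e) f ≡ true → (f ≢ e) × (S f ≡ true)
    ∖-elim {f} p with f ≟ e
    ... | no q = q , p

    ∖-removed : (S ∖ e) e ≡ false
    ∖-removed with e ≟ e
    ... | yes _ = refl
    ... | no p = ⊥-elim (p refl)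

    ⊕-added : (S ⊕ e) e ≡ true
    ⊕-added with e ≟ e
    ... | yes _ = refl
    ... | no p = ⊥-elim (p refl)

    ⊕-intro : ∀ {f} → S f ≡ true → (S ⊕ e) f ≡ true
    ⊕-intro {f} p with f ≟ e
    ... | yes _ = refl
    ... | no _ = p

    ⊕-elim : ∀ {f} → (S ⊕ e) f ≡ true → f ≢ e → S f ≡ true
    ⊕-elim {f} p f≢e with f ≟ e
    ... | yes q = ⊥-elim (f≢e q)
    ... | no _ = p

  module Walks {n m} (g : Graph n m) where

    src tgt : Fin m → Fin n
    src e = proj₁ (ends g e)
    tgt e = proj₂ (ends g e)

    swapJoins : ∀ {e u v} → Joins g e u v → Joins g e v u
    swapJoins = swap

    joins : ∀ e → Joins g e (src e) (tgt e)
    joins e = inj₁ refl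

    Conn : EdgeSet m → Fin n → Fin n → Set
    Conn S u v = ∃ λ es → Walk g S u v es

    Noncrossing : EdgeSet m → (Fin n → Bool) → Set
    Noncrossing S χ = ∀ h → S h ≡ true → present g h ≡ true → χ (src h) ≡ χ (tgt h)

    Separated : EdgeSet m → Fin n → Fin n → Set
    Separated S u v = Σ (Fin n → Bool) λ χ → (χ u ≡ true) × (χ v ≡ false) × Noncrossing S χ

    conn-refl : ∀ {S u} → Conn S u u
    conn-refl = [] , []

    _⁀_ : ∀ {S u v w es fs} → Walk g S u v es → Walk g S v w fs → Walk g S u w (es ++ fs)
    [] ⁀ q = q
    _∷_ e c p ⁀ q = _∷_ e c (p ⁀ q)

    conn-trans : ∀ {S u v w} → Conn S u v → Conn S v w → Conn S u w
    conn-trans (_ , p) (_ , q) = _ , p ⁀ q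

    conn-edge : ∀ {S u v} e → S e ≡ true → present g e ≡ true → Joins g e u v → Conn S u v
    conn-edge e a b j = _ , _∷_ e (a , b , j) []

    conn-sym : ∀ {S u v} → Conn S u v → Conn S v u
    conn-sym (_ , p) = sym′ p
      where
      sym′ : ∀ {S u v es} → Walk g S u v es → Conn S v u
      sym′ [] = conn-refl
      sym′ (_∷_ e (a , b , j) p) = conn-trans (sym′ p) (conn-edge e a b (swapJoins j))

    walk-map : ∀ {S S′ u v es} → (∀ h → h ∈ es → S h ≡ true → S′ h ≡ true) → Walk g S u v es → Walk g S′ u v es
    walk-map i [] = []
    walk-map i (_∷_ e (a , b , j) p) = _∷_ e (i e (here refl) a , b , j) (walk-map (λ h h∈ → i h (there h∈)) p)

    conn-mono : ∀ {S S′ u v} → (∀ h → S h ≡ true → S′ h ≡ true) → Conn S u v → Conn S′ u v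
    conn-mono i (_ , p) = _ , walk-map (λ h _ → i h) p

    conn-bind : ∀ {S S′ u v} → (∀ h → S h ≡ true → present g h ≡ true → Conn S′ (src h) (tgt h)) → Conn S u v → Conn S′ u v
    conn-bind {S} {S′} i (_ , p) = go p
      where
      go : ∀ {u v es} → Walk g S u v es → Conn S′ u v
      go [] = conn-refl
      go (_∷_ e (a , b , inj₁ refl) p) = conn-trans (i e a b) (go p)
      go (_∷_ e (a , b , inj₂ refl) p) = conn-trans (conn-sym (i e a b)) (go p)

    conn-ends : ∀ {S e u v} → Joins g e u v → Conn S u v → Conn S (src e) (tgt e)
    conn-ends (inj₁ refl) c = c
    conn-ends (inj₂ refl) c = conn-sym c

    walk-sound : ∀ {S u v es h} → Walk g S u v es → h ∈ es → (S h ≡ true) × (present g h ≡ true)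
    walk-sound (_∷_ e (a , b , _) p) (here refl) = a , b
    walk-sound (_∷_ e c p) (there i) = walk-sound p i

    joins-color : ∀ {h u v} (χ : Fin n → Bool) → Joins g h u v → χ (src h) ≡ χ (tgt h) → χ u ≡ χ v
    joins-color χ (inj₁ refl) p = p
    joins-color χ (inj₂ refl) p = sym p

    walk-color : ∀ {S u v es} (χ : Fin n → Bool) → (∀ h → h ∈ es → χ (src h) ≡ χ (tgt h)) → Walk g S u v es → χ u ≡ χ v
    walk-color χ i [] = refl
    walk-color χ i (_∷_ e (_ , _ , j) p) = trans (joins-color χ j (i e (here refl))) (walk-color χ (λ h h∈ → i h (there h∈)) p)

    noncrossing-conn : ∀ {S u v χ} → Noncrossing S χ → Conn S u v → χ u ≡ χ v
    noncrossing-conn {χ = χ} nc (_ , p) = walk-color χ (λ h h∈ → nc h (proj₁ (walk-sound p h∈)) (proj₂ (walk-sound p h∈))) p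

    private
      SepBy : List (Fin m) → EdgeSet m → Fin n → Fin n → Set
      SepBy es S u v = Σ (Fin n → Bool) λ χ → (χ u ≡ true) × (χ v ≡ false) × (∀ h → h ∈ es → S h ≡ true → present g h ≡ true → χ (src h) ≡ χ (tgt h))

      sep-sym : ∀ {es S u v} → SepBy es S u v → SepBy es S v u
      sep-sym (χ , a , b , nc) = not ∘ χ , cong not b , cong not a , λ h p q r → cong not (nc h p q r)

      -- If neither side of e reaches u, the product of the two colourings avoids e.
      combine : ∀ {es S u v x y e} → Joins g e x y → SepBy es S u x → (σ : SepBy es S u v) → proj₁ σ y ≡ false → SepBy (e ∷ es) S u v
      combine {es} {S} {u} {v} {x} {y} {e} j (χ , u₁ , x₁ , nc₁) (ψ , u₂ , v₂ , nc₂) y₂ =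
        φ , cong₂ _∧_ u₁ u₂ , trans (cong (χ v ∧_) v₂) (Boolₚ.∧-zeroʳ (χ v)) , nc
        where
        φ : Fin n → Bool
        φ w = χ w ∧ ψ w
        φx : φ x ≡ false
        φx = cong (_∧ ψ x) x₁
        φy : φ y ≡ false
        φy = trans (cong (χ y ∧_) y₂) (Boolₚ.∧-zeroʳ (χ y))
        nc : ∀ h → h ∈ e ∷ es → S h ≡ true → present g h ≡ true → φ (src h) ≡ φ (tgt h)
        nc h (here refl) _ _ = joins-back j
          where
          joins-back : Joins g e x y → φ (src e) ≡ φ (tgt e)
          joins-back (inj₁ eq) = trans (cong (φ ∘ proj₁) eq) (trans (trans φx (sym φy)) (cong (φ ∘ proj₂) (sym eq)))
          joins-back (inj₂ eq) = trans (cong (φ ∘ proj₁) eq) (trans (trans φy (sym φx)) (cong (φ ∘ proj₂) (sym eq)))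
        nc h (there i) a b = cong₂ _∧_ (nc₁ h i a b) (nc₂ h i a b)

      monochromatic : ∀ {es S u v e} (σ : SepBy es S u v) →
        (S e ≡ true → present g e ≡ true → proj₁ σ (src e) ≡ proj₁ σ (tgt e)) → SepBy (e ∷ es) S u v
      monochromatic (χ , a , b , nc) p = χ , a , b , λ { h (here refl) → p ; h (there i) → nc h i }

      -- Reachability is decided by induction on the list of edges that the colouring must respect.
      -- Only an edge `e` crossing the colouring found so far needs work: either walks to its two
      -- ends combine into a walk over `e`, or one of these walks is blocked, and the blocking
      -- colouring repairs the old one. This needs the induction hypothesis for other end points.
      conn-or-sepBy : ∀ S es u v → Conn S u v ⊎ SepBy es S u v
      conn-or-sepBy S [] u v with u ≟ v
      ... | yes refl = inj₁ conn-refl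
      ... | no u≢v = inj₂ ((λ w → ⌊ w ≟ u ⌋) , ⌊⌋-true (u ≟ u) refl , other , λ _ ())
        where
        other : ⌊ v ≟ u ⌋ ≡ false
        other with v ≟ u
        ... | yes p = ⊥-elim (u≢v (sym p))
        ... | no _ = refl
      conn-or-sepBy S (e ∷ es) u v with conn-or-sepBy S es u v
      ... | inj₁ c = inj₁ c
      ... | inj₂ σ@(χ , u₁ , v₁ , nc) =
        cases (bool-dec (S e)) (bool-dec (present g e)) (bool-dec (χ (src e))) (bool-dec (χ (tgt e)))
        where
        across : S e ≡ true → present g e ≡ true → ∀ {x y} → Joins g e x y → χ x ≡ true → χ y ≡ false →
          Conn S u v ⊎ SepBy (e ∷ es) S u v
        across eqS eqP {x} {y} j χx χy with conn-or-sepBy S es u x | conn-or-sepBy S es y v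
        ... | inj₁ c | inj₁ d = inj₁ (conn-trans c (conn-trans (conn-edge e eqS eqP j) d))
        ... | inj₂ s | _ = inj₂ (combine j s σ χy)
        ... | _ | inj₂ s = inj₂ (sep-sym (combine (swapJoins {e} j) (sep-sym s) (sep-sym σ) (cong not χx)))
        cases : (S e ≡ true) ⊎ (S e ≡ false) → (present g e ≡ true) ⊎ (present g e ≡ false) →
          (χ (src e) ≡ true) ⊎ (χ (src e) ≡ false) → (χ (tgt e) ≡ true) ⊎ (χ (tgt e) ≡ false) →
          Conn S u v ⊎ SepBy (e ∷ es) S u v
        cases (inj₂ p) _ _ _ = inj₂ (monochromatic σ (λ a _ → ⊥-elim (true≢false a p)))
        cases _ (inj₂ p) _ _ = inj₂ (monochromatic σ (λ _ a → ⊥-elim (true≢false a p)))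
        cases _ _ (inj₁ a) (inj₁ b) = inj₂ (monochromatic σ (λ _ _ → trans a (sym b)))
        cases _ _ (inj₂ a) (inj₂ b) = inj₂ (monochromatic σ (λ _ _ → trans a (sym b)))
        cases (inj₁ p) (inj₁ q) (inj₁ a) (inj₂ b) = across p q (joins e) a b
        cases (inj₁ p) (inj₁ q) (inj₂ a) (inj₁ b) = across p q (swapJoins {e} (joins e)) b a

    conn-or-separated : ∀ S u v → Conn S u v ⊎ Separated S u v
    conn-or-separated S u v with conn-or-sepBy S (allFin m) u v
    ... | inj₁ c = inj₁ c
    ... | inj₂ (χ , a , b , nc) = inj₂ (χ , a , b , λ h → nc h (∈-allFin h))

    conn? : ∀ S u v → Dec (Conn S u v)
    conn? S u v with conn-or-separated S u v
    ... | inj₁ c = yes c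
    ... | inj₂ (χ , a , b , nc) = no λ c → true≢false (trans (sym (noncrossing-conn {χ = χ} nc c)) a) b

    record Split (S : EdgeSet m) (u w : Fin n) (es : List (Fin m)) (e : Fin m) : Set where
      field
        {x y} : Fin n
        {before after} : List (Fin m)
        prefix : Walk g S u x before
        suffix : Walk g S y w after
        step : Joins g e x y
        split : es ≡ before ++ e ∷ after

    splitAt : ∀ {S u w es e} → Walk g S u w es → e ∈ es → Split S u w es e
    splitAt (_∷_ e (a , b , j) p) (here refl) = record { prefix = [] ; suffix = p ; step = j ; split = refl }
    splitAt (_∷_ e c p) (there i) = record { prefix = _∷_ e c s.prefix ; suffix = s.suffix ; step = s.step ; split = cong (e ∷_) s.split }
      where module s = Split (splitAt p i)

    unique-split : ∀ (xs : List (Fin m)) {e ys} → Unique (xs ++ e ∷ ys) → (e ∉ xs) × (e ∉ ys) × Unique ys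
    unique-split [] (e∉ ∷ u) = (λ ()) , (λ i → All.lookup e∉ i refl) , u
    unique-split (x ∷ xs) (x∉ ∷ u) with unique-split xs u
    ... | a , b , c = (λ { (here refl) → All.lookup x∉ (∈-++⁺ʳ xs (here refl)) refl ; (there i) → a i }) , b , c

    trail : ∀ {S u w} → Conn S u w → ∃ λ es → Walk g S u w es × Unique es
    trail (_ , p) = go p
      where
      go : ∀ {S u w es} → Walk g S u w es → ∃ λ es → Walk g S u w es × Unique es
      go [] = [] , [] , []
      go (_∷_ e c p) with go p
      ... | es , q , uniq with e ∈? es
      ... | no e∉ = e ∷ es , _∷_ e c q , All.tabulate (λ { i refl → e∉ i }) ∷ uniq
      ... | yes e∈ = rejoin (splitAt q e∈)
        where
        rejoin : Split _ _ _ es e → _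
        rejoin s with unique-split (Split.before s) (subst Unique (Split.split s) uniq)
        ... | _ , e∉ , uniq′ with proj₂ (proj₂ c) | Split.step s
        ... | inj₁ a | inj₁ b with trans (sym a) b
        ...   | refl = e ∷ Split.after s , _∷_ e c (Split.suffix s) , All.tabulate (λ { i refl → e∉ i }) ∷ uniq′
        rejoin s | _ , e∉ , uniq′ | inj₂ a | inj₂ b with trans (sym a) b
        ...   | refl = e ∷ Split.after s , _∷_ e c (Split.suffix s) , All.tabulate (λ { i refl → e∉ i }) ∷ uniq′
        -- Opposite directions: the later passage of `e` returns to the starting vertex, so the part
        -- after it is already a trail from there and `e` disappears.
        rejoin s | _ , e∉ , uniq′ | inj₁ a | inj₂ b with trans (sym a) b
        ...   | refl = Split.after s , Split.suffix s , uniq′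
        rejoin s | _ , e∉ , uniq′ | inj₂ a | inj₁ b with trans (sym a) b
        ...   | refl = Split.after s , Split.suffix s , uniq′

    cycle-through : ∀ {S e} → present g e ≡ true → S e ≡ true → Conn (S ∖ e) (src e) (tgt e) →
      ∃ λ es → Cycle g S es × e ∈ es
    cycle-through {S} {e} pe se c with trail (conn-sym c)
    ... | es , p , uniq = e ∷ es , ((λ ()) , All.tabulate fresh ∷ uniq , _ ,
          _∷_ e (se , pe , joins e) (walk-map (λ h _ q → proj₂ (∖-elim {S = S} {e} q)) p)) , here refl
      where
      fresh : ∀ {h} → h ∈ es → e ≢ h
      fresh i refl = proj₁ (∖-elim {S = S} {e} (proj₁ (walk-sound p i))) refl

    -- Going around a closed trail the other way connects the ends of any of its edges.
    around : ∀ {S es e} → Cycle g S es → e ∈ es → Conn (λ h → ⌊ h ∈? es ⌋ ∧ (S ∖ e) h) (src e) (tgt e)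
    around {S} {es} {e} (_ , uniq , v , p) e∈ = conn-ends (Split.step s) (conn-sym (_ , post ⁀ pre))
      where
      s = splitAt p e∈
      open Split s using (before; after; prefix; suffix; split; x; y)
      parts = unique-split before (subst Unique split uniq)
      S′ : EdgeSet m
      S′ h = ⌊ h ∈? es ⌋ ∧ (S ∖ e) h
      keep : ∀ h → h ∈ es → h ≢ e → S h ≡ true → S′ h ≡ true
      keep h i h≢e q = cong₂ _∧_ (⌊⌋-true (h ∈? es) i) (∖-intro {S = S} h≢e q)
      pre : Walk g S′ v x before
      pre = walk-map (λ h i → keep h (subst (h ∈_) (sym split) (∈-++⁺ˡ i)) (λ { refl → proj₁ parts i })) prefix
      post : Walk g S′ y v after
      post = walk-map (λ h i → keep h (subst (h ∈_) (sym split) (∈-++⁺ʳ before (there i))) (λ { refl → proj₁ (proj₂ parts) i })) suffix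

-- Exchange arguments for minimum spanning trees

module SpanningTrees where

  open Preliminaries
  open QueryStates using (<⇒≱; <-⊔; <-⊓; op-nonempty)
  open GraphWalks
  open import Data.Rational using (ℚ; 0ℚ; _<_; _≤_; _+_; -_; _⊔_; _⊓_)
  open import Data.Rational.Properties using (_≤?_; ≤-refl; ≤-trans; ≤-reflexive)

  Σℚ-cong : ∀ {m} {f g : Fin m → ℚ} → (∀ h → f h ≡ g h) → Σℚ f ≡ Σℚ g
  Σℚ-cong {zero} p = refl
  Σℚ-cong {suc m} p = cong₂ _+_ (p zero) (Σℚ-cong (p ∘ suc))

  -- The changed terms appear crosswise on the two sides, which avoids subtraction.
  Σℚ-update : ∀ {m} {f g : Fin m → ℚ} e → (∀ h → h ≢ e → f h ≡ g h) → Σℚ f + g e ≡ Σℚ g + f e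
  Σℚ-update {suc m} {f} {g} zero p = begin
    (f zero + Σℚ (f ∘ suc)) + g zero ≡⟨ ℚₚ.+-comm _ (g zero) ⟩
    g zero + (f zero + Σℚ (f ∘ suc)) ≡⟨ cong (g zero +_) (trans (ℚₚ.+-comm (f zero) _) (cong (_+ f zero) (Σℚ-cong (λ h → p (suc h) (λ ()))))) ⟩
    g zero + (Σℚ (g ∘ suc) + f zero) ≡⟨ sym (ℚₚ.+-assoc (g zero) _ (f zero)) ⟩
    (g zero + Σℚ (g ∘ suc)) + f zero ∎
    where open ≡-Reasoning
  Σℚ-update {suc m} {f} {g} (suc e) p = begin
    (f zero + Σℚ (f ∘ suc)) + g (suc e) ≡⟨ ℚₚ.+-assoc (f zero) _ _ ⟩
    f zero + (Σℚ (f ∘ suc) + g (suc e)) ≡⟨ cong₂ _+_ (p zero (λ ())) (Σℚ-update e (λ h h≢e → p (suc h) (λ { refl → h≢e refl }))) ⟩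
    g zero + (Σℚ (g ∘ suc) + f (suc e)) ≡⟨ sym (ℚₚ.+-assoc (g zero) _ _) ⟩
    (g zero + Σℚ (g ∘ suc)) + f (suc e) ∎
    where open ≡-Reasoning

  +-cancelʳ-≤ : ∀ r {p q} → p + r ≤ q + r → p ≤ q
  +-cancelʳ-≤ r {p} {q} le = subst₂ _≤_ (undo p) (undo q) (ℚₚ.+-monoˡ-≤ (- r) le)
    where
    undo : ∀ p → (p + r) + (- r) ≡ p
    undo p = trans (ℚₚ.+-assoc p r (- r)) (trans (cong (p +_) (ℚₚ.+-inverseʳ r)) (ℚₚ.+-identityʳ p))

  +-cancelˡ-≤ : ∀ r {p q} → r + p ≤ r + q → p ≤ q
  +-cancelˡ-≤ r {p} {q} le = +-cancelʳ-≤ r (subst₂ _≤_ (ℚₚ.+-comm r p) (ℚₚ.+-comm r q) le)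

  module _ {m} (x : Fin m → ℚ) where
    contribution : EdgeSet m → Fin m → ℚ
    contribution T e = if T e then x e else 0ℚ

    contribution-in : ∀ T {e} → T e ≡ true → contribution T e ≡ x e
    contribution-in T p rewrite p = refl

    contribution-out : ∀ T {e} → T e ≡ false → contribution T e ≡ 0ℚ
    contribution-out T p rewrite p = refl

    weight-remove : ∀ T {h} → T h ≡ true → weightOf (T ∖ h) x + x h ≡ weightOf T x
    weight-remove T {h} Th = begin
      weightOf (T ∖ h) x + x h ≡⟨ cong (weightOf (T ∖ h) x +_) (sym (contribution-in T Th)) ⟩
      weightOf (T ∖ h) x + contribution T h ≡⟨ Σℚ-update h same ⟩
      weightOf T x + contribution (T ∖ h) h ≡⟨ cong (weightOf T x +_) (contribution-out (T ∖ h) {h} (∖-removed {S = T} {h})) ⟩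
      weightOf T x + 0ℚ ≡⟨ ℚₚ.+-identityʳ _ ⟩
      weightOf T x ∎
      where
      open ≡-Reasoning
      same : ∀ k → k ≢ h → contribution (T ∖ h) k ≡ contribution T k
      same k k≢h with k ≟ h
      ... | yes p = ⊥-elim (k≢h p)
      ... | no _ = refl

    weight-add : ∀ T {e} → T e ≡ false → weightOf (T ⊕ e) x ≡ weightOf T x + x e
    weight-add T {e} Te = begin
      weightOf (T ⊕ e) x ≡⟨ sym (ℚₚ.+-identityʳ _) ⟩
      weightOf (T ⊕ e) x + 0ℚ ≡⟨ cong (weightOf (T ⊕ e) x +_) (sym (contribution-out T Te)) ⟩
      weightOf (T ⊕ e) x + contribution T e ≡⟨ Σℚ-update e same ⟩
      weightOf T x + contribution (T ⊕ e) e ≡⟨ cong (weightOf T x +_) (contribution-in (T ⊕ e) {e} (⊕-added {S = T} {e})) ⟩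
      weightOf T x + x e ∎
      where
      open ≡-Reasoning
      same : ∀ k → k ≢ e → contribution (T ⊕ e) k ≡ contribution T k
      same k k≢e with k ≟ e
      ... | yes p = ⊥-elim (k≢e p)
      ... | no _ = refl

    weight-swap : ∀ T {h e} → T h ≡ true → T e ≡ false → weightOf ((T ∖ h) ⊕ e) x + x h ≡ weightOf T x + x e
    weight-swap T {h} {e} Th Te = begin
      weightOf ((T ∖ h) ⊕ e) x + x h ≡⟨ cong (_+ x h) (weight-add (T ∖ h) {e} out) ⟩
      (weightOf (T ∖ h) x + x e) + x h ≡⟨ ℚₚ.+-assoc (weightOf (T ∖ h) x) (x e) (x h) ⟩
      weightOf (T ∖ h) x + (x e + x h) ≡⟨ cong (weightOf (T ∖ h) x +_) (ℚₚ.+-comm (x e) (x h)) ⟩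
      weightOf (T ∖ h) x + (x h + x e) ≡⟨ sym (ℚₚ.+-assoc (weightOf (T ∖ h) x) (x h) (x e)) ⟩
      (weightOf (T ∖ h) x + x h) + x e ≡⟨ cong (_+ x e) (weight-remove T {h} Th) ⟩
      weightOf T x + x e ∎
      where
      open ≡-Reasoning
      out : (T ∖ h) e ≡ false
      out with e ≟ h
      ... | yes _ = refl
      ... | no _ = Te

  weight-change-out : ∀ {m} T {e : Fin m} {x x₀} → (∀ h → T h ≡ true → h ≢ e → x h ≡ x₀ h) → T e ≡ false → weightOf T x ≡ weightOf T x₀
  weight-change-out T {e} {x} {x₀} p Te = Σℚ-cong same
    where
    same : ∀ h → contribution x T h ≡ contribution x₀ T h
    same h with T h in eq
    ... | false = refl
    ... | true = p h eq (λ { refl → true≢false eq Te })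

  weight-change-in : ∀ {m} T {e : Fin m} {x x₀} → (∀ h → T h ≡ true → h ≢ e → x h ≡ x₀ h) → T e ≡ true → weightOf T x + x₀ e ≡ weightOf T x₀ + x e
  weight-change-in T {e} {x} {x₀} p Te = begin
    weightOf T x + x₀ e ≡⟨ cong (weightOf T x +_) (sym (contribution-in x₀ T Te)) ⟩
    weightOf T x + contribution x₀ T e ≡⟨ Σℚ-update e same ⟩
    weightOf T x₀ + contribution x T e ≡⟨ cong (weightOf T x₀ +_) (contribution-in x T Te) ⟩
    weightOf T x₀ + x e ∎
    where
    open ≡-Reasoning
    same : ∀ h → h ≢ e → contribution x T h ≡ contribution x₀ T h
    same h h≢e with T h in eq
    ... | false = refl
    ... | true = p h eq h≢e

  weight-ext : ∀ {m} {T T′ : EdgeSet m} x → (∀ h → T h ≡ T′ h) → weightOf T x ≡ weightOf T′ x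
  weight-ext x p = Σℚ-cong (λ h → cong (λ b → if b then x h else 0ℚ) (p h))

  ¬¬-em : ∀ {A B : Set} → (A → ¬ ¬ B) → (¬ A → ¬ ¬ B) → ¬ ¬ B
  ¬¬-em a n k = n (λ x → a x k) k

  _◂_ : ∀ {m} → Bool → EdgeSet m → EdgeSet (suc m)
  (b ◂ S) zero = b
  (b ◂ S) (suc i) = S i

  allSubsets : ∀ m → List (EdgeSet m)
  allSubsets zero = (λ ()) ∷ []
  allSubsets (suc m) = map (true ◂_) (allSubsets m) ++ map (false ◂_) (allSubsets m)

  -- Edge sets are functions, so a set is only pointwise equal to a listed one; hence the
  -- extensionality lemmas for weights and spanning trees.
  allSubsets-complete : ∀ {m} (S : EdgeSet m) → ∃ λ S′ → S′ ∈ allSubsets m × (∀ h → S h ≡ S′ h)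
  allSubsets-complete {zero} S = _ , here refl , λ ()
  allSubsets-complete {suc m} S with allSubsets-complete (S ∘ suc) | S zero in eq
  ... | S′ , i , p | true = true ◂ S′ , ∈-++⁺ˡ (∈-map⁺ (true ◂_) i) , λ { zero → eq ; (suc h) → p h }
  ... | S′ , i , p | false = false ◂ S′ , ∈-++⁺ʳ (map (true ◂_) (allSubsets m)) (∈-map⁺ (false ◂_) i) , λ { zero → eq ; (suc h) → p h }

  -- Being a spanning tree is not decided here, so the case split on `P b` is classical and the
  -- minimum exists under a double negation. This suffices, since `mst-exists` serves only to refute
  -- `PredictionMandatory`.
  minimum-in-list : ∀ {A : Set} (P : A → Set) (f : A → ℚ) l → ∀ a → P a → ¬ ¬ (∃ λ a′ → P a′ × (f a′ ≤ f a) × (∀ b → b ∈ l → P b → f a′ ≤ f b))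
  minimum-in-list P f [] a p k = k (a , p , ≤-refl , λ _ ())
  minimum-in-list P f (b ∷ l) a p = ¬¬-em both (λ ¬Pb k → minimum-in-list P f l a p λ { (c , pc , ca , r) →
      k (c , pc , ca , λ { _ (here refl) pb → ⊥-elim (¬Pb pb) ; d (there i) → r d i }) })
    where
    both : P b → _
    both pb with f a ≤? f b
    ... | yes a≤b = λ k → minimum-in-list P f l a p λ { (c , pc , ca , r) →
      k (c , pc , ca , λ { _ (here refl) _ → ≤-trans ca a≤b ; d (there i) → r d i }) }
    ... | no a≰b = λ k → minimum-in-list P f l b pb λ { (c , pc , cb , r) →
      k (c , pc , ≤-trans cb (ℚₚ.<⇒≤ (ℚₚ.≰⇒> a≰b)) , λ { _ (here refl) _ → cb ; d (there i) → r d i }) }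

  module Cuts {n m} (g : Graph n m) where
    open Walks g public

    cycle-map : ∀ {S S′ es} → (∀ h → h ∈ es → S h ≡ true → S′ h ≡ true) → Cycle g S es → Cycle g S′ es
    cycle-map i (ne , u , v , p) = ne , u , v , walk-map i p

    cross : ∀ {S u v es} (χ : Fin n → Bool) → χ u ≢ χ v → Walk g S u v es → ∃ λ h → h ∈ es × (χ (src h) ≢ χ (tgt h))
    cross χ ne [] = ⊥-elim (ne refl)
    cross χ ne (_∷_ {v = v} e (_ , _ , j) p) with χ (src e) Boolₚ.≟ χ (tgt e)
    ... | no q = e , here refl , q
    ... | yes q with cross χ (λ r → ne (trans (joins-color χ j q) r)) p
    ... | h , i , r = h , there i , r

    -- The counterparts of `HasCircuit` and `HasCocircuit` on the present edges, so that they also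
    -- make sense while a graph is being reduced.
    CircuitOn CutOn : (Fin m → Set) → Fin m → Set
    CircuitOn P e = ∃ λ es → Cycle g (present g) es × e ∈ es × (∀ h → h ∈ es → h ≢ e → P h)
    CutOn P e = Σ (Fin n → Bool) λ χ → (χ (src e) ≢ χ (tgt e)) × (∀ h → present g h ≡ true → χ (src h) ≢ χ (tgt h) → h ≢ e → P h)

    bypass : ∀ {P e} → CircuitOn P e → ∃ λ A → Conn A (src e) (tgt e) × (∀ h → A h ≡ true → (h ≢ e) × P h)
    bypass {P} {e} (es , cyc , e∈ , p) = (λ h → ⌊ h ∈? es ⌋ ∧ (present g ∖ e) h) , around cyc e∈ , λ h q → sound h (h ∈? es) q
      where
      sound : ∀ h (d : Dec (h ∈ es)) → ⌊ d ⌋ ∧ (present g ∖ e) h ≡ true → (h ≢ e) × P h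
      sound h (yes i) q = let h≢e = proj₁ (∖-elim {S = present g} {e} {h} q) in h≢e , p h i h≢e

    meetOn : ∀ {P Q e} → CircuitOn P e → CutOn Q e → ∃ λ h → (h ≢ e) × (present g h ≡ true) × P h × Q h
    meetOn c (χ , χe , q) with bypass c
    ... | A , path , A-ok with cross χ χe (proj₂ path)
    ... | h , h∈ , χh with walk-sound (proj₂ path) h∈
    ... | Ah , ph with A-ok h Ah
    ... | h≢e , Ph = h , h≢e , ph , Ph , q h ph χh h≢e

    paintOn : ∀ {P : Fin m → Set} → (∀ h → Dec (P h)) → ∀ {e} → present g e ≡ true → CircuitOn P e ⊎ CutOn (¬_ ∘ P) e
    paintOn {P} P? {e} pe = side (conn-or-separated (A ∖ e) (src e) (tgt e))
      where
      A : EdgeSet m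
      A h = ⌊ P? h ⌋
      side : Conn (A ∖ e) (src e) (tgt e) ⊎ Separated (A ∖ e) (src e) (tgt e) → CircuitOn P e ⊎ CutOn (¬_ ∘ P) e
      side (inj₁ c) with cycle-through {S = A ⊕ e} pe (⊕-added {S = A} {e}) (conn-mono (λ h q → let (a , b) = ∖-elim {S = A} {e} {h} q in ∖-intro {S = A ⊕ e} a (⊕-intro {S = A} b)) c)
      ... | es , cyc@(_ , _ , _ , p) , e∈ = inj₁ (es , cycle-map (λ h i _ → proj₂ (walk-sound p i)) cyc , e∈ ,
            λ h i h≢e → ⌊⌋-sound (P? h) (⊕-elim {S = A} {e} (proj₁ (walk-sound p i)) h≢e))
      side (inj₂ (χ , a , b , nc)) = inj₂ (χ , (λ q → true≢false (trans (sym q) a) b) ,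
        λ h ph χh h≢e Ph → χh (nc h (∖-intro {S = A} h≢e (⌊⌋-true (P? h) Ph)) ph))

  module Trees {n m} (g : Graph n m) (ends-active : ∀ e → present g e ≡ true →
        (active g (proj₁ (ends g e)) ≡ true) × (active g (proj₂ (ends g e)) ≡ true)) where
    open Cuts g

    -- The tree path between the ends of `e` has to cross the cut, and an edge `h` where it does so
    -- can be replaced by `e`.
    exchange-in : ∀ {T e} → SpanningTree g T → present g e ≡ true → T e ≡ false →
      (χ : Fin n → Bool) → χ (src e) ≢ χ (tgt e) →
      ∃ λ h → (T h ≡ true) × (χ (src h) ≢ χ (tgt h)) × SpanningTree g ((T ∖ h) ⊕ e)
    exchange-in {T} {e} (T⊆ , acyclic , conn) pe Te χ ne
      with trail (conn (src e) (tgt e) (proj₁ (ends-active e pe)) (proj₂ (ends-active e pe)))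
    ... | es , p , uniq with cross χ ne p
    ... | h , h∈ , χh = h , Th , χh , sub , acyclic′ , connected′
      where
      Th : T h ≡ true
      Th = proj₁ (walk-sound p h∈)
      T′ : EdgeSet m
      T′ = (T ∖ h) ⊕ e
      s = splitAt p h∈
      open Split s using (before; after; prefix; suffix; split; x; y; step)
      parts = unique-split before (subst Unique split uniq)
      pre : Conn (T ∖ h) (src e) x
      pre = _ , walk-map (λ k i → ∖-intro {S = T} (λ { refl → proj₁ parts i })) prefix
      post : Conn (T ∖ h) y (tgt e)
      post = _ , walk-map (λ k i → ∖-intro {S = T} (λ { refl → proj₁ (proj₂ parts) i })) suffix
      grow : ∀ {u v} → Conn (T ∖ h) u v → Conn T′ u v
      grow = conn-mono (λ k → ⊕-intro {S = T ∖ h})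
      sub : T′ ⊆ present g
      sub k q with k ≟ e
      ... | yes refl = pe
      ... | no _ = T⊆ k (proj₂ (∖-elim {S = T} {h} {k} q))
      bridge : Conn T′ x y
      bridge = conn-trans (conn-sym (grow pre)) (conn-trans (conn-edge e (⊕-added {S = T ∖ h} {e}) pe (joins e)) (conn-sym (grow post)))
      connected′ : ∀ u v → active g u ≡ true → active g v ≡ true → Conn T′ u v
      connected′ u v a b = conn-bind rep (conn u v a b)
        where
        rep : ∀ k → T k ≡ true → present g k ≡ true → Conn T′ (src k) (tgt k)
        rep k Tk pk with k ≟ h
        ... | yes refl = conn-ends step bridge
        ... | no k≢h = grow (conn-edge k (∖-intro {S = T} k≢h Tk) pk (joins k))
      acyclic′ : ∀ es → ¬ Cycle g T′ es
      acyclic′ es c with e ∈? es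
      ... | no e∉ = acyclic es (cycle-map (λ k i q → proj₂ (∖-elim {S = T} {h} {k} (⊕-elim {S = T ∖ h} {e} q (λ { refl → e∉ i })))) c)
      -- Going around the cycle joins the ends of `e` inside `T` without `h`; with the two pieces of
      -- the tree path this joins the ends of `h`, so `T` would already have a cycle.
      ... | yes e∈ = acyclic _ (proj₁ (proj₂ (cycle-through (T⊆ h Th) Th (conn-ends step (conn-trans (conn-sym pre) (conn-trans loop (conn-sym post)))))))
        where
        loop : Conn (T ∖ h) (src e) (tgt e)
        loop = conn-mono (λ k q → let (a , b) = ∖-elim {S = T′} {e} {k} (proj₂ (∧-true q)) in ⊕-elim {S = T ∖ h} {e} b a) (around c e∈)
          where
          ∧-true : ∀ {a b} → a ∧ b ≡ true → (a ≡ true) × (b ≡ true)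
          ∧-true {true} {true} _ = refl , refl

    -- Removing `e` splits the tree into two colour classes. The given path crosses between them at
    -- an edge `h` outside `T`, and the edge that `exchange-in` removes for `h` across the same
    -- colouring can only be `e`.
    exchange-out : ∀ {T e A} → SpanningTree g T → T e ≡ true → Conn A (src e) (tgt e) → (∀ h → A h ≡ true → h ≢ e) →
      ∃ λ h → (A h ≡ true) × (T h ≡ false) × SpanningTree g ((T ∖ e) ⊕ h)
    exchange-out {T} {e} {A} st@(T⊆ , acyclic , _) Te c A≢e with conn-or-separated (T ∖ e) (src e) (tgt e)
    ... | inj₁ d = ⊥-elim (acyclic _ (proj₁ (proj₂ (cycle-through (T⊆ e Te) Te d))))
    ... | inj₂ (χ , a , b , nc) with cross χ (λ q → true≢false (trans (sym q) a) b) (proj₂ c)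
    ... | h , h∈ , χh = h , Ah , Th , found
      where
      Ah : A h ≡ true
      Ah = proj₁ (walk-sound (proj₂ c) h∈)
      ph : present g h ≡ true
      ph = proj₂ (walk-sound (proj₂ c) h∈)
      Th : T h ≡ false
      Th with bool-dec (T h)
      ... | inj₂ q = q
      ... | inj₁ q = ⊥-elim (χh (nc h (∖-intro {S = T} (A≢e h Ah) q) ph))
      found : SpanningTree g ((T ∖ e) ⊕ h)
      found with exchange-in st ph Th χ χh
      ... | k , Tk , χk , st′ with k ≟ e
      ... | yes refl = st′
      ... | no k≢e = ⊥-elim (χk (nc k (∖-intro {S = T} k≢e Tk) (T⊆ k Tk)))

    -- Each listed edge is dropped if its ends are otherwise connected when its turn comes. Later
    -- removals only destroy connections, so an edge that is kept stays a bridge.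
    prune : ∀ ks S → ∃ λ S′ → (∀ h → S′ h ≡ true → S h ≡ true) × (∀ u v → Conn S u v → Conn S′ u v) ×
      (∀ k → k ∈ ks → S′ k ≡ true → ¬ Conn (S′ ∖ k) (src k) (tgt k))
    prune [] S = S , (λ _ p → p) , (λ _ _ c → c) , λ _ ()
    prune (k ∷ ks) S with conn? (S ∖ k) (src k) (tgt k)
    ... | no ¬c with prune ks S
    ... | S′ , i , c , b = S′ , i , c , λ
      { _ (here refl) _ d → ¬c (conn-mono (λ h q → let (x , y) = ∖-elim {S = S′} {k} {h} q in ∖-intro {S = S} x (i h y)) d)
      ; l (there j) → b l j }
    prune (k ∷ ks) S | yes ck with prune ks (S ∖ k)
    ... | S′ , i , c , b = S′ , (λ h p → proj₂ (∖-elim {S = S} {k} {h} (i h p))) , (λ u v d → c u v (conn-bind rep d)) , λ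
      { _ (here refl) p _ → proj₁ (∖-elim {S = S} {k} {k} (i k p)) refl ; l (there j) → b l j }
      where
      rep : ∀ h → S h ≡ true → present g h ≡ true → Conn (S ∖ k) (src h) (tgt h)
      rep h Sh ph with h ≟ k
      ... | yes refl = ck
      ... | no h≢k = conn-edge h (∖-intro {S = S} h≢k Sh) ph (joins h)

    spanningTree : Connected g → ∃ λ T → SpanningTree g T
    spanningTree conn with prune (allFin m) (present g)
    ... | T , i , c , b = T , i , acyclic , λ u v p q → c u v (conn u v p q)
      where
      acyclic : ∀ es → ¬ Cycle g T es
      acyclic [] (ne , _) = ne refl
      acyclic (e ∷ es) cyc@(_ , _ , _ , p) = b e (∈-allFin e) (proj₁ (walk-sound p (here refl)))
        (conn-mono (λ h q → ∧-right q) (around cyc (here refl)))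
        where
        ∧-right : ∀ {a b} → a ∧ b ≡ true → b ≡ true
        ∧-right {true} {true} _ = refl

    spanningTree-ext : ∀ {T T′} → (∀ h → T h ≡ T′ h) → SpanningTree g T → SpanningTree g T′
    spanningTree-ext p (s , a , c) = (λ e q → s e (trans (p e) q)) ,
      (λ es cyc → a es (cycle-map (λ h _ → trans (p h)) cyc)) , λ u v x y → conn-mono (λ h → trans (sym (p h))) (c u v x y)

    mst-exists : Connected g → ∀ x → ¬ ¬ (∃ λ T → MST g x T)
    mst-exists conn x k with spanningTree conn
    ... | T₀ , st₀ = minimum-in-list (SpanningTree g) (λ T → weightOf T x) (allSubsets m) T₀ st₀ λ
      { (T , st , _ , r) → k (T , st , λ T′ st′ → let (S , S∈ , q) = allSubsets-complete T′ in
          ≤-trans (r S S∈ (spanningTree-ext q st′)) (≤-reflexive (sym (weight-ext x q)))) }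

    module _ (I : Fin m → Interval) (v : Fin m → ℚ) where

      -- If `e` were not queried, one tree `T` would be optimal for every value of `e` in its
      -- interval. With `e` in `T`, a value close to `u` makes another edge of the circuit cheaper;
      -- with `e` outside `T`, a value close to `l` makes `e` cheaper than a tree edge of the cut.
      forced : ∀ {Q} → Feasible g I v Q → (x : Fin m → ℚ) →
        (∀ h → present g h ≡ true → (Q h ≡ true → x h ≡ v h) × (x h ∈I I h)) →
        ∀ {e l u} → present g e ≡ true → I e ≡ op l u →
        CircuitOn (λ h → x h < u) e → CutOn (λ h → l < x h) e → Q e ≡ true
      forced {Q} (_ , T , optimal) x x-ok {e} {l} {u} pe eq c (χ , χe , above) = decide (bool-dec (Q e)) (bool-dec (T e))
        where
        x[_] : ℚ → Fin m → ℚ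
        x[ t ] = x [ e ≔ t ]
        x-at : ∀ t → x[ t ] e ≡ t
        x-at = update-at x e
        x-off : ∀ t {h} → h ≢ e → x[ t ] h ≡ x h
        x-off = update-off x e
        l<u : l < u
        l<u = op-nonempty eq (proj₂ (x-ok e pe))
        mst : Q e ≡ false → ∀ t → l < t → t < u → MST g x[ t ] T
        mst Qe t l<t t<u = optimal x[ t ] λ h ph → λ where
            .proj₁ Qh → trans (x-off t (λ { refl → true≢false Qh Qe })) (proj₁ (x-ok h ph) Qh)
            .proj₂ _ → inside h ph
          where
          inside : ∀ h → present g h ≡ true → x[ t ] h ∈I I h
          inside = update-elim x e t (λ h y → present g h ≡ true → y ∈I I h)
            (λ _ → subst (t ∈I_) (sym eq) (l<t , t<u)) (λ h _ ph → proj₂ (x-ok h ph))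
        st : Q e ≡ false → SpanningTree g T
        st Qe with ℚₚ.<-dense l<u
        ... | t , a , b = proj₁ (mst Qe t a b)
        improve : ∀ {t h k} → MST g x[ t ] T → T h ≡ true → T k ≡ false → SpanningTree g ((T ∖ h) ⊕ k) → ¬ x[ t ] k < x[ t ] h
        improve {t} {h} {k} (_ , opt) Th Tk st′ lt = <⇒≱ lt (+-cancelˡ-≤ (weightOf T x[ t ]) (≤-trans (ℚₚ.+-monoˡ-≤ (x[ t ] h) (opt _ st′)) (≤-reflexive (weight-swap x[ t ] T {h} {k} Th Tk))))
        decide : (Q e ≡ true) ⊎ (Q e ≡ false) → (T e ≡ true) ⊎ (T e ≡ false) → Q e ≡ true
        decide (inj₁ q) _ = q
        decide (inj₂ Qe) (inj₁ Te) with bypass c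
        ... | A , path , A-ok with exchange-out (st Qe) Te path (λ h q → proj₁ (A-ok h q))
        ... | h , Ah , Th , st′ with A-ok h Ah
        ... | h≢e , xh<u with ℚₚ.<-dense {l ⊔ x h} {u} (<-⊔ l<u xh<u)
        ... | t , a , b = ⊥-elim (improve {t} (mst Qe t (ℚₚ.≤-<-trans (ℚₚ.p≤p⊔q l (x h)) a) b) Te Th st′
                (subst₂ _<_ (sym (x-off t h≢e)) (sym (x-at t)) (ℚₚ.≤-<-trans (ℚₚ.p≤q⊔p l (x h)) a)))
        decide (inj₂ Qe) (inj₂ Te) with exchange-in (st Qe) pe Te χ χe
        ... | h , Th , χh , st′ with (λ { refl → true≢false Th Te }) | proj₁ (st Qe) h Th
        ... | h≢e | ph with ℚₚ.<-dense {l} {u ⊓ x h} (<-⊓ l<u (above h ph χh h≢e))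
        ... | t , a , b = ⊥-elim (improve {t} (mst Qe t a (ℚₚ.<-≤-trans b (ℚₚ.p⊓q≤p u (x h)))) Th Te st′
                (subst₂ _<_ (sym (x-at t)) (sym (x-off t h≢e)) (ℚₚ.<-≤-trans b (ℚₚ.p⊓q≤q u (x h)))))

    module _ (connected : Connected g) (I : Fin m → Interval) (v : Fin m → ℚ) {e : Fin m} (pe : present g e ≡ true) where

      private
        v[_] : ℚ → Fin m → ℚ
        v[ t ] = v [ e ≔ t ]
        v-at : ∀ t → v[ t ] e ≡ t
        v-at = update-at v e
        v-off : ∀ t {h} → h ≢ e → v[ t ] h ≡ v h
        v-off = update-off v e

      -- Such a tree certifies that all the other edges together form a feasible query set.
      avoidable : (∃ λ T → ∀ x → (∀ h → present g h ≡ true → h ≢ e → x h ≡ v h) → x e ∈I I e → MST g x T) →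
        ¬ PredictionMandatory g I v e
      avoidable (T , opt) (_ , all) = true≢false (all (present g ∖ e) feasible) (∖-removed {S = present g} {e})
        where
        feasible : Feasible g I v (present g ∖ e)
        feasible = (λ h q → proj₂ (∖-elim {S = present g} {e} {h} q)) , T , λ x ok →
          opt x (λ h ph h≢e → proj₁ (ok h ph) (∖-intro {S = present g} h≢e ph)) (proj₂ (ok e pe) (∖-removed {S = present g} {e}))

      agree : ∀ {T} {x : Fin m → ℚ} {t} → SpanningTree g T → (∀ h → present g h ≡ true → h ≢ e → x h ≡ v h) →
        ∀ h → T h ≡ true → h ≢ e → x h ≡ v[ t ] h
      agree {t = t} st ok h Th h≢e = trans (ok h (proj₁ st h Th) h≢e) (sym (v-off t h≢e))

      trivial-avoidable : ∀ {a} → I e ≡ pt a → ¬ PredictionMandatory g I v e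
      trivial-avoidable {a} eq pm = mst-exists connected v[ a ] λ { (T , st , opt) → avoidable (T , λ x ok xe →
          st , λ T′ st′ → subst₂ _≤_ (same x ok xe T st) (same x ok xe T′ st′) (opt T′ st′)) pm }
        where
        same : ∀ x → (∀ h → present g h ≡ true → h ≢ e → x h ≡ v h) → x e ∈I I e → ∀ T → SpanningTree g T → weightOf T v[ a ] ≡ weightOf T x
        same x ok xe T st = Σℚ-cong λ h → cell h (bool-dec (T h))
          where
          at-e : x e ≡ a
          at-e = subst (x e ∈I_) eq xe
          agree′ : ∀ h → T h ≡ true → Dec (h ≡ e) → v[ a ] h ≡ x h
          agree′ h Th (yes refl) = trans (v-at a) (sym at-e)
          agree′ h Th (no h≢e) = sym (agree {t = a} st ok h Th h≢e)
          cell : ∀ h → (T h ≡ true) ⊎ (T h ≡ false) → contribution v[ a ] T h ≡ contribution x T h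
          cell h (inj₁ q) = trans (contribution-in v[ a ] T q) (trans (agree′ h q (h ≟ e)) (sym (contribution-in x T q)))
          cell h (inj₂ q) = trans (contribution-out v[ a ] T q) (sym (contribution-out x T q))

      mst-swap : ∀ {t T h k} → MST g v[ t ] T → T h ≡ true → T k ≡ false → v[ t ] k ≤ v[ t ] h →
        SpanningTree g ((T ∖ h) ⊕ k) → MST g v[ t ] ((T ∖ h) ⊕ k)
      mst-swap {t} {T} {h} {k} (_ , opt) Th Tk k≤h st′ = st′ , λ T′ st″ → ≤-trans
        (+-cancelʳ-≤ (v[ t ] h) (≤-trans (≤-reflexive (weight-swap v[ t ] T {h} {k} Th Tk)) (ℚₚ.+-monoʳ-≤ (weightOf T v[ t ]) k≤h)))
        (opt T′ st″)

      -- On a circuit, `e` is set to `l` and an optimal tree is made to avoid `e`, by a swap if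
      -- necessary; raising `e` again leaves this tree unchanged and makes no other lighter. On a
      -- cut, `e` is set to `u` and the tree is made to contain `e`; lowering `e` gives this tree
      -- the full saving, and no tree gains more.
      open-avoidable : ∀ {l u} → I e ≡ op l u → CircuitOn (λ h → v h ≤ l) e ⊎ CutOn (λ h → u ≤ v h) e →
        ¬ PredictionMandatory g I v e
      open-avoidable {l} {u} eq (inj₁ c) pm = mst-exists connected v[ l ] λ { (T , mst) → without T mst (bool-dec (T e)) }
        where
        finish : ∀ T → MST g v[ l ] T → T e ≡ false → ⊥
        finish T (st , opt) Te = avoidable (T , λ x ok xe → st , λ T′ st′ →
          subst (_≤ weightOf T′ x) (sym (weight-change-out T (agree st ok) Te)) (≤-trans (opt T′ st′) (larger x ok xe T′ st′ (bool-dec (T′ e))))) pm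
          where
          larger : ∀ x → (∀ h → present g h ≡ true → h ≢ e → x h ≡ v h) → x e ∈I I e → ∀ T′ → SpanningTree g T′ →
            (T′ e ≡ true) ⊎ (T′ e ≡ false) → weightOf T′ v[ l ] ≤ weightOf T′ x
          larger x ok xe T′ st′ (inj₂ q) = ≤-reflexive (sym (weight-change-out T′ (agree st′ ok) q))
          larger x ok xe T′ st′ (inj₁ q) = +-cancelʳ-≤ (x e) (≤-trans (≤-reflexive (sym (weight-change-in T′ (agree st′ ok) q)))
            (ℚₚ.+-monoʳ-≤ (weightOf T′ x) (subst (_≤ x e) (sym (v-at l)) (ℚₚ.<⇒≤ (proj₁ (subst (x e ∈I_) eq xe))))))
        without : ∀ T → MST g v[ l ] T → (T e ≡ true) ⊎ (T e ≡ false) → ⊥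
        without T mst (inj₂ Te) = finish T mst Te
        without T mst@(st , _) (inj₁ Te) with bypass c
        ... | A , path , A-ok with exchange-out st Te path (λ h q → proj₁ (A-ok h q))
        ... | h , Ah , Th , st′ with A-ok h Ah
        ... | h≢e , vh≤l = finish ((T ∖ e) ⊕ h) (mst-swap mst Te Th (subst₂ _≤_ (sym (v-off l h≢e)) (sym (v-at l)) vh≤l) st′) out
          where
          out : ((T ∖ e) ⊕ h) e ≡ false
          out with e ≟ h
          ... | yes q = ⊥-elim (h≢e (sym q))
          ... | no _ = ∖-removed {S = T} {e}
      open-avoidable {l} {u} eq (inj₂ (χ , χe , above)) pm = mst-exists connected v[ u ] λ { (T , mst) → within T mst (bool-dec (T e)) }
        where
        finish : ∀ T → MST g v[ u ] T → T e ≡ true → ⊥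
        finish T (st , opt) Te = avoidable (T , λ x ok xe → st , λ T′ st′ → +-cancelʳ-≤ (v[ u ] e)
          (≤-trans (≤-reflexive (weight-change-in T (agree st ok) Te))
            (≤-trans (ℚₚ.+-monoˡ-≤ (x e) (opt T′ st′)) (smaller x ok xe T′ st′ (bool-dec (T′ e)))))) pm
          where
          smaller : ∀ x → (∀ h → present g h ≡ true → h ≢ e → x h ≡ v h) → x e ∈I I e → ∀ T′ → SpanningTree g T′ →
            (T′ e ≡ true) ⊎ (T′ e ≡ false) → weightOf T′ v[ u ] + x e ≤ weightOf T′ x + v[ u ] e
          smaller x ok xe T′ st′ (inj₁ q) = ≤-reflexive (sym (weight-change-in T′ (agree st′ ok) q))
          smaller x ok xe T′ st′ (inj₂ q) = ℚₚ.+-mono-≤ (≤-reflexive (sym (weight-change-out T′ (agree st′ ok) q)))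
            (subst (x e ≤_) (sym (v-at u)) (ℚₚ.<⇒≤ (proj₂ (subst (x e ∈I_) eq xe))))
        within : ∀ T → MST g v[ u ] T → (T e ≡ true) ⊎ (T e ≡ false) → ⊥
        within T mst (inj₁ Te) = finish T mst Te
        within T mst@(st , _) (inj₂ Te) with exchange-in st pe Te χ χe
        ... | h , Th , χh , st′ = finish ((T ∖ h) ⊕ e)
              (mst-swap mst Th Te (subst₂ _≤_ (sym (v-at u)) (sym (v-off u h≢e)) (above h (proj₁ st h Th) χh h≢e)) st′) (⊕-added {S = T ∖ h} {e})
          where
          h≢e : h ≢ e
          h≢e refl = true≢false Th Te

-- Deletions and contractions that keep the remaining graph free

module Reductions where

  open Preliminaries
  open MintySystems
  open QueryStates using (<⇒≱; lo<hi)
  open LimitKeys using (module Embedding)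
  open GraphWalks
  open SpanningTrees
  open import Data.Rational using (ℚ; _<_; _≤_)
  open import Data.Rational.Properties using (_≤?_; ≤-refl; ≤-trans; ≤-<-trans; <-≤-trans; <⇒≤)

  xor-true : ∀ {a b} → a ≢ b → a xor b ≡ true
  xor-true {true} {true} p = ⊥-elim (p refl)
  xor-true {true} {false} _ = refl
  xor-true {false} {true} _ = refl
  xor-true {false} {false} p = ⊥-elim (p refl)

  xor-sound : ∀ {a b} → a xor b ≡ true → a ≢ b
  xor-sound {true} {false} _ ()
  xor-sound {false} {true} _ ()

  module _ {n m} (ends : Fin m → Fin n × Fin n) where
    open Cuts (fullGraph ends)

    graphMinty : Minty m
    graphMinty = record
      { Circuit = ∃ λ es → Cycle (fullGraph ends) (λ _ → true) es
      ; Cocircuit = Fin n → Bool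
      ; onCircuit = λ C h → ⌊ h ∈? proj₁ C ⌋
      ; onCocircuit = λ χ h → χ (src h) xor χ (tgt h)
      ; orthogonal = orthogonal
      ; paint = paint }
      where
      orthogonal : ∀ (C : ∃ λ es → Cycle (fullGraph ends) (λ _ → true) es) (χ : Fin n → Bool) e →
        ⌊ e ∈? proj₁ C ⌋ ≡ true → χ (src e) xor χ (tgt e) ≡ true →
        ∃ λ h → (h ≢ e) × (⌊ h ∈? proj₁ C ⌋ ≡ true) × (χ (src h) xor χ (tgt h) ≡ true)
      orthogonal (es , cyc) χ e e∈ χe
        with meetOn {λ h → h ∈ es} {λ h → χ (src h) ≢ χ (tgt h)} {e} (es , cyc , ⌊⌋-sound (e ∈? es) e∈ , λ _ i _ → i) (χ , xor-sound χe , λ _ _ q _ → q)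
      ... | h , h≢e , _ , h∈ , χh = h , h≢e , ⌊⌋-true (h ∈? es) h∈ , xor-true χh
      paint : (A : Fin m → Bool) (e : Fin m) →
        (∃ λ (C : ∃ λ es → Cycle (fullGraph ends) (λ _ → true) es) → (⌊ e ∈? proj₁ C ⌋ ≡ true) × (∀ h → ⌊ h ∈? proj₁ C ⌋ ≡ true → h ≢ e → A h ≡ true))
        ⊎ (Σ (Fin n → Bool) λ χ → (χ (src e) xor χ (tgt e) ≡ true) × (∀ h → χ (src h) xor χ (tgt h) ≡ true → h ≢ e → A h ≡ false))
      paint A e with paintOn {λ h → A h ≡ true} (λ h → A h Boolₚ.≟ true) {e} refl
      ... | inj₁ (es , cyc , e∈ , p) = inj₁ ((es , cyc) , ⌊⌋-true (e ∈? es) e∈ , λ h h∈ → p h (⌊⌋-sound (h ∈? es) h∈))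
      ... | inj₂ (χ , χe , p) = inj₂ (χ , xor-true χe , λ h χh h≢e → Boolₚ.¬-not (p h refl (xor-sound χh) h≢e))

    toCircuitOn : ∀ {P e} → HasCircuit graphMinty P e → CircuitOn P e
    toCircuitOn ((es , cyc) , e∈ , p) = es , cyc , ⌊⌋-sound (_ ∈? es) e∈ , λ h i → p h (⌊⌋-true (h ∈? es) i)

    toCutOn : ∀ {P e} → HasCocircuit graphMinty P e → CutOn P e
    toCutOn (χ , χe , p) = χ , xor-sound χe , λ h _ χh → p h (xor-true χh)

  module Reduction {n m} (ends : Fin m → Fin n × Fin n) where

    module At (s : RState n m) = Cuts (current ends s)

    -- Connectedness is phrased through colourings because these pull back along a contraction by
    -- composition, whereas walks would have to be lifted. Walks are recovered in `connected`.
    record Valid (s : RState n m) : Set where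
      field
        idempotent : ∀ v → cls s (cls s v) ≡ cls s v
        cut-connected : ∀ χ → At.Noncrossing s (alive s) χ → ∀ u v → χ (cls s u) ≡ χ (cls s v)

    module _ {s} (valid : Valid s) where
      open Valid valid

      ends-active : ∀ e → alive s e ≡ true →
        (active (current ends s) (At.src s e) ≡ true) × (active (current ends s) (At.tgt s e) ≡ true)
      ends-active e _ = ⌊⌋-true (_ ≟ _) (idempotent _) , ⌊⌋-true (_ ≟ _) (idempotent _)

      connected : Connected (current ends s)
      connected u v a b with At.conn-or-separated s (alive s) u v
      ... | inj₁ c = c
      ... | inj₂ (χ , p , q , nc) = ⊥-elim (true≢false
        (trans (sym (cut-connected χ nc u v)) (trans (cong χ (⌊⌋-sound (cls s u ≟ u) a)) p))
        (trans (cong χ (⌊⌋-sound (cls s v ≟ v) b)) q))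

    alive-∖ : ∀ {s : RState n m} {e h} → alive s h ≡ true → h ≢ e → alive (deleteEdge s e) h ≡ true
    alive-∖ {s} {e} {h} a h≢e = ∖-intro {S = alive s} {e} h≢e a

    alive-∖⁻ : ∀ {s : RState n m} {e h} → alive (deleteEdge s e) h ≡ true → (h ≢ e) × (alive s h ≡ true)
    alive-∖⁻ {s} {e} {h} = ∖-elim {S = alive s} {e} {h}

    φ : Fin n → Fin n → Fin n → Fin n
    φ u′ v′ x = if ⌊ x ≟ v′ ⌋ then u′ else x

    φ-target : ∀ u′ v′ → φ u′ v′ v′ ≡ u′
    φ-target u′ v′ with v′ ≟ v′
    ... | yes _ = refl
    ... | no q = ⊥-elim (q refl)

    φ-source : ∀ u′ v′ → φ u′ v′ u′ ≡ u′
    φ-source u′ v′ with u′ ≟ v′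
    ... | yes _ = refl
    ... | no _ = refl

    φ-color : ∀ {u′ v′} (χ : Fin n → Bool) → χ u′ ≡ χ v′ → ∀ x → χ (φ u′ v′ x) ≡ χ x
    φ-color {u′} {v′} χ p x with x ≟ v′
    ... | yes refl = p
    ... | no _ = refl

    module Contract (s : RState n m) (e : Fin m) where
      s′ : RState n m
      s′ = contractEdge ends s e

      contraction : Fin n → Fin n
      contraction = φ (At.src s e) (At.tgt s e)

      -- Cuts after the contraction are exactly the cuts that e did not cross.
      pull : (Fin n → Bool) → Fin n → Bool
      pull χ = χ ∘ contraction

      pull-e : ∀ χ → pull χ (At.src s e) ≡ pull χ (At.tgt s e)
      pull-e χ = cong χ (trans (φ-source a b) (sym (φ-target a b)))
        where
        a = At.src s e
        b = At.tgt s e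

      pullCut : ∀ {P g} → At.CutOn s′ P g → At.CutOn s P g
      pullCut (χ , χg , p) = pull χ , χg , λ h ah χh → p h (alive-∖ {s} {e} ah (λ { refl → χh (pull-e χ) })) χh

      pushCut : ∀ {P g} (c : At.CutOn s P g) → proj₁ c (At.src s e) ≡ proj₁ c (At.tgt s e) → At.CutOn s′ P g
      pushCut (χ , χg , p) nc = χ , (λ q → χg (trans (sym (φ-color χ nc _)) (trans q (φ-color χ nc _)))) ,
        λ h ah χh → p h (proj₂ (alive-∖⁻ {s} {e} ah)) (λ q → χh (trans (φ-color χ nc _) (trans q (sym (φ-color χ nc _)))))

      valid′ : Valid s → Valid s′
      valid′ v = record { idempotent = idem ; cut-connected = λ χ nc → cut-connected (pull χ) (pullNoncrossing χ nc) }
        where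
        open Valid v
        pullNoncrossing : ∀ χ → At.Noncrossing s′ (alive s′) χ → At.Noncrossing s (alive s) (pull χ)
        pullNoncrossing χ nc h ah _ with h ≟ e
        ... | yes refl = pull-e χ
        ... | no h≢e = nc h (alive-∖ {s} {e} ah h≢e) (alive-∖ {s} {e} ah h≢e)
        idem : ∀ v → cls s′ (cls s′ v) ≡ cls s′ v
        idem v with cls s v ≟ At.tgt s e
        ... | yes _ = trans (cong contraction (idempotent _)) (φ-source _ _)
        ... | no q = trans (cong contraction (idempotent v)) (same q)
          where
          same : cls s v ≢ At.tgt s e → contraction (cls s v) ≡ cls s v
          same q with cls s v ≟ At.tgt s e
          ... | yes p = ⊥-elim (q p)
          ... | no _ = refl

    -- A colouring crossed by `e` alone is excluded by orthogonality with the circuit through `e`.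
    delete-valid : ∀ {s e P} → At.CircuitOn s P e → Valid s → Valid (deleteEdge s e)
    delete-valid {s} {e} {P} c v = record { idempotent = idempotent ; cut-connected = λ χ nc → cut-connected χ (restore χ nc) }
      where
      open Valid v
      restore : ∀ χ → At.Noncrossing (deleteEdge s e) (alive (deleteEdge s e)) χ → At.Noncrossing s (alive s) χ
      restore χ nc h ah _ with h ≟ e
      ... | no h≢e = nc h (alive-∖ {s} {e} ah h≢e) (alive-∖ {s} {e} ah h≢e)
      ... | yes refl with χ (At.src s h) Boolₚ.≟ χ (At.tgt s h)
      ... | yes q = q
      ... | no q = stuck (At.meetOn s c (χ , q , λ k ak χk k≢e → χk (nc k (alive-∖ {s} {e} ak k≢e) (alive-∖ {s} {e} ak k≢e))))
        where
        stuck : ∃ (λ k → (k ≢ h) × (alive s k ≡ true) × P k × ⊥) → χ (At.src s h) ≡ χ (At.tgt s h)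
        stuck (_ , _ , _ , _ , ())

    module _ (J : Fin m → Interval) (ordered : ∀ h → lo (J h) ≤ hi (J h)) where

      -- With α = β = v this says that g is not mandatory under the values v, with α = hi and β = lo that g is known to be
      -- a minimum of a cut or a maximum of a cycle.
      Blocked : RState n m → (α β : Fin m → ℚ) → Fin m → Set
      Blocked s α β g = At.CircuitOn s (λ h → α h ≤ lo (J g)) g ⊎ At.CutOn s (λ h → hi (J g) ≤ β h) g

      Determined : RState n m → Fin m → Set
      Determined s = Blocked s (hi ∘ J) (lo ∘ J)

      reduceEdge : ∀ {s e} → Determined s e → RState n m
      reduceEdge {s} {e} (inj₁ _) = deleteEdge s e
      reduceEdge {s} {e} (inj₂ _) = contractEdge ends s e

      reduce-valid : ∀ {s e} (d : Determined s e) → Valid s → Valid (reduceEdge d)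
      reduce-valid (inj₁ c) = delete-valid c
      reduce-valid {s} {e} (inj₂ _) = Contract.valid′ s e

      reduce-alive : ∀ {s e} (d : Determined s e) {h} → alive (reduceEdge d) h ≡ true → (h ≢ e) × (alive s h ≡ true)
      reduce-alive {s} {e} (inj₁ _) = alive-∖⁻ {s} {e}
      reduce-alive {s} {e} (inj₂ _) = alive-∖⁻ {s} {e}

      module _ (α β : Fin m → ℚ) (α≤ : ∀ h → α h ≤ hi (J h)) (≤β : ∀ h → lo (J h) ≤ β h) where

        -- Circuit elimination in the language of painting. A cut that prevents a new circuit meets
        -- the old circuit of `g`, apart from `g`, only in `e`. It then also meets the circuit that
        -- determines `e`, in an edge whose upper limit is at most `lo (J e) < α e ≤ lo (J g)`,
        -- which the cut should have avoided.
        delete-blocked : ∀ {s e g} → lo (J e) < α e → At.CircuitOn s (λ h → hi (J h) ≤ lo (J e)) e →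
          alive s g ≡ true → g ≢ e → Blocked s α β g → Blocked (deleteEdge s e) α β g
        delete-blocked {s} {e} {g} l<α c₀ ag g≢e (inj₂ (χ , χg , p)) =
          inj₂ (χ , χg , λ h ah → p h (proj₂ (alive-∖⁻ {s} {e} ah)))
        delete-blocked {s} {e} {g} l<α c₀ ag g≢e (inj₁ c)
          with At.paintOn (deleteEdge s e) (λ h → α h ≤? lo (J g)) {g} (alive-∖ {s} {e} ag g≢e)
        ... | inj₁ c′ = inj₁ c′
        ... | inj₂ (χ , χg , p) = ⊥-elim contradiction
          where
          p′ : ∀ h → alive s h ≡ true → χ (At.src s h) ≢ χ (At.tgt s h) → h ≢ g → (h ≡ e) ⊎ ¬ (α h ≤ lo (J g))
          p′ h ah χh h≢g with h ≟ e
          ... | yes q = inj₁ q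
          ... | no q = inj₂ (p h (alive-∖ {s} {e} ah q) χh h≢g)
          contradiction : ⊥
          contradiction with At.meetOn s c (χ , χg , λ h ah χh h≢g → p′ h ah χh h≢g , χh)
          ... | h , _ , _ , αh , inj₂ q , _ = q αh
          ... | .e , _ , _ , αe , inj₁ refl , χe
            with At.meetOn s c₀ (χ , χe , λ h ah χh h≢e → (λ h≢g → p h (alive-∖ {s} {e} ah h≢e) χh h≢g))
          ... | h , h≢e , _ , hi≤ , q with h ≟ g
          ... | yes refl = <⇒≱ (<-≤-trans (≤-<-trans hi≤ l<α) αe) (ordered h)
          ... | no h≢g = q h≢g (≤-trans (α≤ h) (<⇒≤ (<-≤-trans (≤-<-trans hi≤ l<α) αe)))

        -- Circuits are preserved because cuts pull back along the contraction. For cuts the idea is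
        -- dual to `delete-blocked`, with the difference that the obstructing circuit lives in the
        -- contracted graph.
        contract-blocked : ∀ {s e g} → β e < hi (J e) → At.CutOn s (λ h → hi (J e) ≤ lo (J h)) e → alive s e ≡ true →
          alive s g ≡ true → g ≢ e → Blocked s α β g → Blocked (contractEdge ends s e) α β g
        contract-blocked {s} {e} {g} β<u x₀ ae ag g≢e (inj₁ c)
          with At.paintOn (contractEdge ends s e) (λ h → α h ≤? lo (J g)) {g} (alive-∖ {s} {e} ag g≢e)
        ... | inj₁ c′ = inj₁ c′
        ... | inj₂ x with At.meetOn s c (Contract.pullCut s e x)
        ... | h , _ , _ , p , q = ⊥-elim (q p)
        contract-blocked {s} {e} {g} β<u x₀ ae ag g≢e (inj₂ x)
          with At.paintOn (contractEdge ends s e) (λ h → ¬? (hi (J g) ≤? β h)) {g} (alive-∖ {s} {e} ag g≢e)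
        ... | inj₂ (χ , χg , p) = inj₂ (χ , χg , λ h ah χh h≢g → decidable-stable (hi (J g) ≤? β h) (p h ah χh h≢g))
        ... | inj₁ c′ with At.paintOn s (λ h → ¬? (hi (J g) ≤? β h) ⊎-dec (h ≟ e)) {g} ag
        ... | inj₂ y@(χ , χg , p) with χ (At.src s e) Boolₚ.≟ χ (At.tgt s e)
        ... | no χe = ⊥-elim (p e ae χe (g≢e ∘ sym) (inj₂ refl))
        ... | yes nc with At.meetOn (contractEdge ends s e) c′ (Contract.pushCut s e y nc)
        ... | h , _ , _ , a , b = ⊥-elim (b (inj₁ a))
        contract-blocked {s} {e} {g} β<u x₀ ae ag g≢e (inj₂ x) | inj₁ c′ | inj₁ (es , cyc , g∈ , p)
          with At.meetOn s {λ h → (h ∈ es) × (¬ (hi (J g) ≤ β h) ⊎ h ≡ e)} (es , cyc , g∈ , λ h i h≢g → i , p h i h≢g) x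
        ... | h , _ , _ , (_ , inj₁ a) , b = ⊥-elim (a b)
        ... | .e , _ , _ , (e∈ , inj₂ refl) , u≤βe with At.meetOn s {λ h → h ∈ es} (es , cyc , e∈ , λ _ i _ → i) x₀
        ... | h , h≢e , _ , h∈ , u≤lo with h ≟ g
        ... | yes refl = ⊥-elim (<⇒≱ (≤-<-trans u≤βe β<u) (≤-trans u≤lo (ordered h)))
        ... | no h≢g with p h h∈ h≢g
        ... | inj₂ q = ⊥-elim (h≢e q)
        ... | inj₁ q = ⊥-elim (q (≤-trans (<⇒≤ (≤-<-trans u≤βe β<u)) (≤-trans u≤lo (≤β h))))

        reduce-blocked : ∀ {s e g} (d : Determined s e) → lo (J e) < α e → β e < hi (J e) → alive s e ≡ true →
          alive s g ≡ true → g ≢ e → Blocked s α β g → Blocked (reduceEdge d) α β g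
        reduce-blocked (inj₁ c) l<α _ _ = delete-blocked l<α c
        reduce-blocked (inj₂ x) _ β<u ae = contract-blocked β<u x ae

    module _ (I : Fin m → Interval) (w : Fin m → ℚ) (ALG : EdgeSet m) (v : Fin m → ℚ)
             (v∈J : ∀ h → v h ∈I remI I w ALG h) where
      open Embedding {m} using (lo≤; ≤hi)

      private
        J : Fin m → Interval
        J = remI I w ALG

      Open : Fin m → Set
      Open e = ∃₂ λ l u → J e ≡ op l u

      ordered : ∀ h → lo (J h) ≤ hi (J h)
      ordered h = ≤-trans (lo≤ (J h) (v∈J h)) (≤hi (J h) (v∈J h))

      consistent : ∀ {x} → Consistent I w ALG x → ∀ h → x h ∈I J h
      consistent c h with ALG h | proj₁ (c h)
      ... | true | p = p refl
      ... | false | _ = proj₂ (c h)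

      reduce-step : ∀ {s s′ e} → alive s e ≡ true → (d : Determined J ordered s e) →
        Reduces ends I w ALG (reduceEdge J ordered d) s′ → Reduces ends I w ALG s s′
      reduce-step {s} {_} {e} ae (inj₁ (es , cyc , e∈ , p)) = del e (ae , es , cyc , e∈ , known)
        where
        known : ∀ x → Consistent I w ALG x → ∀ f → f ∈ es → x f ≤ x e
        known x c f f∈ with f ≟ e
        ... | yes refl = ≤-refl
        ... | no f≢e = ≤-trans (≤hi (J f) (consistent c f)) (≤-trans (p f f∈ f≢e) (lo≤ (J e) (consistent c e)))
      reduce-step {s} {_} {e} ae (inj₂ (χ , χe , p)) = con e (χ , (ae , χe) , known)
        where
        known : ∀ x → Consistent I w ALG x → ∀ f → Crosses ends s χ f → x e ≤ x f
        known x c f (af , χf) with f ≟ e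
        ... | yes refl = ≤-refl
        ... | no f≢e = ≤-trans (≤hi (J e) (consistent c e)) (≤-trans (p f af χf f≢e) (lo≤ (J f) (consistent c f)))

      open-limits : ∀ {e} → Open e → (lo (J e) < v e) × (v e < hi (J e)) × (lo (J e) < hi (J e))
      open-limits {e} (l , u , eq) with J e | v∈J e
      open-limits {e} (l , u , refl) | .(op l u) | p = proj₁ p , proj₂ p , lo<hi p

      Free : RState n m → Set
      Free s = ∀ g → alive s g ≡ true → Open g → Blocked J ordered s v v g

      -- Each reduction has to preserve two things: the edges still listed stay determined, so that
      -- they can be removed in turn, and open edges stay blocked under the predictions. Both are
      -- instances of `reduce-blocked`, with different `α` and `β`.
      reduceAll : ∀ ds s → Valid s → (∀ d → d ∈ ds → Open d) →
        (∀ d → d ∈ ds → alive s d ≡ true → Determined J ordered s d) → Free s →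
        ∃ λ s′ → Reduces ends I w ALG s s′ × Valid s′ × Free s′ × (∀ h → alive s′ h ≡ true → alive s h ≡ true) ×
          (∀ d → d ∈ ds → alive s′ d ≡ false)
      reduceAll [] s va _ _ free = s , done , va , free , (λ _ p → p) , λ _ ()
      reduceAll (d ∷ ds) s va opens det free with bool-dec (alive s d)
      ... | inj₂ dead with reduceAll ds s va (λ e i → opens e (there i)) (λ e i → det e (there i)) free
      ... | s′ , r , va′ , free′ , mono , gone = s′ , r , va′ , free′ , mono , λ
        { _ (here refl) → dead-stays ; e (there i) → gone e i }
        where
        dead-stays : alive s′ d ≡ false
        dead-stays with bool-dec (alive s′ d)
        ... | inj₂ q = q
        ... | inj₁ q = ⊥-elim (true≢false (mono d q) dead)
      reduceAll (d ∷ ds) s va opens det free | inj₁ ad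
        with reduceAll ds (reduceEdge J ordered D) (reduce-valid J ordered D va) (λ e i → opens e (there i)) det₁ free₁
        where
        D : Determined J ordered s d
        D = det d (here refl) ad
        lims = open-limits (opens d (here refl))
        det₁ : ∀ e → e ∈ ds → alive (reduceEdge J ordered D) e ≡ true → Determined J ordered (reduceEdge J ordered D) e
        det₁ e i ae = let (e≢d , ae′) = reduce-alive J ordered D ae in
          reduce-blocked J ordered (hi ∘ J) (lo ∘ J) (λ _ → ≤-refl) (λ _ → ≤-refl) D (proj₂ (proj₂ lims)) (proj₂ (proj₂ lims)) ad ae′ e≢d (det e (there i) ae′)
        free₁ : Free (reduceEdge J ordered D)
        free₁ g ag og = let (g≢d , ag′) = reduce-alive J ordered D ag in
          reduce-blocked J ordered v v (λ h → ≤hi (J h) (v∈J h)) (λ h → lo≤ (J h) (v∈J h)) D (proj₁ lims) (proj₁ (proj₂ lims)) ad ag′ g≢d (free g ag′ og)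
      ... | s′ , r , va′ , free′ , mono , gone = s′ , reduce-step ad (det d (here refl) ad) r , va′ , free′ ,
        (λ h p → proj₂ (reduce-alive J ordered (det d (here refl) ad) (mono h p))) , λ
        { _ (here refl) → dead ; e (there i) → gone e i }
        where
        dead : alive s′ d ≡ false
        dead with bool-dec (alive s′ d)
        ... | inj₂ q = q
        ... | inj₁ q = ⊥-elim (proj₁ (reduce-alive J ordered (det d (here refl) ad) (mono d q)) refl)

      free⇒mandatory-free : ∀ {s} → Valid s → Free s → PredictionMandatoryFree (current ends s) J v
      free⇒mandatory-free {s} va free e pm = by-interval (J e) refl
        where
        module T = Trees (current ends s) (ends-active va)
        by-interval : ∀ i → J e ≡ i → ⊥
        by-interval (pt a) eq = T.trivial-avoidable (connected va) J v (proj₁ pm) eq pm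
        by-interval (op l u) eq = T.open-avoidable (connected va) J v (proj₁ pm) eq (blocked (free e (proj₁ pm) (l , u , eq))) pm
          where
          blocked : Blocked J ordered s v v e → At.CircuitOn s (λ h → v h ≤ l) e ⊎ At.CutOn s (λ h → u ≤ v h) e
          blocked b = subst (λ i → At.CircuitOn s (λ h → v h ≤ lo i) e ⊎ At.CutOn s (λ h → hi i ≤ v h) e) eq b

    module _ where
      private
        module G = Cuts (fullGraph ends)

      initialWalk : ∀ {S u v es} → Walk (fullGraph ends) S u v es → Walk (current ends initState) S u v es
      initialWalk [] = []
      initialWalk (_∷_ e (a , _ , j) p) = _∷_ e (a , refl , j) (initialWalk p)

      initialCircuit : ∀ {P e} → G.CircuitOn P e → At.CircuitOn initState P e
      initialCircuit (es , (ne , un , v , p) , rest) = es , (ne , un , v , initialWalk p) , rest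

      initialCut : ∀ {P e} → G.CutOn P e → At.CutOn initState P e
      initialCut c = c

      initial-valid : Connected (fullGraph ends) → Valid initState
      initial-valid conn = record
        { idempotent = λ _ → refl
        ; cut-connected = λ χ nc u v → G.noncrossing-conn {χ = χ} nc (conn u v refl refl) }

-- Decision trees and their replay as memoryless algorithms

module Strategies where

  open Preliminaries
  open import Data.Nat using (_+_; _≤_; z≤n; s≤s)
  open import Data.Nat.Properties using (≤-trans; ≤-reflexive)
  open import Data.Rational using (ℚ)

  Σℕ-cong : ∀ {m} {f g : Fin m → ℕ} → (∀ h → f h ≡ g h) → Σℕ f ≡ Σℕ g
  Σℕ-cong {zero} p = refl
  Σℕ-cong {suc m} p = cong₂ _+_ (p zero) (Σℕ-cong (p ∘ suc))

  Σℕ-insert : ∀ {m} {f g : Fin m → ℕ} e → (∀ h → h ≢ e → g h ≡ f h) → f e ≡ 0 → Σℕ g ≡ g e + Σℕ f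
  Σℕ-insert {suc m} {f} {g} zero p q rewrite q = cong (g zero +_) (Σℕ-cong (λ h → p (suc h) (λ ())))
  Σℕ-insert {suc m} {f} {g} (suc e) p q
    rewrite p zero (λ ()) | Σℕ-insert {f = f ∘ suc} {g ∘ suc} e (λ h h≢e → p (suc h) (λ { refl → h≢e refl })) q =
    left-comm (f zero) (g (suc e)) (Σℕ (f ∘ suc))
    where
    left-comm : ∀ a b c → a + (b + c) ≡ b + (a + c)
    left-comm = solve-∀

  term≤Σℕ : ∀ {m} (f : Fin m → ℕ) e → f e ≤ Σℕ f
  term≤Σℕ {suc m} f zero = ℕₚ.m≤m+n _ _
  term≤Σℕ {suc m} f (suc e) = ≤-trans (term≤Σℕ (f ∘ suc) e) (ℕₚ.m≤n+m _ _)

  ∣∣≤m : ∀ {m} (S : EdgeSet m) → ∣ S ∣ ≤ m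
  ∣∣≤m {zero} S = z≤n
  ∣∣≤m {suc m} S with S zero
  ... | true = s≤s (∣∣≤m (S ∘ suc))
  ... | false = ℕₚ.m≤n⇒m≤1+n (∣∣≤m (S ∘ suc))

  data Strategy (m : ℕ) : Set where
    stop : Strategy m
    ask  : Fin m → (ℚ → Strategy m) → Strategy m

  Revealed : ℕ → Set
  Revealed m = Fin m → Maybe ℚ

  set : ∀ {m} → Revealed m → Fin m → ℚ → Revealed m
  set r e q = r [ e ≔ just q ]

  module _ {m} {r : Revealed m} {e : Fin m} {q : ℚ} where
    set-at : set r e q e ≡ just q
    set-at = update-at r e (just q)

    set-off : ∀ {f} → f ≢ e → set r e q f ≡ r f
    set-off = update-off r e (just q)

  follow : ∀ {m} → Strategy m → Revealed m → Maybe (Fin m)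
  follow stop r = nothing
  follow (ask e c) r with r e
  ... | nothing = just e
  ... | just q = follow (c q) r

  module _ {m} (w : Fin m → ℚ) where
    final : Strategy m → Revealed m → Revealed m
    final stop r = r
    final (ask e c) r = final (c (w e)) (set r e (w e))

    Fresh : Strategy m → Revealed m → Set
    Fresh stop r = ⊤
    Fresh (ask e c) r = (r e ≡ nothing) × Fresh (c (w e)) (set r e (w e))

  hidden : ∀ {m} → Revealed m → EdgeSet m
  hidden r e = not (is-just (r e))

  hidden-set : ∀ {m} {r : Revealed m} {e} q → r e ≡ nothing → ∣ hidden r ∣ ≡ suc ∣ hidden (set r e q) ∣
  hidden-set {m} {r} {e} q eq = trans (Σℕ-insert e same at-e) (cong (_+ ∣ hidden (set r e q) ∣) one)
    where
    same : ∀ h → h ≢ e → (if hidden r h then 1 else 0) ≡ (if hidden (set r e q) h then 1 else 0)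
    same h h≢e rewrite set-off {r = r} {e} {q} h≢e = refl
    at-e : (if hidden (set r e q) e then 1 else 0) ≡ 0
    at-e rewrite set-at {r = r} {e} {q} = refl
    one : (if hidden r e then 1 else 0) ≡ 1
    one rewrite eq = refl

  -- The strategy is replayed from the revealed values, since an Algorithm has no memory.
  module Replay (A : Algorithm) {n m} (ends : Fin m → Fin n × Fin n) (I : Fin m → Interval) (ŵ w : Fin m → ℚ) where

    -- Quantifying over all extensions of `r` lets the property survive later answers: the algorithm
    -- restarts from the root each time, and the answers in `r` lead it back to the subtree `t`.
    Synced : Strategy m → Revealed m → Set
    Synced t r = ∀ r′ → (∀ e q → r e ≡ just q → r′ e ≡ just q) → A ends I ŵ r′ ≡ follow t r′

    -- `r̃` is the state built by `reveal`, which is only pointwise equal to `r`. Every query is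
    -- fresh, so the number of hidden edges decreases and `k` steps suffice.
    run-final : ∀ k t r r̃ → (∀ e → r̃ e ≡ r e) → Synced t r → Fresh w t r → ∣ hidden r ∣ ≤ k →
      (∀ e → run A ends I ŵ w k r̃ e ≡ final w t r e) × (A ends I ŵ (run A ends I ŵ w k r̃) ≡ nothing)
    run-final zero stop r r̃ r̃≗r sync _ _ = r̃≗r , sync r̃ (λ e q → trans (r̃≗r e))
    run-final zero (ask e c) r r̃ r̃≗r sync (fresh , _) le = case ≤-trans (≤-reflexive (sym (hidden-set {r = r} {e} (w e) fresh))) le of λ ()
    run-final (suc k) stop r r̃ r̃≗r sync _ _ with A ends I ŵ r̃ in eq | sync r̃ (λ e q → trans (r̃≗r e))
    ... | nothing | refl = r̃≗r , eq
    run-final (suc k) (ask e c) r r̃ r̃≗r sync (fresh , fresh′) le with A ends I ŵ r̃ in eq | asks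
      where
      asks : A ends I ŵ r̃ ≡ just e
      asks rewrite sync r̃ (λ e q → trans (r̃≗r e)) | r̃≗r e | fresh = refl
    ... | .(just e) | refl = run-final k (c (w e)) (set r e (w e)) (reveal w r̃ e) same sync′ fresh′
            (ℕₚ.≤-pred (≤-trans (≤-reflexive (sym (hidden-set {r = r} {e} (w e) fresh))) le))
      where
      same : ∀ f → reveal w r̃ e f ≡ set r e (w e) f
      same f with f ≟ e
      ... | yes refl = refl
      ... | no _ = r̃≗r f
      sync′ : Synced (c (w e)) (set r e (w e))
      sync′ r′ ext = trans (sync r′ (λ f q p → ext f q (trans (set-off {r = r} {e} {w e} (λ { refl → absurd (trans (sym fresh) p) })) p))) step
        where
        absurd : ∀ {q : ℚ} → nothing ≡ just q → ⊥
        absurd ()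
        step : follow (ask e c) r′ ≡ follow (c (w e)) r′
        step rewrite ext e (w e) (set-at {r = r} {e} {w e}) = refl

-- Bookkeeping of queries, hits and prediction errors

module Accounting where

  open Preliminaries
  open MintySystems
  open LimitKeys using (module Embedding)
  open QueryStates
  open GraphWalks using (_⊕_; ⊕-added)
  open Reductions using (graphMinty)
  open Strategies
  open import Data.Nat using (_+_; _*_; _≤_; z≤n; s≤s)
  open import Data.Nat.Properties using (≤-trans; ≤-refl; ≤-reflexive; +-monoʳ-≤; +-monoˡ-≤; *-monoʳ-≤; module ≤-Reasoning)
  open import Data.Rational using (ℚ)

  -- a queries so far, o of the touched edges in OPT, c the same plus prediction errors, and p the number of
  -- prediction mandatory edges queried since the last batch.
  Balanced : (γ a o c p : ℕ) → Set
  Balanced γ a o c p = (γ * a + p ≤ (γ + 1) * c) × (a ≤ γ * o + p)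

  module _ {γ : ℕ} where

    -- `p` is a saving in the first inequality and a debt in the second, so ending a batch with
    -- `p′ = 0` frees the savings and requires the debts to be repaid.
    balanced-step : ∀ {a o c p a′ o′ c′} Δa Δo Δc p′ → a′ ≡ Δa + a → Δo + o ≤ o′ → Δc + c ≤ c′ →
      γ * Δa + p′ ≤ (γ + 1) * Δc + p → Δa + p ≤ γ * Δo + p′ → Balanced γ a o c p → Balanced γ a′ o′ c′ p′
    balanced-step {a} {o} {c} {p} {a′} {o′} {c′} Δa Δo Δc p′ refl o≤ c≤ q₁ q₂ (b₁ , b₂) = bound₁ , bound₂
      where
      open ≤-Reasoning
      expand₁ : ∀ γ Δa a p′ → γ * (Δa + a) + p′ ≡ γ * a + (γ * Δa + p′)
      expand₁ = solve-∀
      expand₂ : ∀ γ Δc c p → γ * c + ((γ + 1) * Δc + p) ≡ (γ * c + p) + (γ + 1) * Δc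
      expand₂ = solve-∀
      expand₃ : ∀ γ Δc c → (γ + 1) * c + (γ + 1) * Δc ≡ (γ + 1) * (Δc + c)
      expand₃ = solve-∀
      expand₄ : ∀ γ o p Δa → Δa + (γ * o + p) ≡ γ * o + (Δa + p)
      expand₄ = solve-∀
      expand₅ : ∀ γ o Δo p′ → γ * o + (γ * Δo + p′) ≡ γ * (Δo + o) + p′
      expand₅ = solve-∀
      bound₁ : γ * (Δa + a) + p′ ≤ (γ + 1) * c′
      bound₁ = begin
        γ * (Δa + a) + p′ ≡⟨ expand₁ γ Δa a p′ ⟩
        γ * a + (γ * Δa + p′) ≤⟨ +-monoʳ-≤ (γ * a) q₁ ⟩
        γ * a + ((γ + 1) * Δc + p) ≡⟨ expand₂ γ Δc a p ⟩
        (γ * a + p) + (γ + 1) * Δc ≤⟨ +-monoˡ-≤ _ b₁ ⟩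
        (γ + 1) * c + (γ + 1) * Δc ≡⟨ expand₃ γ Δc c ⟩
        (γ + 1) * (Δc + c) ≤⟨ *-monoʳ-≤ (γ + 1) c≤ ⟩
        (γ + 1) * c′ ∎
      bound₂ : Δa + a ≤ γ * o′ + p′
      bound₂ = begin
        Δa + a ≤⟨ +-monoʳ-≤ Δa b₂ ⟩
        Δa + (γ * o + p) ≡⟨ expand₄ γ o p Δa ⟩
        γ * o + (Δa + p) ≤⟨ +-monoʳ-≤ (γ * o) q₂ ⟩
        γ * o + (γ * Δo + p′) ≡⟨ expand₅ γ o Δo p′ ⟩
        γ * (Δo + o) + p′ ≤⟨ +-monoˡ-≤ p′ (*-monoʳ-≤ γ o≤) ⟩
        γ * o′ + p′ ∎

    module Steps (2≤γ : 2 ≤ γ) where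

      known-step : ∀ {a o c p a′ o′ c′} → a′ ≡ 1 + a → 1 + o ≤ o′ → 1 + c ≤ c′ → Balanced γ a o c p → Balanced γ a′ o′ c′ p
      known-step {p = p} x y z = balanced-step 1 1 1 p x y z (+-monoˡ-≤ p (*-mono 1 (ℕₚ.m≤m+n γ 1))) (+-monoˡ-≤ p (≤-trans (≤-trans (s≤s z≤n) 2≤γ) (≤-reflexive (sym (ℕₚ.*-identityʳ γ)))))
        where
        *-mono : ∀ k {x y} → x ≤ y → x * k ≤ y * k
        *-mono k = ℕₚ.*-monoˡ-≤ k

      -- Tight in both inequalities: the charge exceeds the cost by the one unit that is saved, and
      -- the query unmatched in OPT is one unit of new debt.
      predicted-step : ∀ {a o c p a′ o′ c′} → a′ ≡ 1 + a → o ≤ o′ → 1 + c ≤ c′ → Balanced γ a o c p → Balanced γ a′ o′ c′ (suc p)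
      predicted-step {p = p} x y z = balanced-step 1 0 1 (suc p) x y z (≤-reflexive (lem γ p)) (≤-trans (≤-refl {suc p}) (ℕₚ.m≤n+m (suc p) (γ * 0)))
        where
        lem : ∀ γ p → γ * 1 + (1 + p) ≡ (γ + 1) * 1 + p
        lem = solve-∀

      pair-step : ∀ {a o c p a′ o′ c′} → p + 2 ≤ γ → a′ ≡ 2 + a → 1 + o ≤ o′ → 2 + c ≤ c′ → Balanced γ a o c p → Balanced γ a′ o′ c′ 0
      pair-step {p = p} p≤ x y z = balanced-step 2 1 2 0 x y z
        (≤-trans (≤-reflexive (ℕₚ.+-identityʳ (γ * 2))) (≤-trans (ℕₚ.*-monoˡ-≤ 2 (ℕₚ.m≤m+n γ 1)) (ℕₚ.m≤m+n _ p)))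
        (≤-trans (≤-reflexive (ℕₚ.+-comm 2 p)) (≤-trans p≤ (≤-reflexive (lem γ))))
        where
        lem : ∀ γ → γ ≡ γ * 1 + 0
        lem = solve-∀

      single-step : ∀ {a o c p a′ o′ c′} → p + 2 ≤ γ → a′ ≡ 1 + a → 1 + o ≤ o′ → 1 + c ≤ c′ → Balanced γ a o c p → Balanced γ a′ o′ c′ 0
      single-step {p = p} p≤ x y z = balanced-step 1 1 1 0 x y z
        (≤-trans (≤-reflexive (ℕₚ.+-identityʳ (γ * 1))) (≤-trans (ℕₚ.*-monoˡ-≤ 1 (ℕₚ.m≤m+n γ 1)) (ℕₚ.m≤m+n _ p)))
        (≤-trans (≤-trans (≤-reflexive (ℕₚ.+-comm 1 p)) (+-monoʳ-≤ p (s≤s z≤n))) (≤-trans p≤ (≤-reflexive (lem γ))))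
        where
        lem : ∀ γ → γ ≡ γ * 1 + 0
        lem = solve-∀

      -- The first inequality holds with equality and would fail with smaller savings, hence
      -- `p + 2 ≡ γ` instead of `p + 2 ≤ γ`.
      triple-step : ∀ {a o c p a′ o′ c′} → p + 2 ≡ γ → a′ ≡ 3 + a → 2 + o ≤ o′ → 2 + c ≤ c′ → Balanced γ a o c p → Balanced γ a′ o′ c′ 0
      triple-step {p = p} refl x y z = balanced-step 3 2 2 0 x y z (≤-reflexive (lem p)) (≤-trans (ℕₚ.m≤m+n (3 + p) (p + 1)) (≤-reflexive (lem′ p)))
        where
        lem : ∀ p → (p + 2) * 3 + 0 ≡ ((p + 2) + 1) * 2 + p
        lem = solve-∀
        lem′ : ∀ p → (3 + p) + (p + 1) ≡ (p + 2) * 2 + 0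
        lem′ = solve-∀

  indicator : Bool → ℕ
  indicator b = if b then 1 else 0

  just≢nothing : ∀ {A : Set} {a : A} {x} → x ≡ just a → x ≡ nothing → ⊥
  just≢nothing refl ()

  module Game {n m} (ends : Fin m → Fin n × Fin n) (I : Fin m → Interval) (ŵ : Fin m → ℚ) where
    open Analysis (graphMinty ends) public

    J : Revealed m → Intervals
    J r h = maybe pt (I h) (r h)

    val : Revealed m → Values
    val r h = fromMaybe (ŵ h) (r h)

    Legal : Revealed m → Set
    Legal r = ∀ h q → r h ≡ just q → q ∈I I h

    Compat : Values → Revealed m → Set
    Compat w r = (w ∈J I) × (∀ h q → r h ≡ just q → q ≡ w h)

    queried : Revealed m → EdgeSet m
    queried r h = is-just (r h)

    compat⇒∈J : ∀ {w r} → Compat w r → w ∈J J r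
    compat⇒∈J {w} {r} (w∈I , agree) h with r h in eq
    ... | nothing = w∈I h
    ... | just q = sym (agree h q eq)

    ∈J⇒∈I : ∀ {x r} → Legal r → x ∈J J r → x ∈J I
    ∈J⇒∈I {x} {r} legal x∈ h with r h in eq | x∈ h
    ... | nothing | p = p
    ... | just q | refl = legal h q eq

    val∈J : ŵ ∈J I → ∀ r → val r ∈J J r
    val∈J ŵ∈I r h with r h
    ... | nothing = ŵ∈I h
    ... | just q = refl

    open⇒hidden : ∀ {r h l u} → J r h ≡ op l u → (r h ≡ nothing) × (I h ≡ op l u)
    open⇒hidden {r} {h} eq with r h
    ... | nothing = refl , eq

    mandatory-initial : ∀ {r x e} → Mandatory (J r) x e → Mandatory I x e
    mandatory-initial {r} (l , u , eq , rest) = l , u , proj₂ (open⇒hidden {r} eq) , rest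

    mandatory-hidden : ∀ {r x e} → Mandatory (J r) x e → r e ≡ nothing
    mandatory-hidden {r} (l , u , eq , _) = proj₁ (open⇒hidden {r} eq)

    undet-hidden : ∀ {r e} → Undet (J r) e → r e ≡ nothing
    undet-hidden {r} (l , u , eq , _) = proj₁ (open⇒hidden {r} eq)

    J-set-off : ∀ {r e q h} → h ≢ e → J (set r e q) h ≡ J r h
    J-set-off {r} {e} {q} {h} h≢e rewrite set-off {r = r} {e} {q} h≢e = refl

    set-legal : ∀ {r e q} → Legal r → q ∈I I e → Legal (set r e q)
    set-legal {r} {e} {q} legal q∈ h t eq with h ≟ e
    ... | no _ = legal h t eq
    set-legal {r} {e} {q} legal q∈ h .q refl | yes refl = q∈

    compat-unset : ∀ {w r e q} → r e ≡ nothing → Compat w (set r e q) → Compat w r × (q ≡ w e)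
    compat-unset {w} {r} {e} {q} re (w∈I , agree) = (w∈I , λ h t eq → agree h t (trans (set-off {r = r} {e} {q} (λ { refl → just≢nothing eq re })) eq)) , agree e q (set-at {r = r} {e} {q})

    compat-set : ∀ {w r e} → Compat w r → Compat w (set r e (w e))
    compat-set {w} {r} {e} (w∈I , agree) = w∈I , same
      where
      same : ∀ h t → set r e (w e) h ≡ just t → t ≡ w h
      same h t eq with h ≟ e
      ... | no _ = agree h t eq
      same h t refl | yes refl = refl

    det-set : ∀ {r e q d} → r e ≡ nothing → q ∈I I e → d ≢ e → Det (J r) d → Det (J (set r e q)) d
    det-set {r} {e} {q} {d} re q∈ d≢e = go
      where
      open Embedding {m} using (lo≤; ≤hi)
      J′ = J (set r e q)
      shrink : ∀ h → (lo (J r h) ℚ.≤ lo (J′ h)) × (hi (J′ h) ℚ.≤ hi (J r h))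
      shrink h with h ≟ e
      ... | no _ = ℚₚ.≤-refl , ℚₚ.≤-refl
      ... | yes refl rewrite re = lo≤ (I h) q∈ , ≤hi (I h) q∈
      at-d : J′ d ≡ J r d
      at-d = J-set-off {r} d≢e
      go : Det (J r) d → Det J′ d
      go (inj₁ c) = inj₁ (mapCircuit (graphMinty ends) (λ h _ p → subst (λ i → hi (J′ h) ℚ.≤ lo i) (sym at-d) (ℚₚ.≤-trans (proj₂ (shrink h)) p)) c)
      go (inj₂ x) = inj₂ (mapCocircuit (graphMinty ends) (λ h _ p → subst (λ i → hi i ℚ.≤ lo (J′ h)) (sym at-d) (ℚₚ.≤-trans p (proj₁ (shrink h)))) x)

    -- The only property of an optimal query set that the analysis uses.
    Hits : Values → EdgeSet m → Set
    Hits w OPT = ∀ x → (∀ h → OPT h ≡ true → x h ≡ w h) → x ∈J I → ∀ e → Mandatory I x e → OPT e ≡ true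

    -- If `f` is not in `OPT`, then `x` agrees with `w` on `OPT` and is a possible outcome in which
    -- `e` is mandatory.
    pair-hit : ∀ {w OPT x e f} → Hits w OPT → x ∈J I → (∀ h → h ≢ f → x h ≡ w h) → Mandatory I x e → 1 ≤ indicator (OPT e) + indicator (OPT f)
    pair-hit {w} {OPT} {x} {e} {f} hits x∈I same mand with bool-dec (OPT f)
    ... | inj₁ q rewrite q = ℕₚ.m≤n+m 1 _
    ... | inj₂ q rewrite hits x (λ h p → same h (λ { refl → true≢false p q })) x∈I e mand = s≤s z≤n

    module _ (w : Values) where

      k⁻-zero : ∀ e → k⁻ I w ŵ e ≡ 0 → ∀ h → h ≢ e → sameRegion (w h) (ŵ h) (lo (I e)) (hi (I e)) ≡ true
      k⁻-zero e k≡0 h h≢e with ≤-trans (term≤Σℕ (λ h → if ⌊ h ≟ e ⌋ then 0 else kOf I w ŵ e h) h) (≤-reflexive k≡0)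
      ... | le with h ≟ e
      ... | yes p = ⊥-elim (h≢e p)
      ... | no _ with sameRegion (w h) (ŵ h) (lo (I e)) (hi (I e))
      ... | true = refl
      ... | false = case le of λ ()

      k⁺-positive : ∀ e f → f ≢ e → sameRegion (w e) (ŵ e) (lo (I f)) (hi (I f)) ≡ false → 1 ≤ k⁺ I w ŵ e
      k⁺-positive e f f≢e wrong = ≤-trans one (term≤Σℕ (λ h → if ⌊ h ≟ e ⌋ then 0 else kOf I w ŵ h e) f)
        where
        one : 1 ≤ (if ⌊ f ≟ e ⌋ then 0 else kOf I w ŵ f e)
        one with f ≟ e
        ... | yes p = ⊥-elim (f≢e p)
        ... | no _ rewrite wrong = ≤-refl

      -- Whether e is mandatory depends only on the regions of the other values relative to the interval of e.
      predicted-charge : ∀ {r e OPT} → Compat w r → Hits w OPT → Mandatory (J r) (val r) e → 1 ≤ indicator (OPT e) + k⁻ I w ŵ e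
      predicted-charge {r} {e} {OPT} compat@(w∈I , agree) hits (l , u , eq , c , x) = by-count (k⁻ I w ŵ e) refl
        where
        Ie : I e ≡ op l u
        Ie = proj₂ (open⇒hidden {r} eq)
        l<u : l ℚ.< u
        l<u = op-nonempty Ie (w∈I e)
        module _ (keq : k⁻ I w ŵ e ≡ 0) where
          region : ∀ h → h ≢ e → sameRegion (w h) (ŵ h) l u ≡ true
          region h h≢e = subst (λ i → sameRegion (w h) (ŵ h) (lo i) (hi i) ≡ true) Ie (k⁻-zero e keq h h≢e)
          below : ∀ h → h ≢ e → val r h ℚ.< u → w h ℚ.< u
          below h h≢e p with r h in rh
          ... | just q = subst (ℚ._< u) (agree h q rh) p
          ... | nothing with w h ℚₚ.<? u
          ... | yes q = q
          ... | no q = ⊥-elim (true≢false (region h h≢e) (sameRegion-above l<u (ℚₚ.≮⇒≥ q) p))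
          above : ∀ h → h ≢ e → l ℚ.< val r h → l ℚ.< w h
          above h h≢e p with r h in rh
          ... | just q = subst (l ℚ.<_) (agree h q rh) p
          ... | nothing with l ℚₚ.<? w h
          ... | yes q = q
          ... | no q = ⊥-elim (true≢false (region h h≢e) (sameRegion-below l<u (ℚₚ.≮⇒≥ q) p))
          truly : Mandatory I w e
          truly = l , u , Ie , mapCircuit (graphMinty ends) below c , mapCocircuit (graphMinty ends) above x
        by-count : ∀ k → k⁻ I w ŵ e ≡ k → 1 ≤ indicator (OPT e) + k
        by-count (suc k) _ = ≤-trans (s≤s z≤n) (ℕₚ.m≤n+m _ (indicator (OPT e)))
        by-count zero keq rewrite hits w (λ _ _ → refl) w∈I e (truly keq) = s≤s z≤n

    query-sum : ∀ (f : Fin m → ℕ) {r e} q → r e ≡ nothing →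
      Σℕ (λ h → if queried (set r e q) h then f h else 0) ≡ f e + Σℕ (λ h → if queried r h then f h else 0)
    query-sum f {r} {e} q re = trans (Σℕ-insert e same (zero-at re)) (cong (_+ _) at-e)
      where
      same : ∀ h → h ≢ e → (if queried (set r e q) h then f h else 0) ≡ (if queried r h then f h else 0)
      same h h≢e rewrite set-off {r = r} {e} {q} h≢e = refl
      zero-at : r e ≡ nothing → (if queried r e then f e else 0) ≡ 0
      zero-at re rewrite re = refl
      at-e : (if queried (set r e q) e then f e else 0) ≡ f e
      at-e rewrite set-at {r = r} {e} {q} = refl

    query-count : ∀ {r e} q → r e ≡ nothing → ∣ queried (set r e q) ∣ ≡ suc ∣ queried r ∣
    query-count = query-sum (λ _ → 1)

    hitCount : EdgeSet m → Revealed m → EdgeSet m → ℕ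
    hitCount OPT r D = ∣ (queried r ∪ D) ∩ OPT ∣

    module _ (OPT : EdgeSet m) where
      query-hit : ∀ {r e D} q → r e ≡ nothing → D e ≡ false → hitCount OPT (set r e q) D ≡ indicator (OPT e) + hitCount OPT r D
      query-hit {r} {e} {D} q re De = trans (Σℕ-insert e same zero-at) (cong (_+ hitCount OPT r D) at-e)
        where
        same : ∀ h → h ≢ e → indicator (((queried (set r e q) ∪ D) ∩ OPT) h) ≡ indicator (((queried r ∪ D) ∩ OPT) h)
        same h h≢e rewrite set-off {r = r} {e} {q} h≢e = refl
        zero-at : indicator (((queried r ∪ D) ∩ OPT) e) ≡ 0
        zero-at rewrite re | De = refl
        at-e : indicator (((queried (set r e q) ∪ D) ∩ OPT) e) ≡ indicator (OPT e)
        at-e rewrite set-at {r = r} {e} {q} = refl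

      drop-hit : ∀ {r e D} → r e ≡ nothing → D e ≡ false → hitCount OPT r (D ⊕ e) ≡ indicator (OPT e) + hitCount OPT r D
      drop-hit {r} {e} {D} re De = trans (Σℕ-insert e same zero-at) (cong (_+ hitCount OPT r D) at-e)
        where
        same : ∀ h → h ≢ e → indicator (((queried r ∪ (D ⊕ e)) ∩ OPT) h) ≡ indicator (((queried r ∪ D) ∩ OPT) h)
        same h h≢e with h ≟ e
        ... | yes p = ⊥-elim (h≢e p)
        ... | no _ = refl
        zero-at : indicator (((queried r ∪ D) ∩ OPT) e) ≡ 0
        zero-at rewrite re | De = refl
        at-e : indicator (((queried r ∪ (D ⊕ e)) ∩ OPT) e) ≡ indicator (OPT e)
        at-e rewrite re | ⊕-added {S = D} {e} = refl

    module _ (w : Values) where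
      charge : EdgeSet m → Revealed m → EdgeSet m → ℕ
      charge OPT r D = hitCount OPT r D + k⁺Set I w ŵ (queried r) + k⁻Set I w ŵ (queried r)

      module _ (OPT : EdgeSet m) where
        query-charge : ∀ {r e D} q → r e ≡ nothing → D e ≡ false →
          charge OPT (set r e q) D ≡ (indicator (OPT e) + k⁺ I w ŵ e + k⁻ I w ŵ e) + charge OPT r D
        query-charge {r} {e} {D} q re De = trans
          (cong₂ _+_ (cong₂ _+_ (query-hit OPT {r} {e} {D} q re De) (query-sum (k⁺ I w ŵ) {r} {e} q re)) (query-sum (k⁻ I w ŵ) {r} {e} q re))
          (lem (indicator (OPT e)) (k⁺ I w ŵ e) (k⁻ I w ŵ e) (hitCount OPT r D) (k⁺Set I w ŵ (queried r)) (k⁻Set I w ŵ (queried r)))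
          where
          lem : ∀ a b c d e f → (a + d) + (b + e) + (c + f) ≡ (a + b + c) + (d + e + f)
          lem = solve-∀

        drop-charge : ∀ {r e D} → r e ≡ nothing → D e ≡ false → charge OPT r (D ⊕ e) ≡ indicator (OPT e) + charge OPT r D
        drop-charge {r} {e} {D} re De = trans
          (cong (λ z → z + k⁺Set I w ŵ (queried r) + k⁻Set I w ŵ (queried r)) (drop-hit OPT {r} {e} {D} re De))
          (lem (indicator (OPT e)) (hitCount OPT r D) (k⁺Set I w ŵ (queried r)) (k⁻Set I w ŵ (queried r)))
          where
          lem : ∀ a d e f → (a + d) + e + f ≡ a + (d + e + f)
          lem = solve-∀

-- The strategy, built together with its guarantee

module Construction where

  open Preliminaries
  open QueryStates
  open GraphWalks using (_⊕_)
  open Reductions using (graphMinty)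
  open Strategies
  open Accounting
  open import Data.Nat using (_+_; _≤_)
  open import Data.Nat.Properties using (≤-trans; ≤-refl; ≤-reflexive; +-mono-≤; +-monoˡ-≤)
  open import Data.Rational using (ℚ)

  _∈I?_ : ∀ q i → Dec (q ∈I i)
  q ∈I? pt a = q ℚ.≟ a
  q ∈I? op l u = (l ℚₚ.<? q) ×-dec (q ℚₚ.<? u)

  accumulate₂ : ∀ {z x y a b c} → b ≡ x + a → c ≡ y + b → z ≤ y + x → z + a ≤ c
  accumulate₂ {z} {x} {y} {a} refl refl le = ≤-trans (+-monoˡ-≤ a le) (≤-reflexive (ℕₚ.+-assoc y x a))

  accumulate₃ : ∀ {z x y t a b c d} → b ≡ x + a → c ≡ y + b → d ≡ t + c → z ≤ (t + y) + x → z + a ≤ d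
  accumulate₃ {z} {x} {y} {t} {a} refl refl refl le = ≤-trans (+-monoˡ-≤ a le)
    (≤-reflexive (trans (ℕₚ.+-assoc (t + y) x a) (ℕₚ.+-assoc t y (x + a))))

  module Builder (γ : ℕ) (2≤γ : 2 ≤ γ) {n m} (ends : Fin m → Fin n × Fin n) (I : Fin m → Interval) (ŵ : Fin m → ℚ) where
    open Game ends I ŵ
    open Steps {γ} 2≤γ

    -- Openness supplies the strict inequalities at the limits that allow one dropped edge to be
    -- removed without disturbing the others.
    Droppable : Revealed m → EdgeSet m → Set
    Droppable r D = ∀ d → D d ≡ true → (r d ≡ nothing) × (∃₂ λ l u → I d ≡ op l u) × Det (J r) d

    State : Set
    State = Revealed m × EdgeSet m

    Inv : ℕ → State → Values → EdgeSet m → Set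
    Inv p (r , D) w OPT = Balanced γ ∣ queried r ∣ (hitCount OPT r D) (charge w OPT r D) p

    -- The balance at `r` depends on `w` and `OPT`, which the strategy does not know. It therefore
    -- enters as a hypothesis `Φ` on `OPT`, and the final balance is what is asserted.
    Goal : (EdgeSet m → Set) → Values → Revealed m → Strategy m → Set
    Goal Φ w r t = Fresh w t r × ∃ λ D → Droppable (final w t r) D ×
      (∀ g → ¬ Mandatory (J (final w t r)) (val (final w t r)) g) ×
      (∀ OPT → Hits w OPT → Φ OPT → ∃ λ p → (p + 2 ≤ γ) × Inv p (final w t r , D) w OPT)

    Plan : Revealed m → (Values → EdgeSet m → Set) → Set
    Plan r Φ = Σ (Strategy m) λ t → ∀ w → Compat w r → Goal (Φ w) w r t

    weaken : ∀ {r} {Φ Ψ : Values → EdgeSet m → Set} → (∀ w → Compat w r → ∀ OPT → Hits w OPT → Φ w OPT → Ψ w OPT) → Plan r Ψ → Plan r Φ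
    weaken i (t , goal) = t , λ w comp → let (fresh , D , ok , none , bound) = goal w comp in
      fresh , D , ok , none , λ OPT hits φ → bound OPT hits (i w comp OPT hits φ)

    askPlan : ∀ {r Φ} e → r e ≡ nothing → (∀ q → q ∈I I e → Plan (set r e q) Φ) → Plan r Φ
    askPlan {r} {Φ} e re k = ask e (proj₁ ∘ plan) , λ w comp →
      let (fresh , rest) = proj₂ (plan (w e)) w (compat-set {w} {r} {e} comp) in (re , fresh) , rest
      where
      plan : ∀ q → Plan (set r e q) Φ
      plan q with q ∈I? I e
      ... | yes p = k q p
      -- An answer outside the interval never occurs, but the continuation is a total function on
      -- the rationals.
      ... | no ¬p = stop , λ w comp → ⊥-elim (¬p (subst (_∈I I e) (sym (proj₂ (compat-unset {r = r} {e} re comp))) (proj₁ comp e)))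

    not-dropped : ∀ {r D e} → Droppable r D → Undet (J r) e → D e ≡ false
    not-dropped {r} {D} {e} ok und with bool-dec (D e)
    ... | inj₂ q = q
    ... | inj₁ q = ⊥-elim (det⇒¬undet {J r} {e} (proj₂ (proj₂ (ok e q))) und)

    set-droppable : ∀ {r D e q} → Droppable r D → r e ≡ nothing → D e ≡ false → q ∈I I e → Droppable (set r e q) D
    set-droppable {r} {D} {e} {q} ok re De q∈ d Dd = let (rd , od , det) = ok d Dd in
      trans (set-off {r = r} {e} {q} d≢e) rd , od , det-set {r} {e} re q∈ d≢e det
      where
      d≢e : d ≢ e
      d≢e refl = true≢false Dd De

    add-droppable : ∀ {r D e l u} → Droppable r D → r e ≡ nothing → I e ≡ op l u → Det (J r) e → Droppable r (D ⊕ e)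
    add-droppable {r} {D} {e} ok re oe det d Dd with d ≟ e
    ... | yes refl = re , (_ , _ , oe) , det
    ... | no d≢e = ok d Dd

    fuel-step : ∀ {r : Revealed m} {e f} q → r e ≡ nothing → ∣ hidden r ∣ ≤ suc f → ∣ hidden (set r e q) ∣ ≤ f
    fuel-step {r} {e} q re le = ℕₚ.≤-pred (≤-trans (≤-reflexive (sym (hidden-set {r = r} {e} q re))) le)

    fuel-weak : ∀ {r : Revealed m} {e f} q → r e ≡ nothing → ∣ hidden r ∣ ≤ f → ∣ hidden (set r e q) ∣ ≤ f
    fuel-weak {r} {e} q re le = ≤-trans (ℕₚ.n≤1+n _) (≤-trans (≤-reflexive (sym (hidden-set {r = r} {e} q re))) le)

    no-fuel : ∀ {r : Revealed m} {e} → r e ≡ nothing → ¬ (∣ hidden r ∣ ≤ 0)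
    no-fuel {r} {e} re le with ≤-trans (≤-reflexive (sym (hidden-set {r = r} {e} (ŵ e) re))) le
    ... | ()

    module Query {w : Values} {OPT : EdgeSet m} where
      ι : Fin m → ℕ
      ι e = indicator (OPT e)

      total : Fin m → ℕ
      total e = ι e + k⁺ I w ŵ e + k⁻ I w ŵ e

      ι≤total : ∀ e → ι e ≤ total e
      ι≤total e = ≤-trans (ℕₚ.m≤m+n (ι e) (k⁺ I w ŵ e)) (ℕₚ.m≤m+n _ _)

      k⁺≤total : ∀ e → k⁺ I w ŵ e ≤ total e
      k⁺≤total e = ≤-trans (ℕₚ.m≤n+m _ (ι e)) (ℕₚ.m≤m+n _ _)

      ι+k⁻≤total : ∀ e → ι e + k⁻ I w ŵ e ≤ total e
      ι+k⁻≤total e = +-monoˡ-≤ (k⁻ I w ŵ e) (ℕₚ.m≤m+n (ι e) (k⁺ I w ŵ e))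

      ι-hit : ∀ {e} → OPT e ≡ true → 1 ≤ ι e
      ι-hit eq rewrite eq = ≤-refl

      mandatory-hit : ∀ {r e} → Hits w OPT → Compat w r → Mandatory (J r) w e → 1 ≤ ι e
      mandatory-hit {r} {e} hits comp mand = ι-hit (hits w (λ _ _ → refl) (proj₁ comp) e (mandatory-initial {r} mand))

    Build : ℕ → Set
    Build f = ∀ r D p → Legal r → Droppable r D → ∣ hidden r ∣ ≤ f → p + 2 ≤ γ → Plan r (Inv p (r , D))

    module _ (ŵ∈I : ∀ e → ŵ e ∈I I e) {f : ℕ} (build : Build f) {r : Revealed m} {D : EdgeSet m} {p : ℕ} (legal : Legal r) (ok : Droppable r D)
             (fuel : ∣ hidden r ∣ ≤ suc f) (p≤ : p + 2 ≤ γ) where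

      query-known : ∀ e → KM (J r) (val r) (val∈J ŵ∈I r) e → Plan r (Inv p (r , D))
      query-known e km = askPlan e re λ q q∈ → weaken (step q)
        (build (set r e q) D p (set-legal {r} {e} legal q∈) (set-droppable {r} {D} {e} ok re De q∈) (fuel-step {r} {e} q re fuel) p≤)
        where
        mand : ∀ x → x ∈J J r → Mandatory (J r) x e
        mand x x∈ = km⇒mandatory (J r) (val r) (val∈J ŵ∈I r) x∈ km
        v∈ = val∈J ŵ∈I r
        re = mandatory-hidden {r} (mand (val r) v∈)
        De = not-dropped {r} {D} ok (mandatory⇒undet v∈ (mand (val r) v∈))
        step : ∀ q w → Compat w (set r e q) → ∀ OPT → Hits w OPT → Inv p (r , D) w OPT → Inv p (set r e q , D) w OPT
        step q w comp OPT hits = known-step (query-count {r} {e} q re)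
          (≤-trans (+-monoˡ-≤ _ hit) (≤-reflexive (sym (query-hit OPT {r} {e} {D} q re De))))
          (≤-trans (+-monoˡ-≤ _ (≤-trans hit (ι≤total e))) (≤-reflexive (sym (query-charge w OPT {r} {e} {D} q re De))))
          where
          open Query {w} {OPT}
          comp₀ = proj₁ (compat-unset {r = r} {e} re comp)
          hit : 1 ≤ ι e
          hit = mandatory-hit {r} hits comp₀ (mand w (compat⇒∈J {w} {r} comp₀))

      query-predicted : ∀ e → Mandatory (J r) (val r) e → suc p + 2 ≤ γ → Plan r (Inv p (r , D))
      query-predicted e pm p< = askPlan e re λ q q∈ → weaken (step q)
        (build (set r e q) D (suc p) (set-legal {r} {e} legal q∈) (set-droppable {r} {D} {e} ok re De q∈) (fuel-step {r} {e} q re fuel) p<)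
        where
        re = mandatory-hidden {r} pm
        De = not-dropped {r} {D} ok (mandatory⇒undet (val∈J ŵ∈I r) pm)
        step : ∀ q w → Compat w (set r e q) → ∀ OPT → Hits w OPT → Inv p (r , D) w OPT → Inv (suc p) (set r e q , D) w OPT
        step q w comp OPT hits = predicted-step (query-count {r} {e} q re)
          (≤-trans (ℕₚ.m≤n+m _ (ι e)) (≤-reflexive (sym (query-hit OPT {r} {e} {D} q re De))))
          (≤-trans (+-monoˡ-≤ _ (≤-trans (predicted-charge w {r} {e} (proj₁ (compat-unset {r = r} {e} re comp)) hits pm) (ι+k⁻≤total e)))
            (≤-reflexive (sym (query-charge w OPT {r} {e} {D} q re De))))
          where open Query {w} {OPT}

      module Batch (cfg : Config (J r) (val r) (val∈J ŵ∈I r)) (p≡ : p + 2 ≡ γ) where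
        open Config cfg renaming (main to e; companion to f₁)
        v∈ = val∈J ŵ∈I r

        pm : Mandatory (J r) (val r) e
        pm = forces (val r) v∈ good-predicted
        re = mandatory-hidden {r} pm
        De = not-dropped {r} {D} ok (mandatory⇒undet v∈ pm)
        rf = undet-hidden {r} undet-companion
        Df = not-dropped {r} {D} ok undet-companion

        open-companion : ∃₂ λ l u → I f₁ ≡ op l u
        open-companion = let (l , u , eq , _) = undet-companion in l , u , proj₂ (open⇒hidden {r} eq)

        val-companion : val r f₁ ≡ ŵ f₁
        val-companion rewrite rf = refl

        J-companion : J r f₁ ≡ I f₁
        J-companion rewrite rf = refl

        J-main : J r e ≡ I e
        J-main rewrite re = refl

        module AfterMain (q : ℚ) (q∈ : q ∈I I e) where
          r₁ = set r e q
          legal₁ = set-legal {r} {e} legal q∈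
          ok₁ = set-droppable {r} {D} {e} ok re De q∈
          fuel₁ : ∣ hidden r₁ ∣ ≤ f
          fuel₁ = fuel-step {r} {e} q re fuel
          v∈₁ = val∈J ŵ∈I r₁
          r₁f : r₁ f₁ ≡ nothing
          r₁f = trans (set-off {r = r} {e} {q} distinct) rf

          module Facts {w OPT} (comp₁ : Compat w r₁) (hits : Hits w OPT) where
            open Query {w} {OPT} public
            comp : Compat w r
            comp = proj₁ (compat-unset {r = r} {e} re comp₁)
            charged : 1 ≤ total e
            charged = ≤-trans (predicted-charge w {r} {e} comp hits pm) (ι+k⁻≤total e)
            -- Replacing the value of the companion by its prediction makes e mandatory.
            pair : 1 ≤ ι e + ι f₁
            pair = pair-hit {w} {OPT} {x} {e} {f₁} hits (∈J⇒∈I {x} {r} legal x∈) off (mandatory-initial {r} (forces x x∈ (subst Good (sym at) good-predicted)))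
              where
              x : Values
              x = w [ f₁ ≔ val r f₁ ]
              at : x f₁ ≡ val r f₁
              at = update-at w f₁ _
              off : ∀ h → h ≢ f₁ → x h ≡ w h
              off h = update-off w f₁ _
              x∈ : x ∈J J r
              x∈ = update-elim w f₁ _ (λ h y → y ∈I J r h) (v∈ f₁) (λ h _ → compat⇒∈J {w} {r} comp h)

          -- The two units needed are `k`, which lies in `OPT`, and the charge of `e`, so the
          -- companion can be left alone.
          with-known : ∀ k → KM (J r₁) (val r₁) v∈₁ k → Plan r₁ (Inv p (r , D))
          with-known k km = askPlan k rk λ t t∈ → weaken (step t)
            (build (set r₁ k t) D 0 (set-legal {r₁} {k} legal₁ t∈) (set-droppable {r₁} {D} {k} ok₁ rk Dk t∈) (fuel-weak {r₁} {k} t rk fuel₁) 2≤γ)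
            where
            mand : ∀ x → x ∈J J r₁ → Mandatory (J r₁) x k
            mand x x∈ = km⇒mandatory (J r₁) (val r₁) v∈₁ x∈ km
            rk = mandatory-hidden {r₁} (mand (val r₁) v∈₁)
            Dk = not-dropped {r₁} {D} ok₁ (mandatory⇒undet v∈₁ (mand (val r₁) v∈₁))
            step : ∀ t w → Compat w (set r₁ k t) → ∀ OPT → Hits w OPT → Inv p (r , D) w OPT → Inv 0 (set r₁ k t , D) w OPT
            step t w comp₂ OPT hits = pair-step p≤
              (trans (query-count {r₁} {k} t rk) (cong suc (query-count {r} {e} q re)))
              (accumulate₂ {x = ι e} {ι k} (query-hit OPT {r} {e} {D} q re De) (query-hit OPT {r₁} {k} {D} t rk Dk) (≤-trans hit (ℕₚ.m≤m+n _ _)))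
              (accumulate₂ {x = total e} {total k} (query-charge w OPT {r} {e} {D} q re De) (query-charge w OPT {r₁} {k} {D} t rk Dk)
                (+-mono-≤ (≤-trans hit (ι≤total k)) charged))
              where
              comp₁ = proj₁ (compat-unset {r = r₁} {k} rk comp₂)
              open Facts {w} {OPT} comp₁ hits
              hit : 1 ≤ ι k
              hit = mandatory-hit {r₁} hits comp₁ (mand w (compat⇒∈J {w} {r₁} comp₁))

          -- The charge of `e` covers its query, and the edge of OPT guaranteed by the pair is
          -- counted whether it is `e` or the dropped `f₁`.
          drop-companion : Det (J r₁) f₁ → Plan r₁ (Inv p (r , D))
          drop-companion det = weaken step
            (build r₁ (D ⊕ f₁) 0 legal₁ (add-droppable {r₁} {D} {f₁} ok₁ r₁f (proj₂ (proj₂ open-companion)) det) fuel₁ 2≤γ)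
            where
            step : ∀ w → Compat w r₁ → ∀ OPT → Hits w OPT → Inv p (r , D) w OPT → Inv 0 (r₁ , D ⊕ f₁) w OPT
            step w comp₁ OPT hits = single-step p≤ (query-count {r} {e} q re)
              (accumulate₂ {x = ι e} {ι f₁} (query-hit OPT {r} {e} {D} q re De) (drop-hit OPT {r₁} {f₁} {D} r₁f Df) (≤-trans pair (≤-reflexive (ℕₚ.+-comm (ι e) (ι f₁)))))
              (accumulate₂ {x = total e} {ι f₁} (query-charge w OPT {r} {e} {D} q re De) (drop-charge w OPT {r₁} {f₁} {D} r₁f Df) (≤-trans charged (ℕₚ.m≤n+m _ (ι f₁))))
              where open Facts {w} {OPT} comp₁ hits

          module AfterCompanion (f₂ : Fin m) (wp : WitnessPartner (J r₁) (val r₁) v∈₁ f₁ f₂) (t : ℚ) (t∈ : t ∈I I f₁) where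
            r₂ = set r₁ f₁ t
            legal₂ = set-legal {r₁} {f₁} legal₁ t∈
            ok₂ = set-droppable {r₁} {D} {f₁} ok₁ r₁f Df t∈
            fuel₂ : ∣ hidden r₂ ∣ ≤ f
            fuel₂ = fuel-weak {r₁} {f₁} t r₁f fuel₁

            bad : ¬ Good t → Plan r₂ (Inv p (r , D))
            bad ¬good = weaken step (build r₂ D 0 legal₂ ok₂ fuel₂ 2≤γ)
              where
              step : ∀ w → Compat w r₂ → ∀ OPT → Hits w OPT → Inv p (r , D) w OPT → Inv 0 (r₂ , D) w OPT
              step w comp₂ OPT hits = pair-step p≤
                (trans (query-count {r₁} {f₁} t r₁f) (cong suc (query-count {r} {e} q re)))
                (accumulate₂ {x = ι e} {ι f₁} (query-hit OPT {r} {e} {D} q re De) (query-hit OPT {r₁} {f₁} {D} t r₁f Df) (≤-trans pair (≤-reflexive (ℕₚ.+-comm (ι e) (ι f₁)))))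
                (accumulate₂ {x = total e} {total f₁} (query-charge w OPT {r} {e} {D} q re De) (query-charge w OPT {r₁} {f₁} {D} t r₁f Df)
                  (+-mono-≤ (≤-trans error (k⁺≤total f₁)) charged))
                where
                comp₁ = proj₁ (compat-unset {r = r₁} {f₁} r₁f comp₂)
                t≡ = proj₂ (compat-unset {r = r₁} {f₁} r₁f comp₂)
                open Facts {w} {OPT} comp₁ hits
                error : 1 ≤ k⁺ I w ŵ f₁
                error = k⁺-positive w f₁ e (distinct ∘ sym)
                  (subst₂ (λ v i → sameRegion (w f₁) v (lo i) (hi i) ≡ false) val-companion J-main (wrong (w f₁) (subst (¬_ ∘ Good) t≡ ¬good)))

            -- A good value of `f₁` need not come with an error, so `f₁` and `f₂` together guarantee
            -- only one unit, from the pair they form; the other comes from `e`, which the value of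
            -- `f₁` makes mandatory.
            good : Good t → Plan r₂ (Inv p (r , D))
            good g = askPlan f₂ r₂f λ s s∈ → weaken (step s)
              (build (set r₂ f₂ s) D 0 (set-legal {r₂} {f₂} legal₂ s∈) (set-droppable {r₂} {D} {f₂} ok₂ r₂f Df₂ s∈) (fuel-weak {r₂} {f₂} s r₂f fuel₂) 2≤γ)
              where
              f₂≢f₁ = proj₁ wp
              r₁f₂ = undet-hidden {r₁} (proj₁ (proj₂ wp))
              r₂f : r₂ f₂ ≡ nothing
              r₂f = trans (set-off {r = r₁} {f₁} {t} f₂≢f₁) r₁f₂
              -- Read off in `r₁`, since the value of `f₁` may have determined `f₂` in the meantime.
              Df₂ = not-dropped {r₁} {D} ok₁ (proj₁ (proj₂ wp))
              step : ∀ s w → Compat w (set r₂ f₂ s) → ∀ OPT → Hits w OPT → Inv p (r , D) w OPT → Inv 0 (set r₂ f₂ s , D) w OPT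
              step s w comp₃ OPT hits = triple-step p≡
                (trans (query-count {r₂} {f₂} s r₂f) (cong suc (trans (query-count {r₁} {f₁} t r₁f) (cong suc (query-count {r} {e} q re)))))
                (accumulate₃ {x = ι e} {ι f₁} {ι f₂} (query-hit OPT {r} {e} {D} q re De) (query-hit OPT {r₁} {f₁} {D} t r₁f Df) (query-hit OPT {r₂} {f₂} {D} s r₂f Df₂)
                  (+-mono-≤ pair₂ hit))
                (accumulate₃ {x = total e} {total f₁} {total f₂} (query-charge w OPT {r} {e} {D} q re De) (query-charge w OPT {r₁} {f₁} {D} t r₁f Df) (query-charge w OPT {r₂} {f₂} {D} s r₂f Df₂)
                  (+-mono-≤ (≤-trans pair₂ (+-mono-≤ (ι≤total f₂) (ι≤total f₁))) charged))
                where
                comp₂ = proj₁ (compat-unset {r = r₂} {f₂} r₂f comp₃)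
                comp₁ = proj₁ (compat-unset {r = r₁} {f₁} r₁f comp₂)
                t≡ = proj₂ (compat-unset {r = r₁} {f₁} r₁f comp₂)
                open Facts {w} {OPT} comp₁ hits
                hit : 1 ≤ ι e
                hit = mandatory-hit {r} hits comp (forces w (compat⇒∈J {w} {r} comp) (subst Good t≡ g))
                pair₂ : 1 ≤ ι f₂ + ι f₁
                pair₂ = pair-hit {w} {OPT} {x} {f₂} {f₁} hits (∈J⇒∈I {x} {r₁} legal₁ x∈) off (mandatory-initial {r₁} (proj₂ (proj₂ (proj₂ (proj₂ wp))) x x∈ at))
                  where
                  y = proj₁ (proj₂ (proj₂ wp))
                  x : Values
                  x = w [ f₁ ≔ y ]
                  at : x f₁ ≡ y
                  at = update-at w f₁ y
                  off : ∀ h → h ≢ f₁ → x h ≡ w h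
                  off h = update-off w f₁ y
                  x∈ : x ∈J J r₁
                  x∈ = update-elim w f₁ y (λ h z → z ∈I J r₁ h) (proj₁ (proj₂ (proj₂ (proj₂ wp)))) (λ h _ → compat⇒∈J {w} {r₁} comp₁ h)

            plan : Plan r₂ (Inv p (r , D))
            plan with good? t
            ... | yes g = good g
            ... | no ¬g = bad ¬g

          plan : Plan r₁ (Inv p (r , D))
          plan with any? (km? (J r₁) (val r₁) v∈₁)
          ... | yes (k , km) = with-known k km
          ... | no none with det-or-undet {J r₁} {f₁} (trans (trans (J-set-off {r} {e} {q} distinct) J-companion) (proj₂ (proj₂ open-companion)))
          ... | inj₁ det = drop-companion det
          ... | inj₂ und with witness-partner (J r₁) (val r₁) v∈₁ (λ k km → none (k , km)) f₁ und
          -- The partner is fixed before `f₁` is queried, while `f₁` may still take the value that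
          -- makes `f₂` mandatory.
          ... | f₂ , wp = askPlan f₁ r₁f λ t t∈ → AfterCompanion.plan f₂ wp t t∈

        plan : Plan r (Inv p (r , D))
        plan = askPlan e re λ q q∈ → AfterMain.plan q q∈

    build : (∀ e → ŵ e ∈I I e) → ∀ f → Build f
    build ŵ∈I f r D p legal ok fuel p≤ with verdict (J r) (val r) (val∈J ŵ∈I r)
    build ŵ∈I f r D p legal ok fuel p≤ | free none = stop , λ w comp → tt , D , ok , none , λ OPT hits inv → p , p≤ , inv
    build ŵ∈I zero r D p legal ok fuel p≤ | known e km = ⊥-elim (no-fuel {r} {e} (mandatory-hidden {r} (km⇒mandatory (J r) (val r) v∈ v∈ km)) fuel)
      where v∈ = val∈J ŵ∈I r
    build ŵ∈I zero r D p legal ok fuel p≤ | predicted _ g pm = ⊥-elim (no-fuel {r} {g} (mandatory-hidden {r} pm) fuel)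
    build ŵ∈I (suc f) r D p legal ok fuel p≤ | known e km = query-known ŵ∈I (build ŵ∈I f) legal ok fuel p≤ e km
    build ŵ∈I (suc f) r D p legal ok fuel p≤ | predicted none g pm with suc p + 2 ℕ.≤? γ
    ... | yes p< = query-predicted ŵ∈I (build ŵ∈I f) legal ok fuel p≤ g pm p<
    -- The savings have reached exactly `γ - 2`, as the fourth ending requires.
    ... | no p≮ = Batch.plan ŵ∈I (build ŵ∈I f) legal ok fuel p≤ (config (J r) (val r) (val∈J ŵ∈I r) none g pm) (ℕₚ.≤-antisym p≤ (ℕₚ.≤-pred (ℕₚ.≰⇒> p≮)))

-- The algorithm, its final state and the remaining instance

open Preliminaries
open MintySystems
open QueryStates
open SpanningTrees
open Reductions
open Strategies
open Accounting
open Construction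
open import Data.Nat using (_+_; _*_; _∸_; _≤_; z≤n)
open import Data.Nat.Properties using (≤-trans; +-monoʳ-≤)
import Data.Rational
open import Data.Rational using (ℚ; 0ℚ)

unrevealed : ∀ {m} → Revealed m
unrevealed _ = nothing

Σℕ-zero : ∀ {m} {f : Fin m → ℕ} → (∀ h → f h ≡ 0) → Σℕ f ≡ 0
Σℕ-zero {zero} _ = refl
Σℕ-zero {suc m} p rewrite p zero = Σℕ-zero (p ∘ suc)

module _ (γ : ℕ) (2≤γ : 2 ≤ γ) where

  module _ {n m} (ends : Fin m → Fin n × Fin n) (I : Fin m → Interval) (ŵ : Fin m → ℚ) where
    open Builder γ 2≤γ ends I ŵ
    open Game ends I ŵ

    initial-plan : (∀ e → ŵ e ∈I I e) → Plan unrevealed (Inv 0 (unrevealed , λ _ → false))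
    initial-plan ŵ∈I = build ŵ∈I m unrevealed (λ _ → false) 0 (λ _ _ ()) (λ _ ()) (∣∣≤m (hidden {m} unrevealed)) 2≤γ

    strategy : Dec (∀ e → ŵ e ∈I I e) → Strategy m
    strategy (yes ŵ∈I) = proj₁ (initial-plan ŵ∈I)
    -- Reached only for predictions outside their intervals, where an `Algorithm` must still be
    -- defined.
    strategy (no _) = stop

    strategy-goal : (d : Dec (∀ e → ŵ e ∈I I e)) → (∀ e → ŵ e ∈I I e) → ∀ w → (∀ e → w e ∈I I e) →
      Goal (Inv 0 (unrevealed , λ _ → false) w) w unrevealed (strategy d)
    strategy-goal (yes ŵ∈I) _ w w∈I = proj₂ (initial-plan ŵ∈I) w (w∈I , λ _ _ ())
    strategy-goal (no ¬ŵ∈I) ŵ∈I = ⊥-elim (¬ŵ∈I ŵ∈I)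

    initially-balanced : ∀ w OPT → Inv 0 (unrevealed , λ _ → false) w OPT
    initially-balanced w OPT rewrite Σℕ-zero {m} {λ _ → 0} (λ _ → refl) | ℕₚ.*-zeroʳ γ = z≤n , z≤n

    -- A vector that agrees with `w` on `OPT` and respects the intervals is among the assignments
    -- for which the tree of a feasible set must be optimal, so `forced` applies to it.
    optimal-hits : ∀ {w OPT} → IsOPT ends I w OPT → Hits w OPT
    optimal-hits {w} {OPT} (feasible , _) x same x∈I e (l , u , eq , c , k) =
      T.forced I w feasible x (λ h _ → same h , x∈I h) refl eq (toCircuitOn ends c) (toCutOn ends k)
      where module T = Trees (fullGraph ends) (λ _ _ → refl , refl)

    final-compat : ∀ {w} t {r} → Compat w r → Compat w (final w t r)
    final-compat stop c = c
    final-compat {w} (ask e k) {r} c = final-compat (k (w e)) (compat-set {w} {r} {e} c)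

    -- `state` is what `run` computes and `r` what the decision tree computes. They agree only
    -- pointwise, so facts about `r` are transported edge by edge.
    module Outcome (conn : Connected (fullGraph ends)) (ŵ∈I : ∀ e → ŵ e ∈I I e) {w : Fin m → ℚ}
                   (t : Strategy m) (r : Revealed m) (compat : Compat w r)
                   (state : Fin m → Maybe ℚ) (state≗r : ∀ e → state e ≡ r e)
                   (D : EdgeSet m) (ok : Droppable r D) (none : ∀ g → ¬ Mandatory (J r) (val r) g) where

      ALG : EdgeSet m
      ALG e = is-just (state e)

      J≡rem : ∀ h → J r h ≡ remI I w ALG h
      J≡rem h with state h | state≗r h | proj₂ compat h
      ... | x | eq | agree with r h
      J≡rem h | .nothing | refl | agree | nothing = refl
      J≡rem h | .(just q) | refl | agree | just q = cong pt (agree q refl)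

      val≡rem : ∀ h → val r h ≡ remŵ ŵ w ALG h
      val≡rem h with state h | state≗r h | proj₂ compat h
      ... | x | eq | agree with r h
      val≡rem h | .nothing | refl | agree | nothing = refl
      val≡rem h | .(just q) | refl | agree | just q = agree q refl

      v : Fin m → ℚ
      v = remŵ ŵ w ALG

      v∈J : ∀ h → v h ∈I remI I w ALG h
      v∈J h = subst₂ _∈I_ (val≡rem h) (J≡rem h) (val∈J ŵ∈I r h)

      open Reduction ends hiding (φ)

      dropped : List (Fin m)
      dropped = filter (λ d → D d Boolₚ.≟ true) (allFin m)

      in-D : ∀ {d} → d ∈ dropped → D d ≡ true
      in-D i = proj₂ (∈-filter⁻ (λ d → D d Boolₚ.≟ true) {xs = allFin m} i)

      dropped-open : ∀ d → d ∈ dropped → ∃₂ λ l u → remI I w ALG d ≡ op l u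
      dropped-open d i with ok d (in-D i)
      ... | rd , (l , u , eq) , _ = l , u , trans (sym (J≡rem d)) (trans (cong (maybe pt (I d)) rd) eq)

      initially-free : Free I w ALG v v∈J initState
      initially-free g _ (l , u , eq) with ¬mandatory⇒blocked {J r} {val r} {g} (trans (J≡rem g) eq) (none g)
      ... | inj₁ c = inj₁ (initialCircuit (toCircuitOn ends (mapCircuit (graphMinty ends)
              (λ h _ → subst₂ ℚ._≤_ (val≡rem h) (sym (cong lo eq))) c)))
      ... | inj₂ x = inj₂ (initialCut (toCutOn ends (mapCocircuit (graphMinty ends)
              (λ h _ → subst₂ ℚ._≤_ (sym (cong hi eq)) (val≡rem h)) x)))

      determined : ∀ d → d ∈ dropped → alive {n} initState d ≡ true → Determined (remI I w ALG) (ordered I w ALG v v∈J) initState d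
      determined d i _ with proj₂ (proj₂ (ok d (in-D i)))
      ... | inj₁ c = inj₁ (initialCircuit (toCircuitOn ends (mapCircuit (graphMinty ends)
              (λ h _ → subst₂ ℚ._≤_ (cong hi (J≡rem h)) (cong lo (J≡rem d))) c)))
      ... | inj₂ x = inj₂ (initialCut (toCutOn ends (mapCocircuit (graphMinty ends)
              (λ h _ → subst₂ ℚ._≤_ (cong hi (J≡rem d)) (cong lo (J≡rem h))) x)))

      reduced = reduceAll I w ALG v v∈J dropped initState (initial-valid conn) dropped-open determined initially-free

      same-queried : ∀ h → queried r h ≡ ALG h
      same-queried h = cong is-just (sym (state≗r h))

      -- The savings left in `p` are given away in the first bound; as a debt of at most `γ - 2`,
      -- `p` becomes the additive term of the second.
      bounds : ∀ OPT p → p + 2 ≤ γ → Inv p (r , D) w OPT →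
        (γ * ∣ ALG ∣ ≤ (γ + 1) * (∣ (ALG ∪ D) ∩ OPT ∣ + k⁺Set I w ŵ ALG + k⁻Set I w ŵ ALG)) ×
        (∣ ALG ∣ ≤ γ * ∣ (ALG ∪ D) ∩ OPT ∣ + (γ ∸ 2))
      bounds OPT p p≤ (b₁ , b₂) =
        subst₂ _≤_ (cong (γ *_) size) (cong ((γ + 1) *_) (cong₂ _+_ (cong₂ _+_ hit (sum (k⁺ I w ŵ))) (sum (k⁻ I w ŵ)))) (≤-trans (ℕₚ.m≤m+n _ p) b₁) ,
        subst₂ _≤_ size (cong (λ z → γ * z + (γ ∸ 2)) hit) (≤-trans b₂ (+-monoʳ-≤ (γ * hitCount OPT r D) (ℕₚ.m+n≤o⇒m≤o∸n p p≤)))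
        where
        sum : ∀ (f : Fin m → ℕ) → Σℕ (λ h → if queried r h then f h else 0) ≡ Σℕ (λ h → if ALG h then f h else 0)
        sum f = Σℕ-cong (λ h → cong (λ b → if b then f h else 0) (same-queried h))
        size : ∣ queried r ∣ ≡ ∣ ALG ∣
        size = sum (λ _ → 1)
        hit : hitCount OPT r D ≡ ∣ (ALG ∪ D) ∩ OPT ∣
        hit = Σℕ-cong (λ h → cong (λ b → if (b ∨ D h) ∧ OPT h then 1 else 0) (same-queried h))

theorem3p6 : (γ : ℕ) → 2 ≤ γ →
    Σ Algorithm λ A →
    ∀ {n m} (ends : Fin m → Fin n × Fin n) (I : Fin m → Interval)
    (w ŵ : Fin m → ℚ) →
    Connected (fullGraph ends) →
    (∀ e → 0ℚ Data.Rational.≤ lo (I e)) →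
    (∀ e → w e ∈I I e) →
    (∀ e → ŵ e ∈I I e) →
    Halts A ends I ŵ w ×
    ∃ λ (s : RState n m) →
    Reduces ends I w (Queried A ends I ŵ w) initState s ×
    PredictionMandatoryFree (current ends s)
    (remI I w (Queried A ends I ŵ w)) (remŵ ŵ w (Queried A ends I ŵ w)) ×
    ∃ λ (D : EdgeSet m) →
    (∀ e → D e ≡ true → (Queried A ends I ŵ w e ≡ false) × (alive s e ≡ false)) ×
    (∀ OPT → IsOPT ends I w OPT →
    (γ * ∣ Queried A ends I ŵ w ∣
    ≤ (γ + 1) * (∣ (Queried A ends I ŵ w ∪ D) ∩ OPT ∣
    + k⁺Set I w ŵ (Queried A ends I ŵ w)
    + k⁻Set I w ŵ (Queried A ends I ŵ w))) ×
    (∣ Queried A ends I ŵ w ∣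
    ≤ γ * ∣ (Queried A ends I ŵ w ∪ D) ∩ OPT ∣ + (γ ∸ 2)))
theorem3p6 γ 2≤γ = A , correct
  where
  ok? : ∀ {m} (I : Fin m → Interval) (ŵ : Fin m → ℚ) → Dec (∀ e → ŵ e ∈I I e)
  ok? I ŵ = all? (λ e → ŵ e ∈I? I e)

  A : Algorithm
  A ends I ŵ r = follow (strategy γ 2≤γ ends I ŵ (ok? I ŵ)) r

  correct : ∀ {n m} (ends : Fin m → Fin n × Fin n) (I : Fin m → Interval) (w ŵ : Fin m → ℚ) → _
  correct {n} {m} ends I w ŵ conn _ w∈I ŵ∈I with strategy-goal γ 2≤γ ends I ŵ (ok? I ŵ) ŵ∈I w w∈I
  ... | fresh , D , ok , none , bound =
    halts , s , reduces , free⇒mandatory-free I w ALG v v∈J valid free-s , D , drop , λ OPT opt →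
      let (p , p≤ , inv) = bound OPT (optimal-hits γ 2≤γ ends I ŵ opt) (initially-balanced γ 2≤γ ends I ŵ w OPT) in bounds OPT p p≤ inv
    where
    t = strategy γ 2≤γ ends I ŵ (ok? I ŵ)
    ran = Replay.run-final A ends I ŵ w m t unrevealed (λ _ → nothing) (λ _ → refl) (λ _ _ → refl) fresh (∣∣≤m (hidden {m} (λ _ → nothing)))
    halts = proj₂ ran
    open Outcome γ 2≤γ ends I ŵ conn ŵ∈I {w} t (final w t unrevealed)
      (final-compat γ 2≤γ ends I ŵ {w} t {unrevealed} (w∈I , λ _ _ ())) (finalState A ends I ŵ w) (proj₁ ran) D ok none
    open Reduction ends
    s = proj₁ reduced
    reduces = proj₁ (proj₂ reduced)
    valid = proj₁ (proj₂ (proj₂ reduced))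
    free-s = proj₁ (proj₂ (proj₂ (proj₂ reduced)))
    gone = proj₂ (proj₂ (proj₂ (proj₂ (proj₂ reduced))))
    drop : ∀ e → D e ≡ true → (ALG e ≡ false) × (alive s e ≡ false)
    drop e De = cong is-just (trans (proj₁ ran e) (proj₁ (ok e De))) , gone e (∈-filter⁺ (λ d → D d Boolₚ.≟ true) (∈-allFin e) De)
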